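{- For every complex number $t$, the following identity of formal power series in $x$ holds: \[ \prod_{n \geq 1}(1-x^n)^{2t^2+t} =\sum_{(\lambda,\mu)} \delta_\lambda \delta_\mu\, x^{|\lambda|+ |\mu|} \prod_{h \in \Delta} \left(1-\frac{2t+2}{h}\right)\left(1-\frac{t+1}{h}\right) \prod_{j=1}^{h-1} \left(1-\left(\frac{2t+2}{h + \tau_j j} \right)^2 \right), \] where the sum ranges over all pairs $(\lambda,\mu)$ with $\lambda$ a self-conjugate partition and $\mu$ a doubled distinct partition, $\Delta=\Delta(\lambda,\mu)$, and $\tau_j=1$ if $j\in\Delta$ and $\tau_j=-1$ otherwise.
   Context: A partition $\lambda=(\lambda_1\ge\dots\ge\lambda_\ell>0)$ has weight $|\lambda|=\sum\lambda_i$, conjugate $\lambda'$, hook lengths $h(i,j)=\lambda_i-j+\lambda'_j-i+1$; its principal hook lengths are $h(i,i)$ for the indices $i$ with $\lambda_i\ge i$; the number of such $i$ is $D(\lambda)$ and $\delta_\lambda=(-1)^{D(\lambda)}$. Self-conjugate: $\lambda=\lambda'$. A doubled distinct partition is either empty or, for integers $a_1>\dots>a_d\ge1$, the partition with $D(\lambda)=d$ and $\lambda_i-i=a_i$, $\lambda'_i-i=a_i-1$ for $i\le d$. For a pair $(\lambda,\mu)$, $\Delta$ is the set consisting of the principal hook lengths of $\lambda$ together with those of $\mu$. For complex $t$ the left side means $\exp\!\big(-(2t^2+t)\sum_{k\ge1}\frac{x^k}{k(1-x^k)}\big)$. -}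

module Defs where

open import Data.Bool using (if_then_else_)
import Data.Nat as N
open import Data.Nat using (ℕ; zero; suc; _∸_; _≤_; _<_; _≥_; _>_; _≤?_; _≟_; _!)
open import Data.Nat.Divisibility using (_∣?_)
open import Data.List using (List; []; _∷_; length; map; filter; upTo; _++_; foldr; deduplicate)
open import Data.Nat.ListAction using (sum)
open import Data.List.Relation.Unary.All using (All)
open import Data.List.Relation.Unary.Linked using (Linked)
open import Data.List.Membership.DecPropositional _≟_ using (_∈?_)
open import Data.Product using (Σ; _×_)
open import Data.Sum using (_⊎_)
open import Relation.Binary.PropositionalEquality using (_≡_)
open import Relation.Nullary.Decidable using (does)
open import Algebra.Bundles using (CommutativeRing)

IsPartition : List ℕ → Set
IsPartition λ′ = All (λ k → 0 < k) λ′ × Linked _≥_ λ′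

weight : List ℕ → ℕ
weight = sum

idx : List ℕ → ℕ → ℕ
idx [] _ = 0
idx (x ∷ xs) zero = x
idx (x ∷ xs) (suc i) = idx xs i

-- λ_i for i ≥ 1 (1-indexed; 0 beyond the length)
part : List ℕ → ℕ → ℕ
part λ′ i = idx λ′ (i ∸ 1)

conjPart : List ℕ → ℕ → ℕ
conjPart λ′ j = length (filter (j ≤?_) λ′)

oneTo : ℕ → List ℕ
oneTo n = map suc (upTo n)

hook : List ℕ → ℕ → ℕ → ℕ
hook λ′ i j = (part λ′ i N.+ conjPart λ′ j N.+ 1) ∸ (i N.+ j)

diagIdx : List ℕ → List ℕ
diagIdx λ′ = filter (λ i → i ≤? part λ′ i) (oneTo (length λ′))

D : List ℕ → ℕ
D λ′ = length (diagIdx λ′)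

principalHooks : List ℕ → List ℕ
principalHooks λ′ = map (λ i → hook λ′ i i) (diagIdx λ′)

SelfConjugate : List ℕ → Set
SelfConjugate λ′ = ∀ i → part λ′ (suc i) ≡ conjPart λ′ (suc i)

DoubledDistinct : List ℕ → Set
DoubledDistinct λ′ =
  λ′ ≡ [] ⊎
  Σ (List ℕ) (λ as → Linked _>_ as × All (1 ≤_) as × D λ′ ≡ length as ×
    (∀ i → suc i ≤ length as →
       (part λ′ (suc i) ≡ idx as i N.+ suc i) × (conjPart λ′ (suc i) N.+ 1 ≡ idx as i N.+ suc i)))

Δset : List ℕ → List ℕ → List ℕ
Δset λ′ μ = deduplicate _≟_ (principalHooks λ′ ++ principalHooks μ)

-- Ring-valued part.  `inv k` is intended to be 1/k (hypothesis in the
-- theorem); formal power series are coefficient functions ℕ → R.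

module RingDefs {c ℓ} (R : CommutativeRing c ℓ) (inv : ℕ → CommutativeRing.Carrier R) where
  open CommutativeRing R

  fromℕ : ℕ → Carrier
  fromℕ zero = 0#
  fromℕ (suc n) = 1# + fromℕ n

  sumR : List Carrier → Carrier
  sumR = foldr _+_ 0#

  prodR : List Carrier → Carrier
  prodR = foldr _*_ 1#

  powR : Carrier → ℕ → Carrier
  powR a zero = 1#
  powR a (suc m) = a * powR a m

  Series : Set c
  Series = ℕ → Carrier

  conv : Series → Series → Series
  conv f g n = sumR (map (λ i → f i * g (n ∸ i)) (upTo (suc n)))

  oneS : Series
  oneS zero = 1#
  oneS (suc n) = 0#

  powS : Series → ℕ → Series
  powS f zero = oneS
  powS f (suc m) = conv f (powS f m)

  -- exp(G) = Σ_m G^m / m!  for G with zero constant term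
  -- (the coefficient of x^n only receives contributions from m ≤ n)
  expS : Series → Series
  expS G n = sumR (map (λ m → inv (m !) * powS G m n) (upTo (suc n)))

  -- coefficients of Σ_{k≥1} x^k / (k (1 - x^k)) = Σ_k Σ_{m≥1} x^{km}/k
  Lser : Series
  Lser n = sumR (map (λ k → if does (k ∣? n) then inv k else 0#) (oneTo n))

  lhs : Carrier → Series
  lhs t = expS (λ n → - ((fromℕ 2 * t * t + t) * Lser n))

  sign : ℕ → Carrier
  sign d = powR (- 1#) d

  shift : List ℕ → ℕ → ℕ → ℕ
  shift Δ h j = if does (j ∈? Δ) then h N.+ j else h ∸ j

  hookFactor : Carrier → List ℕ → ℕ → Carrier
  hookFactor t Δ h =
    (1# - (fromℕ 2 * t + fromℕ 2) * inv h) * (1# - (t + 1#) * inv h) *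
    prodR (map (λ j → 1# - powR ((fromℕ 2 * t + fromℕ 2) * inv (shift Δ h j)) 2)
               (oneTo (h ∸ 1)))

  -- summand for the pair (λ, μ), without the monomial x^{|λ|+|μ|}
  term : Carrier → List ℕ × List ℕ → Carrier
  term t (λ′ Data.Product., μ) =
    sign (D λ′) * sign (D μ) * prodR (map (hookFactor t (Δset λ′ μ)) (Δset λ′ μ))

-- Let Δ be the set of principal hook lengths of (λ, μ).  The self-conjugate λ contributes its odd
-- elements and the doubled distinct μ its even ones, so the right-hand side is a sum over all finite
-- sets Δ of positive integers, |λ| + |μ| being the sum of Δ.  Both coefficients of xⁿ are polynomials
-- in t, so it suffices to treat all large natural numbers t, working modulo xⁿ⁺¹.
--
-- Put M = t + 1, and let pt v be the column of values at v of a basis of the odd polynomials of degree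
-- less than 2t.  By Vandermonde's determinant the summand of Δ is, up to a common factor, the
-- determinant of the columns pt (M ± j), 1 ≤ j ≤ t, with the sign + exactly for j ∈ Δ.  Hence the
-- whole sum is E = det (c₁, …, c_t) with c_j = pt (M − j) − xʲ pt (M + j).
--
-- Replacing one column of a determinant by its image under a linear operator and summing over the
-- columns gives the trace times the determinant.  This is applied to f(v) ↦ f(v + k) + f(v − k), to
-- multiplication by v² and to the double antidifference.  Up to columns c_{j ± k}, which contribute to
-- an alternating form only when they reduce to a multiple of c_j, the two halves of the first operator
-- agree on c_j up to the factor −xᵏ.  The result is x dE/dx = −(2t² + t) Σ_k k xᵏ/(1 − xᵏ) E, the
-- differential equation of the product.
module Submission where

open import Defs
open import Level using (Level; _⊔_; Lift; lift)
open import Data.Bool using (Bool; true; false; if_then_else_)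
open import Data.Nat as N using (ℕ; suc; zero; _∸_; z≤n; s≤s; _!)
import Data.Nat.Properties as ℕₚ
open import Data.Nat.Divisibility using (_∣?_; divides; ∣⇒≤)
open import Data.Nat.ListAction using (sum)
open import Data.Nat.Solver using (module +-*-Solver)
open import Data.Integer as ℤ using (ℤ; -[1+_])
import Data.Integer.Properties as ℤₚ
import Data.Sign as Sign
open import Data.Maybe using (Maybe; just; nothing)
open import Data.List using (List; []; _∷_; [_]; map; _++_; _∷ʳ_; length; upTo; applyUpTo; filter)
import Data.List.Properties as Lₚ
open import Data.List.Membership.Propositional using (_∈_)
open import Data.List.Membership.Propositional.Properties
  using (∈-∃++; ∈-applyUpTo⁺; ∈-++⁻; ∈-map⁻; ∈-map⁺; ∈-filter⁻; ∈-filter⁺)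
open import Data.List.Membership.DecPropositional N._≟_ using (_∈?_)
open import Data.List.Relation.Binary.Permutation.Propositional as Perm using (_↭_; ↭-sym)
open import Data.List.Relation.Binary.Permutation.Propositional.Properties using (∈-resp-↭)
import Data.List.Relation.Binary.Pointwise as Pw
open import Data.List.Relation.Binary.Pointwise using (Pointwise; []; _∷_)
import Data.List.Relation.Unary.All as All
import Data.List.Relation.Unary.All.Properties as Allₚ
open import Data.List.Relation.Unary.AllPairs using ([]; _∷_)
open import Data.List.Relation.Unary.Any using (here; there)
open import Data.List.Relation.Unary.Unique.Propositional using (Unique)
import Data.List.Relation.Unary.Unique.Propositional.Properties as Uniqueₚ
open import Data.Product using (Σ-syntax; _×_; _,_; proj₁; proj₂)
open import Data.Sum using (inj₁; inj₂)
open import Function using (_∘_; id)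
open import Function.Bundles using (_⇔_; mk⇔; Equivalence)
open import Relation.Nullary using (Dec; yes; no; does; ¬_; contradiction)
open import Relation.Nullary.Decidable using (dec-true; dec-false; does-⇔)
open import Relation.Binary.Definitions using (tri<; tri≈; tri>)
open import Relation.Binary.PropositionalEquality as ≡ using (_≡_; _≢_)
import Relation.Binary.Reasoning.Setoid
open import Algebra.Bundles using (CommutativeRing)
import Algebra.Properties.AbelianGroup
import Algebra.Properties.Ring
import Algebra.Properties.Semiring.Mult.TCOptimised
import Algebra.Solver.Ring
open import Algebra.Solver.Ring.AlmostCommutativeRing using (fromCommutativeRing; _-Raw-AlmostCommutative⟶_)

-- Neither multiplication by v² nor the double antidifference preserves the odd polynomials of
-- degree less than 2t. Each pushes out the top basis element, and both leave the same foreign minor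
-- Z, in which the top row of the determinant is replaced by the next one; comparing the two traces
-- eliminates Z. As (M + j)² - (M - j)² = 4Mj, multiplication by v² acts on c_j as (M - j)² plus 4M
-- times x d/dx, so its trace reads 4M x dE/dx = 2t(2t + 1) Z. The antidifference gives Z = -(2t +
-- 2) Σ_k k xᵏ/(1 - xᵏ) E. Together they produce the constant 2t² + t.
--
-- The choice M = t + 1 puts the points M - j at 1, ..., t: their squares are exactly the diagonal
-- entries of multiplication by v², the column of index M vanishes modulo xⁿ⁺¹, and the numerators
-- 2t + 2 and t + 1 of the theorem are 2M and M.
--
-- Shifting a column by k can carry it beyond M, where oddness reflects it back. Taking t at least
-- 3n keeps the reflected columns away from those in which a power of x survives.

if-yes : ∀ {a p} {A : Set a} {P : Set p} (d : Dec P) {x y : A} → P → (if does d then x else y) ≡ x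
if-yes d p rewrite dec-true d p = ≡.refl

if-no : ∀ {a p} {A : Set a} {P : Set p} (d : Dec P) {x y : A} → ¬ P → (if does d then x else y) ≡ y
if-no d ¬p rewrite dec-false d ¬p = ≡.refl

-- With integer rather than ring-valued coefficients the solver can recognise that a coefficient is zero,
-- and hence cancel.
module IntegerSolver {c ℓ} (R : CommutativeRing c ℓ) where
  open CommutativeRing R
  open import Data.Integer using (+_)
  open Algebra.Properties.Ring ring using (-0#≈0#; -‿distribˡ-*; -‿distribʳ-*; -‿involutive)
  open Algebra.Properties.AbelianGroup +-abelianGroup using (⁻¹-∙-comm)
  open Algebra.Properties.Semiring.Mult.TCOptimised semiring renaming (_×_ to _·_)
  open Relation.Binary.Reasoning.Setoid setoid

  ⟦_⟧ℤ : ℤ → Carrier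
  ⟦ + n ⟧ℤ = n · 1#
  ⟦ -[1+ n ] ⟧ℤ = - (suc n · 1#)

  private
    cancel₁ : ∀ a b → (1# + a) + - (1# + b) ≈ a + - b
    cancel₁ a b = begin
      (1# + a) + - (1# + b)     ≈⟨ +-cong (+-comm 1# a) (sym (⁻¹-∙-comm 1# b)) ⟩
      (a + 1#) + (- 1# + - b)   ≈⟨ +-assoc a 1# _ ⟩
      a + (1# + (- 1# + - b))   ≈⟨ +-congˡ (sym (+-assoc 1# (- 1#) (- b))) ⟩
      a + ((1# + - 1#) + - b)   ≈⟨ +-congˡ (+-congʳ (-‿inverseʳ 1#)) ⟩
      a + (0# + - b)            ≈⟨ +-congˡ (+-identityˡ (- b)) ⟩
      a + - b                   ∎

    ⊖-homo : ∀ m n → ⟦ m ℤ.⊖ n ⟧ℤ ≈ m · 1# + - (n · 1#)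
    ⊖-homo m zero = sym (trans (+-congˡ -0#≈0#) (+-identityʳ _))
    ⊖-homo zero (suc n) = sym (+-identityˡ _)
    ⊖-homo (suc m) (suc n) = begin
      ⟦ suc m ℤ.⊖ suc n ⟧ℤ            ≡⟨ ≡.cong ⟦_⟧ℤ (ℤₚ.[1+m]⊖[1+n]≡m⊖n m n) ⟩
      ⟦ m ℤ.⊖ n ⟧ℤ                    ≈⟨ ⊖-homo m n ⟩
      m · 1# + - (n · 1#)             ≈⟨ cancel₁ _ _ ⟨
      (1# + m · 1#) + - (1# + n · 1#) ≈⟨ +-cong (1+× m 1#) (-‿cong (1+× n 1#)) ⟨
      suc m · 1# + - (suc n · 1#)     ∎

    +-homoℤ : ∀ i j → ⟦ i ℤ.+ j ⟧ℤ ≈ ⟦ i ⟧ℤ + ⟦ j ⟧ℤ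
    +-homoℤ (+ m) (+ n) = ×-homo-+ 1# m n
    +-homoℤ (+ m) -[1+ n ] = ⊖-homo m (suc n)
    +-homoℤ -[1+ m ] (+ n) = trans (⊖-homo n (suc m)) (+-comm _ _)
    +-homoℤ -[1+ m ] -[1+ n ] = begin
      - (suc (suc (m N.+ n)) · 1#)     ≡⟨ ≡.cong (λ k → - (k · 1#)) (≡.cong suc (≡.sym (ℕₚ.+-suc m n))) ⟩
      - ((suc m N.+ suc n) · 1#)       ≈⟨ -‿cong (×-homo-+ 1# (suc m) (suc n)) ⟩
      - (suc m · 1# + suc n · 1#)      ≈⟨ ⁻¹-∙-comm _ _ ⟨
      - (suc m · 1#) + - (suc n · 1#)  ∎

    +◃ : ∀ n → ⟦ Sign.+ ℤ.◃ n ⟧ℤ ≈ n · 1#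
    +◃ zero = refl
    +◃ (suc n) = refl

    -◃ : ∀ n → ⟦ Sign.- ℤ.◃ n ⟧ℤ ≈ - (n · 1#)
    -◃ zero = sym -0#≈0#
    -◃ (suc n) = refl

    *-homoℤ : ∀ i j → ⟦ i ℤ.* j ⟧ℤ ≈ ⟦ i ⟧ℤ * ⟦ j ⟧ℤ
    *-homoℤ (+ m) (+ n) = trans (+◃ (m N.* n)) (×1-homo-* m n)
    *-homoℤ (+ m) -[1+ n ] =
      trans (-◃ (m N.* suc n)) (trans (-‿cong (×1-homo-* m (suc n))) (-‿distribʳ-* _ _))
    *-homoℤ -[1+ m ] (+ n) =
      trans (-◃ (suc m N.* n)) (trans (-‿cong (×1-homo-* (suc m) n)) (-‿distribˡ-* _ _))
    *-homoℤ -[1+ m ] -[1+ n ] = begin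
      ⟦ Sign.+ ℤ.◃ (suc m N.* suc n) ⟧ℤ      ≈⟨ +◃ (suc m N.* suc n) ⟩
      (suc m N.* suc n) · 1#                ≈⟨ ×1-homo-* (suc m) (suc n) ⟩
      (suc m · 1#) * (suc n · 1#)           ≈⟨ -‿involutive _ ⟨
      - - ((suc m · 1#) * (suc n · 1#))     ≈⟨ -‿cong (-‿distribʳ-* _ _) ⟩
      - ((suc m · 1#) * - (suc n · 1#))     ≈⟨ -‿distribˡ-* _ _ ⟩
      - (suc m · 1#) * - (suc n · 1#)       ∎

    -‿homoℤ : ∀ i → ⟦ ℤ.- i ⟧ℤ ≈ - ⟦ i ⟧ℤ
    -‿homoℤ (+ zero) = sym -0#≈0#
    -‿homoℤ (+ suc n) = refl
    -‿homoℤ -[1+ n ] = sym (-‿involutive _)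

    morphism : ℤ.+-*-rawRing -Raw-AlmostCommutative⟶ fromCommutativeRing R
    morphism = record
      { ⟦_⟧ = ⟦_⟧ℤ ; +-homo = +-homoℤ ; *-homo = *-homoℤ ; -‿homo = -‿homoℤ
      ; 0-homo = refl ; 1-homo = refl }

    _coeff≟_ : ∀ i j → Maybe (⟦ i ⟧ℤ ≈ ⟦ j ⟧ℤ)
    i coeff≟ j with i ℤ.≟ j
    ... | yes i≡j = just (reflexive (≡.cong ⟦_⟧ℤ i≡j))
    ... | no _ = nothing

  open Algebra.Solver.Ring ℤ.+-*-rawRing (fromCommutativeRing R) morphism _coeff≟_ public
    using (solve; _:=_; _:+_; _:*_; _:-_; :-_; con; Polynomial)

  K : ∀ {n} → ℕ → Polynomial n
  K k = con (+ k)

  ⟦K⟧ : ℕ → Carrier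
  ⟦K⟧ k = ⟦ + k ⟧ℤ

-- Natural numbers, finite sums and finite products in a commutative ring.

module Kit {c ℓ} (R : CommutativeRing c ℓ) (inv : ℕ → CommutativeRing.Carrier R) where
  open CommutativeRing R public
  open RingDefs R inv public renaming (fromℕ to ι)
  open IntegerSolver R public
  open Relation.Binary.Reasoning.Setoid setoid
  open Algebra.Properties.Ring ring public using (-0#≈0#)

  ≡⇒≈ : ∀ {a b : Carrier} → a ≡ b → a ≈ b
  ≡⇒≈ = reflexive

  ι-+ : ∀ m n → ι (m N.+ n) ≈ ι m + ι n
  ι-+ zero n = sym (+-identityˡ _)
  ι-+ (suc m) n = trans (+-congˡ (ι-+ m n)) (sym (+-assoc _ _ _))

  ι-* : ∀ m n → ι (m N.* n) ≈ ι m * ι n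
  ι-* zero n = sym (zeroˡ _)
  ι-* (suc m) n = begin
    ι (n N.+ m N.* n)             ≈⟨ ι-+ n (m N.* n) ⟩
    ι n + ι (m N.* n)         ≈⟨ +-congˡ (ι-* m n) ⟩
    ι n + ι m * ι n       ≈⟨ solve 2 (λ a b → b :+ a :* b := (K 1 :+ a) :* b) refl _ _ ⟩
    (1# + ι m) * ι n          ∎

  ι-∸ : ∀ {m n} → n N.≤ m → ι (m ∸ n) ≈ ι m - ι n
  ι-∸ {m} z≤n = sym (trans (+-congˡ -0#≈0#) (+-identityʳ _))
  ι-∸ (s≤s {n} {m} n≤m) = trans (ι-∸ n≤m)
    (solve 2 (λ a b → a :- b := (K 1 :+ a) :- (K 1 :+ b)) refl (ι m) (ι n))

  ∑ : ℕ → (ℕ → Carrier) → Carrier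
  ∑ zero f = 0#
  ∑ (suc n) f = f 0 + ∑ n (f ∘ suc)

  ∏ : ℕ → (ℕ → Carrier) → Carrier
  ∏ zero f = 1#
  ∏ (suc n) f = f 0 * ∏ n (f ∘ suc)

  sumR-applyUpTo : ∀ f n → sumR (applyUpTo f n) ≡ ∑ n f
  sumR-applyUpTo f zero = ≡.refl
  sumR-applyUpTo f (suc n) = ≡.cong (f 0 +_) (sumR-applyUpTo (f ∘ suc) n)

  sumR-upTo : ∀ f n → sumR (map f (upTo n)) ≡ ∑ n f
  sumR-upTo f n = ≡.trans (≡.cong sumR (Lₚ.map-applyUpTo id f n)) (sumR-applyUpTo f n)

  prodR-applyUpTo : ∀ f n → prodR (applyUpTo f n) ≡ ∏ n f
  prodR-applyUpTo f zero = ≡.refl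
  prodR-applyUpTo f (suc n) = ≡.cong (f 0 *_) (prodR-applyUpTo (f ∘ suc) n)

  sumR-oneTo : ∀ f n → sumR (map f (oneTo n)) ≡ ∑ n (f ∘ suc)
  sumR-oneTo f n = ≡.trans
    (≡.cong (sumR ∘ map f) (Lₚ.map-applyUpTo id suc n))
    (≡.trans (≡.cong sumR (Lₚ.map-applyUpTo suc f n)) (sumR-applyUpTo (f ∘ suc) n))

  prodR-oneTo : ∀ f n → prodR (map f (oneTo n)) ≡ ∏ n (f ∘ suc)
  prodR-oneTo f n = ≡.trans
    (≡.cong (prodR ∘ map f) (Lₚ.map-applyUpTo id suc n))
    (≡.trans (≡.cong prodR (Lₚ.map-applyUpTo suc f n)) (prodR-applyUpTo (f ∘ suc) n))

  ∑-cong< : ∀ n {f g} → (∀ i → i N.< n → f i ≈ g i) → ∑ n f ≈ ∑ n g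
  ∑-cong< zero e = refl
  ∑-cong< (suc n) e = +-cong (e 0 (s≤s z≤n)) (∑-cong< n (λ i i<n → e (suc i) (s≤s i<n)))

  ∑-cong : ∀ n {f g} → (∀ i → f i ≈ g i) → ∑ n f ≈ ∑ n g
  ∑-cong n e = ∑-cong< n (λ i _ → e i)

  ∑-zero : ∀ n → ∑ n (λ _ → 0#) ≈ 0#
  ∑-zero zero = refl
  ∑-zero (suc n) = trans (+-identityˡ _) (∑-zero n)

  ∑-zero< : ∀ n {f} → (∀ i → i N.< n → f i ≈ 0#) → ∑ n f ≈ 0#
  ∑-zero< n e = trans (∑-cong< n e) (∑-zero n)

  ∑-+ : ∀ n f g → ∑ n (λ i → f i + g i) ≈ ∑ n f + ∑ n g
  ∑-+ zero f g = sym (+-identityˡ _)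
  ∑-+ (suc n) f g = trans (+-congˡ (∑-+ n _ _))
    (solve 4 (λ a b c d → (a :+ b) :+ (c :+ d) := (a :+ c) :+ (b :+ d)) refl _ _ _ _)

  ∑-*ˡ : ∀ n a f → ∑ n (λ i → a * f i) ≈ a * ∑ n f
  ∑-*ˡ zero a f = sym (zeroʳ a)
  ∑-*ˡ (suc n) a f = trans (+-congˡ (∑-*ˡ n a _)) (sym (distribˡ _ _ _))

  ∑-*ʳ : ∀ n a f → ∑ n (λ i → f i * a) ≈ ∑ n f * a
  ∑-*ʳ n a f = trans (∑-cong n (λ i → *-comm _ _)) (trans (∑-*ˡ n a f) (*-comm _ _))

  ∑-neg : ∀ n f → ∑ n (λ i → - f i) ≈ - ∑ n f
  ∑-neg zero f = sym -0#≈0#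
  ∑-neg (suc n) f = trans (+-congˡ (∑-neg n _)) (solve 2 (λ a b → :- a :+ :- b := :- (a :+ b)) refl _ _)

  ∑-last : ∀ n f → ∑ (suc n) f ≈ ∑ n f + f n
  ∑-last zero f = +-comm _ _
  ∑-last (suc n) f = trans (+-congˡ (∑-last n (f ∘ suc))) (sym (+-assoc _ _ _))

  ∑-swap : ∀ m n (f : ℕ → ℕ → Carrier) → ∑ m (λ i → ∑ n (f i)) ≈ ∑ n (λ j → ∑ m (λ i → f i j))
  ∑-swap zero n f = sym (∑-zero n)
  ∑-swap (suc m) n f = trans (+-congˡ (∑-swap m n _)) (sym (∑-+ n _ _))

  ∑-extend : ∀ {m n} f → m N.≤ n → (∀ i → m N.≤ i → i N.< n → f i ≈ 0#) → ∑ n f ≈ ∑ m f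
  ∑-extend {n = n} f z≤n e = ∑-zero< n (λ i → e i z≤n)
  ∑-extend f (s≤s m≤n) e = +-congˡ (∑-extend (f ∘ suc) m≤n (λ i m≤i i<n → e (suc i) (s≤s m≤i) (s≤s i<n)))

  ∑-single : ∀ n k f → k N.< n → (∀ i → i N.< n → i ≡.≢ k → f i ≈ 0#) → ∑ n f ≈ f k
  ∑-single (suc n) zero f k<n e =
    trans (+-congˡ (∑-zero< n (λ i i<n → e (suc i) (s≤s i<n) (λ ())))) (+-identityʳ _)
  ∑-single (suc n) (suc k) f (s≤s k<n) e =
    trans (+-cong (e 0 (s≤s z≤n) (λ ())) (∑-single n k (f ∘ suc) k<n
      (λ i i<n i≢k → e (suc i) (s≤s i<n) (i≢k ∘ ℕₚ.suc-injective)))) (+-identityˡ _)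

  ∑-rev : ∀ n f → ∑ n (λ i → f (n ∸ suc i)) ≈ ∑ n f
  ∑-rev zero f = refl
  ∑-rev (suc n) f = trans (+-congˡ (∑-rev n f)) (trans (+-comm _ _) (sym (∑-last n f)))

  ∏-cong< : ∀ n {f g} → (∀ i → i N.< n → f i ≈ g i) → ∏ n f ≈ ∏ n g
  ∏-cong< zero e = refl
  ∏-cong< (suc n) e = *-cong (e 0 (s≤s z≤n)) (∏-cong< n (λ i i<n → e (suc i) (s≤s i<n)))

  ∏-* : ∀ n f g → ∏ n (λ i → f i * g i) ≈ ∏ n f * ∏ n g
  ∏-* zero f g = sym (*-identityˡ _)
  ∏-* (suc n) f g = trans (*-congˡ (∏-* n _ _))
    (solve 4 (λ a b c d → (a :* b) :* (c :* d) := (a :* c) :* (b :* d)) refl _ _ _ _)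

  ∏-last : ∀ n f → ∏ (suc n) f ≈ ∏ n f * f n
  ∏-last zero f = *-comm _ _
  ∏-last (suc n) f = trans (*-congˡ (∏-last n (f ∘ suc))) (sym (*-assoc _ _ _))

  ∏-rev : ∀ n f → ∏ n (λ i → f (n ∸ suc i)) ≈ ∏ n f
  ∏-rev zero f = refl
  ∏-rev (suc n) f = trans (*-congˡ (∏-rev n f)) (trans (*-comm _ _) (sym (∏-last n f)))

  ∏-split : ∀ m n f → ∏ (m N.+ n) f ≈ ∏ m f * ∏ n (λ i → f (m N.+ i))
  ∏-split zero n f = sym (*-identityˡ _)
  ∏-split (suc m) n f = trans (*-congˡ (∏-split m n (f ∘ suc))) (sym (*-assoc _ _ _))

-- Makes `R` a ℚ-algebra: the denominators that occur, such as h, h ± j with j < h, and m!, are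
-- positive integers.
Reciprocals : ∀ {c ℓ} (R : CommutativeRing c ℓ) → (ℕ → CommutativeRing.Carrier R) → Set ℓ
Reciprocals R inv = ∀ n → ι (suc n) * inv (suc n) ≈ 1#
  where open Kit R inv

-- The determinant argument runs over any ring with such an element `x`, which stands for the
-- indeterminate. It is applied to `X` in the ring of series truncated after degree n, so no series
-- occurs inside a determinant until then.
NilpotentBeyond : ∀ {c ℓ} (R : CommutativeRing c ℓ) → (ℕ → CommutativeRing.Carrier R) → ℕ → CommutativeRing.Carrier R → Set ℓ
NilpotentBeyond R inv n x = ∀ j → n N.< j → powR x j ≈ 0#
  where open Kit R inv

-- Formal power series and their truncations.

module PowerSeries {c ℓ} (R : CommutativeRing c ℓ) (inv : ℕ → CommutativeRing.Carrier R) where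
  open Kit R inv
  open Relation.Binary.Reasoning.Setoid setoid

  infixl 7 _⊛_
  infixl 6 _⊕_
  infix 4 _≋_

  _≋_ : Series → Series → Set ℓ
  f ≋ g = ∀ n → f n ≈ g n

  _⊕_ : Series → Series → Series
  (f ⊕ g) n = f n + g n

  _⊛_ : Series → Series → Series
  (f ⊛ g) n = ∑ (suc n) (λ i → f i * g (n ∸ i))

  conv≡⊛ : ∀ f g n → conv f g n ≡ (f ⊛ g) n
  conv≡⊛ f g n = sumR-upTo (λ i → f i * g (n ∸ i)) (suc n)

  const : Carrier → Series
  const a zero = a
  const a (suc _) = 0#

  ⊛-cong≤ : ∀ {f f′ g g′} n → (∀ i → i N.≤ n → f i ≈ f′ i) → (∀ i → i N.≤ n → g i ≈ g′ i) →
            (f ⊛ g) n ≈ (f′ ⊛ g′) n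
  ⊛-cong≤ n p q = ∑-cong< (suc n) (λ i i<1+n → *-cong (p i (ℕₚ.≤-pred i<1+n)) (q (n ∸ i) (ℕₚ.m∸n≤m n i)))

  ⊛-cong : ∀ {f f′ g g′} → f ≋ f′ → g ≋ g′ → f ⊛ g ≋ f′ ⊛ g′
  ⊛-cong p q n = ⊛-cong≤ n (λ i _ → p i) (λ i _ → q i)

  ⊛-comm : ∀ f g → f ⊛ g ≋ g ⊛ f
  ⊛-comm f g n = begin
    ∑ (suc n) (λ i → f i * g (n ∸ i))              ≈⟨ ∑-rev (suc n) (λ i → f i * g (n ∸ i)) ⟨
    ∑ (suc n) (λ i → f (n ∸ i) * g (n ∸ (n ∸ i)))  ≈⟨ ∑-cong< (suc n) (λ i i<1+n → trans
        (*-congˡ {f (n ∸ i)} (reflexive (≡.cong g (ℕₚ.m∸[m∸n]≡n (ℕₚ.≤-pred i<1+n))))) (*-comm _ (g i))) ⟩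
    ∑ (suc n) (λ i → g i * f (n ∸ i))              ∎

  ⊛-distribʳ : ∀ h f g → (f ⊕ g) ⊛ h ≋ (f ⊛ h) ⊕ (g ⊛ h)
  ⊛-distribʳ h f g n = trans (∑-cong (suc n) (λ i → distribʳ (h (n ∸ i)) (f i) (g i)))
    (∑-+ (suc n) (λ i → f i * h (n ∸ i)) (λ i → g i * h (n ∸ i)))

  ⊛-distribˡ : ∀ h f g → h ⊛ (f ⊕ g) ≋ (h ⊛ f) ⊕ (h ⊛ g)
  ⊛-distribˡ h f g n = trans (∑-cong (suc n) (λ i → distribˡ (h i) (f (n ∸ i)) (g (n ∸ i))))
    (∑-+ (suc n) (λ i → h i * f (n ∸ i)) (λ i → h i * g (n ∸ i)))

  ⊛-*ˡ : ∀ a f g → (λ n → a * f n) ⊛ g ≋ (λ n → a * (f ⊛ g) n)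
  ⊛-*ˡ a f g n = trans (∑-cong (suc n) (λ i → *-assoc a (f i) (g (n ∸ i))))
    (∑-*ˡ (suc n) a (λ i → f i * g (n ∸ i)))

  ⊛-*ʳ : ∀ a f g → f ⊛ (λ n → a * g n) ≋ (λ n → a * (f ⊛ g) n)
  ⊛-*ʳ a f g n = trans (⊛-comm f (λ m → a * g m) n) (trans (⊛-*ˡ a g f n) (*-congˡ (⊛-comm g f n)))

  ⊛-assoc : ∀ f g h → (f ⊛ g) ⊛ h ≋ f ⊛ (g ⊛ h)
  ⊛-assoc f g h zero = solve 3 (λ a b c → (a :* b :+ K 0) :* c :+ K 0 := a :* (b :* c :+ K 0) :+ K 0) refl _ _ _
  ⊛-assoc f g h (suc n) = begin
    -- The tail of `f ⊛ g` is by definition `f 0` times the tail of `g` plus the product of the tail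
    -- of `f` with `g`, so the induction is on the coefficient.
    (f 0 * g 0 + 0#) * h (suc n) + (((f ⊛ g) ∘ suc) ⊛ h) n
      ≈⟨ +-cong (*-congʳ (+-identityʳ _)) (trans (⊛-distribʳ h (λ k → f 0 * g (suc k)) ((f ∘ suc) ⊛ g) n)
           (+-cong (⊛-*ˡ (f 0) (g ∘ suc) h n) (⊛-assoc (f ∘ suc) g h n))) ⟩
    (f 0 * g 0) * h (suc n) + (f 0 * ((g ∘ suc) ⊛ h) n + ((f ∘ suc) ⊛ (g ⊛ h)) n)
      ≈⟨ solve 5 (λ a b c d e → (a :* b) :* c :+ (a :* d :+ e) := a :* (b :* c :+ d) :+ e) refl _ _ _ _ _ ⟩
    f 0 * (g 0 * h (suc n) + ((g ∘ suc) ⊛ h) n) + ((f ∘ suc) ⊛ (g ⊛ h)) n ∎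

  const-⊛ : ∀ a f → const a ⊛ f ≋ (λ n → a * f n)
  const-⊛ a f n = trans (+-congˡ (∑-zero< n (λ i _ → zeroˡ _))) (+-identityʳ _)

  -- R[x]/(x^{N+1}), carried by all series with equality up to the coefficient of x^N.
  truncated : ℕ → CommutativeRing c ℓ
  truncated N = record
    { Carrier = Series
    ; _≈_ = λ f g → ∀ i → i N.≤ N → f i ≈ g i
    ; _+_ = _⊕_
    ; _*_ = _⊛_
    ; -_ = λ f n → - f n
    ; 0# = λ _ → 0#
    ; 1# = const 1#
    ; isCommutativeRing = record
      { isRing = record
        { +-isAbelianGroup = record
          { isGroup = record
            { isMonoid = record
              { isSemigroup = record
                { isMagma = record
                  { isEquivalence = record
                    { refl = λ _ _ → refl
                    ; sym = λ p i i≤N → sym (p i i≤N)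
                    ; trans = λ p q i i≤N → trans (p i i≤N) (q i i≤N) }
                  ; ∙-cong = λ p q i i≤N → +-cong (p i i≤N) (q i i≤N) }
                ; assoc = λ _ _ _ _ _ → +-assoc _ _ _ }
              ; identity = (λ _ _ _ → +-identityˡ _) , (λ _ _ _ → +-identityʳ _) }
            ; inverse = (λ _ _ _ → -‿inverseˡ _) , (λ _ _ _ → -‿inverseʳ _)
            ; ⁻¹-cong = λ p i i≤N → -‿cong (p i i≤N) }
          ; comm = λ _ _ _ _ → +-comm _ _ }
        ; *-cong = λ p q n n≤N → ⊛-cong≤ n (λ i i≤n → p i (ℕₚ.≤-trans i≤n n≤N))
                                           (λ i i≤n → q i (ℕₚ.≤-trans i≤n n≤N))
        ; *-assoc = λ f g h n _ → ⊛-assoc f g h n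
        ; *-identity = (λ f n _ → trans (const-⊛ 1# f n) (*-identityˡ _))
                     , (λ f n _ → trans (⊛-comm f (const 1#) n) (trans (const-⊛ 1# f n) (*-identityˡ _)))
        ; distrib = (λ h f g n _ → ⊛-distribˡ h f g n) , (λ h f g n _ → ⊛-distribʳ h f g n) }
      ; *-comm = λ f g n _ → ⊛-comm f g n } }

  X : Series
  X zero = 0#
  X (suc zero) = 1#
  X (suc (suc _)) = 0#

  X-⊛-zero : ∀ f → (X ⊛ f) 0 ≈ 0#
  X-⊛-zero f = trans (+-identityʳ _) (zeroˡ _)

  X-⊛-suc : ∀ f n → (X ⊛ f) (suc n) ≈ f n
  X-⊛-suc f n = begin
    0# * f (suc n) + (1# * f n + ∑ n (λ i → 0# * f (n ∸ suc i)))
      ≈⟨ +-cong (zeroˡ _) (+-cong (*-identityˡ _) (∑-zero< n (λ i _ → zeroˡ _))) ⟩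
    0# + (f n + 0#)
      ≈⟨ trans (+-identityˡ _) (+-identityʳ _) ⟩
    f n ∎

  infixr 8 X^_
  X^_ : ℕ → Series
  X^ zero = const 1#
  X^ suc m = X ⊛ X^ m

  X^-diag : ∀ m → (X^ m) m ≈ 1#
  X^-diag zero = refl
  X^-diag (suc m) = trans (X-⊛-suc (X^ m) m) (X^-diag m)

  X^-off : ∀ m n → m ≢ n → (X^ m) n ≈ 0#
  X^-off zero zero m≢n = contradiction ≡.refl m≢n
  X^-off zero (suc n) m≢n = refl
  X^-off (suc m) zero m≢n = X-⊛-zero (X^ m)
  X^-off (suc m) (suc n) m≢n = trans (X-⊛-suc (X^ m) n) (X^-off m n (m≢n ∘ ≡.cong suc))

-- Cancelling images of positive integers.

module Units {c ℓ} (R : CommutativeRing c ℓ) (inv : ℕ → CommutativeRing.Carrier R)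
  (inv-suc : Reciprocals R inv) where
  open Kit R inv
  open Relation.Binary.Reasoning.Setoid setoid

  ι-inv : ∀ {m} → 0 N.< m → ι m * inv m ≈ 1#
  ι-inv {suc m} _ = inv-suc m

  unit-cancel : ∀ {u u′ a b} → u * u′ ≈ 1# → u * a ≈ u * b → a ≈ b
  unit-cancel {u} {u′} {a} {b} uu′≈1 ua≈ub = begin
    a              ≈⟨ *-identityˡ a ⟨
    1# * a         ≈⟨ *-congʳ uu′≈1 ⟨
    u * u′ * a     ≈⟨ solve 3 (λ u u′ a → u :* u′ :* a := u′ :* (u :* a)) refl _ _ _ ⟩
    u′ * (u * a)   ≈⟨ *-congˡ ua≈ub ⟩
    u′ * (u * b)   ≈⟨ solve 3 (λ u u′ a → u :* u′ :* a := u′ :* (u :* a)) refl _ _ _ ⟨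
    u * u′ * b     ≈⟨ *-congʳ uu′≈1 ⟩
    1# * b         ≈⟨ *-identityˡ b ⟩
    b              ∎

  ι-cancel : ∀ {m a b} → 0 N.< m → ι m * a ≈ ι m * b → a ≈ b
  ι-cancel 0<m = unit-cancel (ι-inv 0<m)

  inv-suc-* : ∀ m k → 0 N.< k → inv (suc m N.* k) * ι (suc m) ≈ inv k
  inv-suc-* m k 0<k = ι-cancel 0<k (begin
    ι k * (inv (suc m N.* k) * ι (suc m))
      ≈⟨ solve 3 (λ k i s → k :* (i :* s) := (s :* k) :* i) refl _ _ _ ⟩
    (ι (suc m) * ι k) * inv (suc m N.* k)  ≈⟨ *-congʳ (ι-* (suc m) k) ⟨
    ι (suc m N.* k) * inv (suc m N.* k)        ≈⟨ ι-inv (ℕₚ.≤-trans 0<k (ℕₚ.m≤m+n k (m N.* k))) ⟩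
    1#                                             ≈⟨ ι-inv 0<k ⟨
    ι k * inv k                                ∎)

-- The differential equation of the exponential and the logarithmic derivative of the product.

module ExpODE {c ℓ} (R : CommutativeRing c ℓ) (inv : ℕ → CommutativeRing.Carrier R)
  (inv-suc : Reciprocals R inv) where
  open Kit R inv
  open Units R inv inv-suc
  open PowerSeries R inv
  open Relation.Binary.Reasoning.Setoid setoid

  -- The Euler operator x d/dx.
  θ : Series → Series
  θ f n = ι n * f n

  θ-⊛ : ∀ f g → θ (f ⊛ g) ≋ (θ f ⊛ g) ⊕ (f ⊛ θ g)
  θ-⊛ f g n = begin
    ι n * (f ⊛ g) n
      ≈⟨ ∑-*ˡ (suc n) (ι n) (λ i → f i * g (n ∸ i)) ⟨
    ∑ (suc n) (λ i → ι n * (f i * g (n ∸ i)))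
      ≈⟨ ∑-cong< (suc n) {g = λ i → θ f i * g (n ∸ i) + f i * θ g (n ∸ i)} (λ i i<1+n → trans
           (*-congʳ (trans (reflexive (≡.cong ι (≡.sym (ℕₚ.m+[n∸m]≡n (ℕₚ.≤-pred i<1+n))))) (ι-+ i (n ∸ i))))
           (solve 4 (λ i j a b → (i :+ j) :* (a :* b) := (i :* a) :* b :+ a :* (j :* b)) refl _ _ (f i) (g (n ∸ i)))) ⟩
    ∑ (suc n) (λ i → θ f i * g (n ∸ i) + f i * θ g (n ∸ i))
      ≈⟨ ∑-+ (suc n) (λ i → θ f i * g (n ∸ i)) (λ i → f i * θ g (n ∸ i)) ⟩
    (θ f ⊛ g) n + (f ⊛ θ g) n ∎

  -- Since `A 0` vanishes, the equation expresses n times the n-th coefficient through strictly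
  -- lower ones, and n is invertible for n > 0. Only the coefficients up to `N` are involved, which
  -- is all that a truncated identity provides.
  ode-unique : ∀ N (A F H : Series) → A 0 ≈ 0# → F 0 ≈ H 0 →
               (∀ n → n N.≤ N → θ F n ≈ (A ⊛ F) n) → (∀ n → n N.≤ N → θ H n ≈ (A ⊛ H) n) →
               ∀ n → n N.≤ N → F n ≈ H n
  ode-unique N A F H A₀ F₀ odeF odeH n n≤N = go n n ℕₚ.≤-refl n≤N
    where
    go : ∀ b n → n N.≤ b → n N.≤ N → F n ≈ H n
    go b zero _ _ = F₀
    go (suc b) (suc n) (s≤s n≤b) n<N = ι-cancel {suc n} (s≤s z≤n) (begin
      ι (suc n) * F (suc n)
        ≈⟨ odeF (suc n) n<N ⟩
      A 0 * F (suc n) + ∑ (suc n) (λ i → A (suc i) * F (n ∸ i))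
        ≈⟨ +-cong (trans (*-congʳ A₀) (trans (zeroˡ _) (sym (trans (*-congʳ A₀) (zeroˡ _)))))
             (∑-cong< (suc n) (λ i i<1+n → *-congˡ {A (suc i)}
               (go b (n ∸ i) (ℕₚ.≤-trans (ℕₚ.m∸n≤m n i) n≤b) (ℕₚ.≤-trans (ℕₚ.m∸n≤m n i) (ℕₚ.<⇒≤ n<N))))) ⟩
      A 0 * H (suc n) + ∑ (suc n) (λ i → A (suc i) * H (n ∸ i))
        ≈⟨ odeH (suc n) n<N ⟨
      ι (suc n) * H (suc n) ∎)

  module _ (G : Series) (G₀ : G 0 ≈ 0#) where

    private
      P : ℕ → Series
      P = powS G

      ⊛-low : ∀ H → H 0 ≈ 0# → ∀ m g → (∀ n → n N.< m → g n ≈ 0#) → ∀ n → n N.< suc m → (H ⊛ g) n ≈ 0#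
      ⊛-low H H₀ m g g-low n n<1+m = trans (+-cong (trans (*-congʳ H₀) (zeroˡ _))
          (∑-zero< n (λ i i<n → trans (*-congˡ (g-low (n ∸ suc i)
            (ℕₚ.<-≤-trans (ℕₚ.∸-monoʳ-< (s≤s z≤n) i<n) (ℕₚ.≤-pred n<1+m)))) (zeroʳ _)))) (+-identityˡ _)

      P-low : ∀ m n → n N.< m → P m n ≈ 0#
      P-low (suc m) n n<1+m = trans (reflexive (conv≡⊛ G (P m) n)) (⊛-low G G₀ m (P m) (P-low m) n n<1+m)

      θP : ∀ m → θ (P (suc m)) ≋ (λ n → ι (suc m) * (θ G ⊛ P m) n)
      θP m n = begin
        ι n * conv G (P m) n     ≡⟨ ≡.cong (ι n *_) (conv≡⊛ G (P m) n) ⟩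
        θ (G ⊛ P m) n                ≈⟨ θ-⊛ G (P m) n ⟩
        (θ G ⊛ P m) n + (G ⊛ θ (P m)) n  ≈⟨ +-congˡ (rest m) ⟩
        (θ G ⊛ P m) n + ι m * (θ G ⊛ P m) n  ≈⟨ solve 2 (λ a m → a :+ m :* a := (K 1 :+ m) :* a) refl _ _ ⟩
        ι (suc m) * (θ G ⊛ P m) n ∎
        where
        rest : ∀ m → (G ⊛ θ (P m)) n ≈ ι m * (θ G ⊛ P m) n
        rest zero = trans (∑-zero< (suc n) (λ i _ → trans (*-congˡ {G i} (θ1 (n ∸ i))) (zeroʳ _))) (sym (zeroˡ _))
          where
          θ1 : ∀ k → ι k * oneS k ≈ 0#
          θ1 zero = zeroˡ _
          θ1 (suc k) = zeroʳ _
        rest (suc m) = begin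
          (G ⊛ θ (P (suc m))) n                          ≈⟨ ⊛-cong {G} (λ _ → refl) (θP m) n ⟩
          (G ⊛ (λ n → ι (suc m) * (θ G ⊛ P m) n)) n  ≈⟨ ⊛-*ʳ (ι (suc m)) G (θ G ⊛ P m) n ⟩
          ι (suc m) * (G ⊛ (θ G ⊛ P m)) n            ≈⟨ *-congˡ (⊛-assoc G (θ G) (P m) n) ⟨
          ι (suc m) * ((G ⊛ θ G) ⊛ P m) n            ≈⟨ *-congˡ (⊛-cong {G ⊛ θ G} {θ G ⊛ G} {P m} (⊛-comm G (θ G)) (λ _ → refl) n) ⟩
          ι (suc m) * ((θ G ⊛ G) ⊛ P m) n            ≈⟨ *-congˡ (⊛-assoc (θ G) G (P m) n) ⟩
          ι (suc m) * (θ G ⊛ (G ⊛ P m)) n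
            ≈⟨ *-congˡ (⊛-cong {θ G} {θ G} {G ⊛ P m} (λ _ → refl) (λ k → reflexive (≡.sym (conv≡⊛ G (P m) k))) n) ⟩
          ι (suc m) * (θ G ⊛ P (suc m)) n            ∎

    expS-∑ : ∀ n → expS G n ≡ ∑ (suc n) (λ m → inv (m !) * powS G m n)
    expS-∑ n = sumR-upTo (λ m → inv (m !) * powS G m n) (suc n)

    -- Both sides equal the sum over m < n of θG · Gᵐ / m!. On the left θ removes the term m = 0 and
    -- shifts the others by the power rule; on the right the inner cut-off m ≤ n - i may be raised
    -- to m ≤ n because Gᵐ starts in degree m, and then the term m = n vanishes because θG · Gⁿ
    -- starts in degree n + 1.
    expS-ode : ∀ n → θ (expS G) n ≈ (θ G ⊛ expS G) n
    expS-ode n = trans left (sym right)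
      where
      middle : Carrier
      middle = ∑ n (λ m → inv (m !) * (θ G ⊛ P m) n)

      left : ι n * expS G n ≈ middle
      left = begin
        ι n * expS G n                                     ≡⟨ ≡.cong (ι n *_) (expS-∑ n) ⟩
        ι n * ∑ (suc n) (λ m → inv (m !) * P m n)          ≈⟨ ∑-*ˡ (suc n) (ι n) (λ m → inv (m !) * P m n) ⟨
        ∑ (suc n) (λ m → ι n * (inv (m !) * P m n))
          ≈⟨ +-cong (first n) (∑-cong n (λ m → begin
               ι n * (inv (suc m !) * P (suc m) n)
                 ≈⟨ solve 3 (λ a b c → a :* (b :* c) := b :* (a :* c)) refl _ _ _ ⟩
               inv (suc m !) * θ (P (suc m)) n
                 ≈⟨ *-congˡ (θP m n) ⟩
               inv (suc m !) * (ι (suc m) * (θ G ⊛ P m) n)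
                 ≈⟨ *-assoc _ _ _ ⟨
               inv (suc m !) * ι (suc m) * (θ G ⊛ P m) n
                 ≈⟨ *-congʳ (inv-suc-* m (m !) (N.>-nonZero⁻¹ (m !) {{m ℕₚ.!≢0}})) ⟩
               inv (m !) * (θ G ⊛ P m) n ∎)) ⟩
        0# + middle                                            ≈⟨ +-identityˡ _ ⟩
        middle ∎
        where
        first : ∀ n → ι n * (inv 1 * oneS n) ≈ 0#
        first zero = zeroˡ _
        first (suc n) = trans (*-congˡ (zeroʳ _)) (zeroʳ _)

      right : (θ G ⊛ expS G) n ≈ middle
      right = begin
        ∑ (suc n) (λ i → θ G i * expS G (n ∸ i))
          ≈⟨ ∑-cong (suc n) (λ i → *-congˡ {θ G i} (trans (reflexive (expS-∑ (n ∸ i)))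
               (sym (∑-extend (λ m → inv (m !) * P m (n ∸ i)) (s≤s (ℕₚ.m∸n≤m n i))
                 (λ m n-i<m _ → trans (*-congˡ (P-low m (n ∸ i) n-i<m)) (zeroʳ _)))))) ⟩
        ∑ (suc n) (λ i → θ G i * ∑ (suc n) (λ m → inv (m !) * P m (n ∸ i)))
          ≈⟨ ∑-cong (suc n) (λ i → trans (sym (∑-*ˡ (suc n) (θ G i) (λ m → inv (m !) * P m (n ∸ i))))
               (∑-cong (suc n) {λ m → θ G i * (inv (m !) * P m (n ∸ i))} {λ m → inv (m !) * (θ G i * P m (n ∸ i))}
                 (λ m → solve 3 (λ a b c → a :* (b :* c) := b :* (a :* c)) refl _ _ _))) ⟩
        ∑ (suc n) (λ i → ∑ (suc n) (λ m → inv (m !) * (θ G i * P m (n ∸ i))))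
          ≈⟨ ∑-swap (suc n) (suc n) (λ i m → inv (m !) * (θ G i * P m (n ∸ i))) ⟩
        ∑ (suc n) (λ m → ∑ (suc n) (λ i → inv (m !) * (θ G i * P m (n ∸ i))))
          ≈⟨ ∑-cong (suc n) (λ m → ∑-*ˡ (suc n) (inv (m !)) (λ i → θ G i * P m (n ∸ i))) ⟩
        ∑ (suc n) (λ m → inv (m !) * (θ G ⊛ P m) n)
          ≈⟨ ∑-last n (λ m → inv (m !) * (θ G ⊛ P m) n) ⟩
        middle + inv (n !) * (θ G ⊛ P n) n
          ≈⟨ +-congˡ (trans (*-congˡ (⊛-low (θ G) (zeroˡ _) n (P n) (P-low n) n ℕₚ.≤-refl)) (zeroʳ _)) ⟩
        middle + 0#
          ≈⟨ +-identityʳ _ ⟩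
        middle ∎

  -- The coefficient of x^m counts each factorisation m = (k+1)(r+1) with weight k+1.
  divisorSum : ℕ → Series
  divisorSum N m = ∑ N (λ k → ∑ N (λ r → ι (suc k) * (X^ (suc k N.* suc r)) m))

  -- The coefficient of xᵐ in `Lser` is the sum of 1/d over the divisors d of m. Multiplication by m
  -- turns 1/d into the complementary divisor m/d, which is the weight `suc k` when d is `suc r`.
  θ-Lser : ∀ N m → m N.≤ N → θ Lser m ≈ divisorSum N m
  θ-Lser N zero _ = trans (zeroˡ _) (sym (∑-zero< N (λ k _ → ∑-zero< N (λ r _ →
    trans (*-congˡ (X^-off (suc k N.* suc r) 0 (λ ()))) (zeroʳ _)))))
  θ-Lser N (suc n) m≤N = begin
    ι m * Lser m
      ≡⟨ ≡.cong (ι m *_) (sumR-oneTo (λ k → if does (k ∣? m) then inv k else 0#) m) ⟩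
    ι m * ∑ m (λ r → reciprocal r)
      ≈⟨ ∑-*ˡ m (ι m) reciprocal ⟨
    ∑ m (λ r → ι m * reciprocal r)
      ≈⟨ ∑-extend (λ r → ι m * reciprocal r) m≤N (λ r m≤r _ → trans (*-congˡ (beyond r m≤r)) (zeroʳ _)) ⟨
    ∑ N (λ r → ι m * reciprocal r)
      ≈⟨ ∑-cong N codivisor ⟩
    ∑ N (λ r → ∑ N (λ k → ι (suc k) * (X^ (suc k N.* suc r)) m))
      ≈⟨ ∑-swap N N (λ k r → ι (suc k) * (X^ (suc k N.* suc r)) m) ⟨
    divisorSum N m ∎
    where
    m : ℕ
    m = suc n

    reciprocal : ℕ → Carrier
    reciprocal r = if does (suc r ∣? m) then inv (suc r) else 0#

    beyond : ∀ r → m N.≤ r → reciprocal r ≈ 0#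
    beyond r m≤r = reflexive (if-no (suc r ∣? m) (λ r∣m → ℕₚ.<⇒≱ (s≤s m≤r) (∣⇒≤ r∣m)))

    codivisor : ∀ r → ι m * reciprocal r ≈ ∑ N (λ k → ι (suc k) * (X^ (suc k N.* suc r)) m)
    codivisor r with suc r ∣? m
    ... | no r∤m = trans (trans (*-congˡ (reflexive (if-no (suc r ∣? m) r∤m))) (zeroʳ _)) (sym (∑-zero< N (λ k _ → trans
            (*-congˡ (X^-off (suc k N.* suc r) m (λ e → r∤m (divides (suc k) (≡.sym e))))) (zeroʳ _))))
    ... | yes (divides (suc q) m≡) = begin
      ι m * reciprocal r
        ≡⟨ ≡.cong (ι m *_) (if-yes (suc r ∣? m) (divides (suc q) m≡)) ⟩
      ι m * inv (suc r)
        ≈⟨ *-congʳ (trans (reflexive (≡.cong ι m≡)) (ι-* (suc q) (suc r))) ⟩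
      ι (suc q) * ι (suc r) * inv (suc r)
        ≈⟨ trans (*-assoc _ _ _) (trans (*-congˡ (inv-suc r)) (*-identityʳ _)) ⟩
      ι (suc q)
        ≈⟨ trans (*-congˡ (trans (reflexive (≡.cong (X^ (suc q N.* suc r)) m≡)) (X^-diag (suc q N.* suc r)))) (*-identityʳ _) ⟨
      ι (suc q) * (X^ (suc q N.* suc r)) m
        ≈⟨ ∑-single N q (λ k → ι (suc k) * (X^ (suc k N.* suc r)) m) q<N (λ k _ k≢q → trans
             (*-congˡ (X^-off (suc k N.* suc r) m (λ e → k≢q (ℕₚ.suc-injective
               (ℕₚ.*-cancelʳ-≡ (suc k) (suc q) (suc r) (≡.trans e m≡)))))) (zeroʳ _)) ⟨
      ∑ N (λ k → ι (suc k) * (X^ (suc k N.* suc r)) m) ∎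
      where
      q<N : q N.< N
      q<N = ℕₚ.≤-trans (ℕₚ.≤-trans (ℕₚ.m≤m*n (suc q) (suc r)) (ℕₚ.≤-reflexive (≡.sym m≡))) m≤N

-- Determinants as iterated exterior products, and derivations acting on them.

module Wedge {c ℓ} (R : CommutativeRing c ℓ) (inv : ℕ → CommutativeRing.Carrier R) where
  open Kit R inv
  open Relation.Binary.Reasoning.Setoid setoid

  Col : Set c
  Col = ℕ → Carrier

  Form : Set c
  Form = List Col → Carrier

  infix 4 _≐_
  _≐_ : Col → Col → Set ℓ
  x ≐ y = ∀ i → x i ≈ y i

  infixl 6 _⊞_
  infixr 7 _•_
  _⊞_ : Col → Col → Col
  (x ⊞ y) i = x i + y i

  _•_ : Carrier → Col → Col
  (a • x) i = a * x i

  -- The exterior product of the linear form `f` with `w`, that is, Laplace expansion along the row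
  -- `f`. The alternating signs come from the subtraction in each recursive call, which fixes the
  -- skipped column as first argument of `w`.
  wedge : (Col → Carrier) → Form → Form
  wedge f w [] = 0#
  wedge f w (x ∷ xs) = f x * w xs - wedge f (λ ys → w (x ∷ ys)) xs

  -- e_{n-1} ∧ … ∧ e_0, the determinant of the first n entries of n columns.
  W : ℕ → Form
  W zero [] = 1#
  W zero (_ ∷ _) = 0#
  W (suc n) = wedge (λ x → x n) (W n)

  wedge-cong : ∀ {f g w v} → (∀ x → f x ≈ g x) → (∀ xs → w xs ≈ v xs) → ∀ xs → wedge f w xs ≈ wedge g v xs
  wedge-cong p q [] = refl
  wedge-cong p q (x ∷ xs) = +-cong (*-cong (p x) (q xs)) (-‿cong (wedge-cong p (λ ys → q (x ∷ ys)) xs))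

  wedge-congʳ : ∀ {f w v} → (∀ xs → w xs ≈ v xs) → ∀ xs → wedge f w xs ≈ wedge f v xs
  wedge-congʳ = wedge-cong (λ _ → refl)

  wedge-+ʳ : ∀ f w v xs → wedge f (λ ys → w ys + v ys) xs ≈ wedge f w xs + wedge f v xs
  wedge-+ʳ f w v [] = sym (+-identityˡ _)
  wedge-+ʳ f w v (x ∷ xs) = trans (+-congˡ (-‿cong (wedge-+ʳ f (w ∘ (x ∷_)) (v ∘ (x ∷_)) xs)))
    (solve 5 (λ a b c d e → a :* (b :+ c) :- (d :+ e) := (a :* b :- d) :+ (a :* c :- e)) refl _ _ _ _ _)

  wedge-*ʳ : ∀ f a w xs → wedge f (λ ys → a * w ys) xs ≈ a * wedge f w xs
  wedge-*ʳ f a w [] = sym (zeroʳ a)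
  wedge-*ʳ f a w (x ∷ xs) = trans (+-congˡ (-‿cong (wedge-*ʳ f a (w ∘ (x ∷_)) xs)))
    (solve 4 (λ f a b c → f :* (a :* b) :- a :* c := a :* (f :* b :- c)) refl _ _ _ _)

  wedge-negʳ : ∀ f w xs → wedge f (λ ys → - w ys) xs ≈ - wedge f w xs
  wedge-negʳ f w xs = trans (wedge-congʳ (λ ys → solve 1 (λ a → :- a := (:- K 1) :* a) refl (w ys)) xs)
    (trans (wedge-*ʳ f (- 1#) w xs) (solve 1 (λ a → (:- K 1) :* a := :- a) refl _))

  wedge-zeroʳ : ∀ f xs → wedge f (λ _ → 0#) xs ≈ 0#
  wedge-zeroʳ f xs = trans (wedge-congʳ (λ _ → sym (zeroˡ 0#)) xs) (trans (wedge-*ʳ f 0# (λ _ → 0#) xs) (zeroˡ _))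

  wedge-+ˡ : ∀ f g w xs → wedge (λ x → f x + g x) w xs ≈ wedge f w xs + wedge g w xs
  wedge-+ˡ f g w [] = sym (+-identityˡ _)
  wedge-+ˡ f g w (x ∷ xs) = trans (+-congˡ (-‿cong (wedge-+ˡ f g (w ∘ (x ∷_)) xs)))
    (solve 5 (λ b c a d e → (b :+ c) :* a :- (d :+ e) := (b :* a :- d) :+ (c :* a :- e)) refl _ _ _ _ _)

  wedge-*ˡ : ∀ a f w xs → wedge (λ x → a * f x) w xs ≈ a * wedge f w xs
  wedge-*ˡ a f w [] = sym (zeroʳ a)
  wedge-*ˡ a f w (x ∷ xs) = trans (+-congˡ (-‿cong (wedge-*ˡ a f (w ∘ (x ∷_)) xs)))
    (solve 4 (λ f a b c → a :* f :* b :- a :* c := a :* (f :* b :- c)) refl _ _ _ _)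

  wedge-zeroˡ : ∀ w xs → wedge (λ _ → 0#) w xs ≈ 0#
  wedge-zeroˡ w [] = refl
  wedge-zeroˡ w (x ∷ xs) = trans (+-cong (zeroˡ _) (-‿cong (wedge-zeroˡ _ xs))) (-‿inverseʳ 0#)

  wedge-swap : ∀ f g w xs → wedge f (wedge g w) xs ≈ - wedge g (wedge f w) xs
  wedge-swap f g w [] = sym -0#≈0#
  wedge-swap f g w (x ∷ xs) = begin
    f x * wedge g w xs - wedge f (λ ys → g x * w ys - wedge g w′ ys) xs
      ≈⟨ +-congˡ (-‿cong (expand f g)) ⟩
    f x * wedge g w xs - (g x * wedge f w xs - wedge f (wedge g w′) xs)
      ≈⟨ +-congˡ (-‿cong (+-congˡ (-‿cong (wedge-swap f g w′ xs)))) ⟩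
    f x * wedge g w xs - (g x * wedge f w xs - - wedge g (wedge f w′) xs)
      ≈⟨ solve 5 (λ a b c d e → a :* b :- (c :* d :- :- e) := :- (c :* d :- (a :* b :- e))) refl _ _ _ _ _ ⟩
    - (g x * wedge f w xs - (f x * wedge g w xs - wedge g (wedge f w′) xs))
      ≈⟨ -‿cong (+-congˡ (-‿cong (expand g f))) ⟨
    - (g x * wedge f w xs - wedge g (λ ys → f x * w ys - wedge f w′ ys) xs) ∎
    where
    w′ : Form
    w′ ys = w (x ∷ ys)
    expand : ∀ f g → wedge f (λ ys → g x * w ys - wedge g w′ ys) xs ≈ g x * wedge f w xs - wedge f (wedge g w′) xs
    expand f g = trans (wedge-+ʳ f (λ ys → g x * w ys) (λ ys → - wedge g w′ ys) xs)
      (+-cong (wedge-*ʳ f (g x) w xs) (wedge-negʳ f (wedge g w′) xs))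

  -- Two is not assumed invertible in this module, so antisymmetry alone does not give this. In the
  -- induction the two terms in which the first column meets one of the equal rows cancel.
  wedge-square : ∀ f w xs → wedge f (wedge f w) xs ≈ 0#
  wedge-square f w [] = refl
  wedge-square f w (x ∷ xs) = begin
    f x * wedge f w xs - wedge f (λ ys → f x * w ys - wedge f w′ ys) xs
      ≈⟨ +-congˡ (-‿cong (trans (wedge-+ʳ f (λ ys → f x * w ys) (λ ys → - wedge f w′ ys) xs)
           (+-cong (wedge-*ʳ f (f x) w xs) (trans (wedge-negʳ f (wedge f w′) xs) (-‿cong (wedge-square f w′ xs)))))) ⟩
    f x * wedge f w xs - (f x * wedge f w xs - 0#)
      ≈⟨ solve 1 (λ a → a :- (a :- K 0) := K 0) refl _ ⟩
    0# ∎
    where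
    w′ : Form
    w′ ys = w (x ∷ ys)

  -- The row `i` already occurs in `W n`; it is moved inwards by `wedge-swap` until it meets its
  -- twin.
  wedge-W-zero : ∀ n i → i N.< n → ∀ xs → wedge (λ x → x i) (W n) xs ≈ 0#
  wedge-W-zero (suc n) i i<1+n xs with i N.≟ n
  ... | yes ≡.refl = wedge-square (λ x → x n) (W n) xs
  ... | no i≢n = trans (wedge-swap (λ x → x i) (λ x → x n) (W n) xs)
    (trans (-‿cong (trans (wedge-congʳ (wedge-W-zero n i (ℕₚ.≤∧≢⇒< (ℕₚ.≤-pred i<1+n) i≢n)) xs) (wedge-zeroʳ _ xs))) -0#≈0#)

  -- Only adjacent equal columns are required to give zero, a condition that `wedge` preserves by a
  -- direct induction. Exchange of neighbours and vanishing on distant repetitions follow in `swap`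
  -- and `repeated`.
  record Alternating (w : Form) : Set (c ⊔ ℓ) where
    field
      resp : ∀ {xs ys} → Pointwise _≐_ xs ys → w xs ≈ w ys
      add : ∀ us x y vs → w (us ++ (x ⊞ y) ∷ vs) ≈ w (us ++ x ∷ vs) + w (us ++ y ∷ vs)
      scale : ∀ us a x vs → w (us ++ (a • x) ∷ vs) ≈ a * w (us ++ x ∷ vs)
      adjacent : ∀ us x vs → w (us ++ x ∷ x ∷ vs) ≈ 0#

  record LinearRow (f : Col → Carrier) : Set (c ⊔ ℓ) where
    field
      respᵣ : ∀ {x y} → x ≐ y → f x ≈ f y
      addᵣ : ∀ x y → f (x ⊞ y) ≈ f x + f y
      scaleᵣ : ∀ a x → f (a • x) ≈ a * f x

  open Alternating
  open LinearRow

  ≐-refl : ∀ xs → Pointwise _≐_ xs xs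
  ≐-refl xs = Pw.refl (λ _ → refl)

  fix-first : ∀ {w} → Alternating w → ∀ x → Alternating (λ ys → w (x ∷ ys))
  fix-first alt x = record
    { resp = λ p → resp alt ((λ _ → refl) ∷ p)
    ; add = λ us → add alt (x ∷ us)
    ; scale = λ us → scale alt (x ∷ us)
    ; adjacent = λ us → adjacent alt (x ∷ us) }

  wedge-alternating : ∀ {f w} → LinearRow f → Alternating w → Alternating (wedge f w)
  wedge-alternating {f} lin alt = record
    { resp = resp′ alt ; add = add′ alt ; scale = scale′ alt ; adjacent = adjacent′ alt }
    where
    resp′ : ∀ {w} → Alternating w → ∀ {xs ys} → Pointwise _≐_ xs ys → wedge f w xs ≈ wedge f w ys
    resp′ alt [] = refl
    resp′ {w} alt {x ∷ xs} {y ∷ ys} (p ∷ ps) = +-cong (*-cong (respᵣ lin p) (resp alt ps)) (-‿cong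
      (trans (wedge-congʳ (λ zs → resp alt (p ∷ ≐-refl zs)) xs) (resp′ (fix-first alt y) ps)))

    add′ : ∀ {w} → Alternating w → ∀ us x y vs →
           wedge f w (us ++ (x ⊞ y) ∷ vs) ≈ wedge f w (us ++ x ∷ vs) + wedge f w (us ++ y ∷ vs)
    add′ {w} alt [] x y vs = trans
      (+-cong (*-congʳ (addᵣ lin x y)) (-‿cong (trans (wedge-congʳ (λ zs → add alt [] x y zs) vs)
        (wedge-+ʳ f (λ zs → w (x ∷ zs)) (λ zs → w (y ∷ zs)) vs))))
      (solve 5 (λ a b c d e → (a :+ b) :* c :- (d :+ e) := (a :* c :- d) :+ (b :* c :- e)) refl _ _ _ _ _)
    add′ alt (u ∷ us) x y vs = trans
      (+-cong (*-congˡ (add alt us x y vs)) (-‿cong (add′ (fix-first alt u) us x y vs)))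
      (solve 5 (λ a b c d e → a :* (b :+ c) :- (d :+ e) := (a :* b :- d) :+ (a :* c :- e)) refl _ _ _ _ _)

    scale′ : ∀ {w} → Alternating w → ∀ us a x vs →
             wedge f w (us ++ (a • x) ∷ vs) ≈ a * wedge f w (us ++ x ∷ vs)
    scale′ {w} alt [] a x vs = trans
      (+-cong (*-congʳ (scaleᵣ lin a x)) (-‿cong (trans (wedge-congʳ (λ zs → scale alt [] a x zs) vs)
        (wedge-*ʳ f a (λ zs → w (x ∷ zs)) vs))))
      (solve 4 (λ a b c d → a :* b :* c :- a :* d := a :* (b :* c :- d)) refl _ _ _ _)
    scale′ alt (u ∷ us) a x vs = trans
      (+-cong (*-congˡ (scale alt us a x vs)) (-‿cong (scale′ (fix-first alt u) us a x vs)))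
      (solve 4 (λ a b c d → b :* (a :* c) :- a :* d := a :* (b :* c :- d)) refl _ _ _ _)

    adjacent′ : ∀ {w} → Alternating w → ∀ us x vs → wedge f w (us ++ x ∷ x ∷ vs) ≈ 0#
    -- The two terms that feed one of the equal columns to `f` leave the same argument for `w` and
    -- have opposite signs.
    adjacent′ {w} alt [] x vs = trans
      (+-congˡ (-‿cong (+-congˡ (-‿cong (trans (wedge-congʳ (λ zs → adjacent alt [] x zs) vs) (wedge-zeroʳ f vs))))))
      (solve 1 (λ a → a :- (a :- K 0) := K 0) refl _)
    adjacent′ alt (u ∷ us) x vs = trans
      (+-cong (trans (*-congˡ (adjacent alt us x vs)) (zeroʳ _)) (-‿cong (adjacent′ (fix-first alt u) us x vs)))
      (-‿inverseʳ 0#)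

  entry-linear : ∀ n → LinearRow (λ x → x n)
  entry-linear n = record { respᵣ = λ p → p n ; addᵣ = λ _ _ → refl ; scaleᵣ = λ _ _ → refl }

  W-alternating : ∀ n → Alternating (W n)
  W-alternating zero = record { resp = resp₀ ; add = add₀ ; scale = scale₀ ; adjacent = adjacent₀ }
    where
    resp₀ : ∀ {xs ys} → Pointwise _≐_ xs ys → W 0 xs ≈ W 0 ys
    resp₀ [] = refl
    resp₀ (_ ∷ _) = refl
    add₀ : ∀ us x y vs → W 0 (us ++ (x ⊞ y) ∷ vs) ≈ W 0 (us ++ x ∷ vs) + W 0 (us ++ y ∷ vs)
    add₀ [] x y vs = sym (+-identityˡ _)
    add₀ (_ ∷ _) x y vs = sym (+-identityˡ _)
    scale₀ : ∀ us a x vs → W 0 (us ++ (a • x) ∷ vs) ≈ a * W 0 (us ++ x ∷ vs)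
    scale₀ [] a x vs = sym (zeroʳ _)
    scale₀ (_ ∷ _) a x vs = sym (zeroʳ _)
    adjacent₀ : ∀ us x vs → W 0 (us ++ x ∷ x ∷ vs) ≈ 0#
    adjacent₀ [] x vs = refl
    adjacent₀ (_ ∷ _) x vs = refl
  W-alternating (suc n) = wedge-alternating (entry-linear n) (W-alternating n)

  module _ {w : Form} (alt : Alternating w) where

    -- Polarisation: expand the vanishing value of the form at the repeated column `x ⊞ y`.
    swap : ∀ us x y vs → w (us ++ x ∷ y ∷ vs) ≈ - w (us ++ y ∷ x ∷ vs)
    swap us x y vs = begin
      w₂ x y                                        ≈⟨ solve 2 (λ a b → a := (K 0 :+ a :+ (b :+ K 0)) :- b) refl _ _ ⟩
      (0# + w₂ x y + (w₂ y x + 0#)) - w₂ y x        ≈⟨ +-congʳ (+-cong (+-congʳ (adjacent alt us x vs)) (+-congˡ (adjacent alt us y vs))) ⟨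
      (w₂ x x + w₂ x y + (w₂ y x + w₂ y y)) - w₂ y x ≈⟨ +-congʳ (+-cong (second x) (second y)) ⟨
      (w₂ x (x ⊞ y) + w₂ y (x ⊞ y)) - w₂ y x        ≈⟨ +-congʳ (add alt us x y ((x ⊞ y) ∷ vs)) ⟨
      w₂ (x ⊞ y) (x ⊞ y) - w₂ y x                   ≈⟨ +-congʳ (adjacent alt us (x ⊞ y) vs) ⟩
      0# - w₂ y x                                   ≈⟨ +-identityˡ _ ⟩
      - w₂ y x                                      ∎
      where
      w₂ : Col → Col → Carrier
      w₂ x y = w (us ++ x ∷ y ∷ vs)
      second : ∀ z → w₂ z (x ⊞ y) ≈ w₂ z x + w₂ z y
      second z = begin
        w (us ++ z ∷ (x ⊞ y) ∷ vs)
          ≡⟨ ≡.cong w (Lₚ.++-assoc us [ z ] ((x ⊞ y) ∷ vs)) ⟨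
        w ((us ++ [ z ]) ++ (x ⊞ y) ∷ vs)
          ≈⟨ add alt (us ++ [ z ]) x y vs ⟩
        w ((us ++ [ z ]) ++ x ∷ vs) + w ((us ++ [ z ]) ++ y ∷ vs)
          ≡⟨ ≡.cong₂ (λ a b → w a + w b) (Lₚ.++-assoc us [ z ] (x ∷ vs)) (Lₚ.++-assoc us [ z ] (y ∷ vs)) ⟩
        w₂ z x + w₂ z y ∎

    repeated : ∀ us x ys vs → w (us ++ x ∷ (ys ++ x ∷ vs)) ≈ 0#
    repeated us x [] vs = adjacent alt us x vs
    repeated us x (y ∷ ys) vs = begin
      w (us ++ x ∷ y ∷ (ys ++ x ∷ vs))            ≈⟨ swap us x y (ys ++ x ∷ vs) ⟩
      - w (us ++ y ∷ x ∷ (ys ++ x ∷ vs))          ≡⟨ ≡.cong (λ zs → - w zs) (Lₚ.++-assoc us [ y ] (x ∷ (ys ++ x ∷ vs))) ⟨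
      - w ((us ++ [ y ]) ++ x ∷ (ys ++ x ∷ vs))   ≈⟨ -‿cong (repeated (us ++ [ y ]) x ys vs) ⟩
      - 0#                                        ≈⟨ -0#≈0# ⟩
      0#                                          ∎

    repeated-before : ∀ {x us} vs → x ∈ us → w (us ++ x ∷ vs) ≈ 0#
    repeated-before {x} vs x∈us with ∈-∃++ x∈us
    ... | us₁ , us₂ , ≡.refl = trans (reflexive (≡.cong w (Lₚ.++-assoc us₁ (x ∷ us₂) (x ∷ vs)))) (repeated us₁ x us₂ vs)

    repeated-after : ∀ {x vs} us → x ∈ vs → w (us ++ x ∷ vs) ≈ 0#
    repeated-after {x} us x∈vs with ∈-∃++ x∈vs
    ... | vs₁ , vs₂ , ≡.refl = repeated us x vs₁ vs₂

  derive : (Col → Col) → Form → Form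
  derive A w [] = 0#
  derive A w (x ∷ xs) = w (A x ∷ xs) + derive A (λ ys → w (x ∷ ys)) xs

  derive-zero : ∀ A xs → derive A (λ _ → 0#) xs ≈ 0#
  derive-zero A [] = refl
  derive-zero A (x ∷ xs) = trans (+-identityˡ _) (derive-zero A xs)

  derive-lin : ∀ A a w v xs → derive A (λ ys → a * w ys - v ys) xs ≈ a * derive A w xs - derive A v xs
  derive-lin A a w v [] = solve 1 (λ a → K 0 := a :* K 0 :- K 0) refl a
  derive-lin A a w v (x ∷ xs) = trans (+-congˡ (derive-lin A a (w ∘ (x ∷_)) (v ∘ (x ∷_)) xs))
    (solve 5 (λ a b c d e → (a :* b :- c) :+ (a :* d :- e) := a :* (b :+ d) :- (c :+ e)) refl _ _ _ _ _)

  -- The Leibniz rule in the row direction. It turns the sum over columns that defines `derive` into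
  -- a sum over rows, where the trace can be read off the matrix of `A`.
  derive-wedge : ∀ A f w xs → derive A (wedge f w) xs ≈ wedge (f ∘ A) w xs + wedge f (derive A w) xs
  derive-wedge A f w [] = sym (+-identityˡ _)
  derive-wedge A f w (x ∷ xs) = begin
    (f (A x) * w xs - wedge f (λ ys → w (A x ∷ ys)) xs) + derive A (λ ys → f x * w ys - wedge f w′ ys) xs
      ≈⟨ +-congˡ (trans (derive-lin A (f x) w (wedge f w′) xs) (+-congˡ (-‿cong (derive-wedge A f w′ xs)))) ⟩
    (f (A x) * w xs - wedge f (λ ys → w (A x ∷ ys)) xs)
      + (f x * derive A w xs - (wedge (f ∘ A) w′ xs + wedge f (derive A w′) xs))
      ≈⟨ solve 6 (λ a b c d e f → (a :* b :- c) :+ (d :- (e :+ f)) := (a :* b :- e) :+ (d :- (c :+ f))) refl _ _ _ _ _ _ ⟩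
    (f (A x) * w xs - wedge (f ∘ A) w′ xs)
      + (f x * derive A w xs - (wedge f (λ ys → w (A x ∷ ys)) xs + wedge f (derive A w′) xs))
      ≈⟨ +-congˡ (+-congˡ (-‿cong (wedge-+ʳ f (λ ys → w (A x ∷ ys)) (derive A w′) xs))) ⟨
    (f (A x) * w xs - wedge (f ∘ A) w′ xs)
      + (f x * derive A w xs - wedge f (λ ys → w (A x ∷ ys) + derive A w′ ys) xs) ∎
    where
    w′ : Form
    w′ ys = w (x ∷ ys)

  derive-W₀ : ∀ A xs → derive A (W 0) xs ≈ 0#
  derive-W₀ A [] = refl
  derive-W₀ A (x ∷ xs) = trans (+-identityˡ _) (derive-zero A xs)

  -- `φ i` is the part of row i lying in the span of the earlier rows. It is described only by its
  -- vanishing against `W i`, so that an operator given by a recursion, such as `U k`, never needs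
  -- explicit matrix entries.
  derive-lower-triangular : ∀ A (d : ℕ → Carrier) (φ : ℕ → Col → Carrier) →
    (∀ i x → A x i ≈ d i * x i + φ i x) → (∀ i xs → wedge (φ i) (W i) xs ≈ 0#) →
    ∀ n xs → derive A (W n) xs ≈ ∑ n d * W n xs
  derive-lower-triangular A d φ rows null zero xs = trans (derive-W₀ A xs) (sym (zeroˡ _))
  derive-lower-triangular A d φ rows null (suc n) xs = begin
    derive A (W (suc n)) xs
      ≈⟨ derive-wedge A (λ x → x n) (W n) xs ⟩
    wedge (λ x → A x n) (W n) xs + wedge (λ x → x n) (derive A (W n)) xs
      ≈⟨ +-cong (trans (wedge-cong (rows n) (λ _ → refl) xs) row)
           (trans (wedge-congʳ (derive-lower-triangular A d φ rows null n) xs) (wedge-*ʳ _ (∑ n d) (W n) xs)) ⟩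
    d n * W (suc n) xs + ∑ n d * W (suc n) xs
      ≈⟨ trans (sym (distribʳ _ _ _)) (*-congʳ (trans (+-comm _ _) (sym (∑-last n d)))) ⟩
    ∑ (suc n) d * W (suc n) xs ∎
    where
    row : wedge (λ x → d n * x n + φ n x) (W n) xs ≈ d n * W (suc n) xs
    row = begin
      wedge (λ x → d n * x n + φ n x) (W n) xs
        ≈⟨ wedge-+ˡ (λ x → d n * x n) (φ n) (W n) xs ⟩
      wedge (λ x → d n * x n) (W n) xs + wedge (φ n) (W n) xs
        ≈⟨ +-cong (wedge-*ˡ (d n) (λ x → x n) (W n) xs) (null n xs) ⟩
      d n * W (suc n) xs + 0#
        ≈⟨ +-identityʳ _ ⟩
      d n * W (suc n) xs ∎

  -- The off-diagonal part replaces row i by row i + 1. For every row but the last this repeats a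
  -- row that is present, so only the last row contributes: it leaves the minor in which row n gives
  -- way to row n + 1.
  derive-superdiagonal : ∀ A (d a : ℕ → Carrier) → (∀ i x → A x i ≈ d i * x i + a i * x (suc i)) →
    ∀ n xs → derive A (W (suc n)) xs ≈ ∑ (suc n) d * W (suc n) xs + a n * wedge (λ x → x (suc n)) (W n) xs
  derive-superdiagonal A d a rows n xs = begin
    derive A (W (suc n)) xs
      ≈⟨ derive-wedge A (λ x → x n) (W n) xs ⟩
    wedge (λ x → A x n) (W n) xs + wedge (λ x → x n) (derive A (W n)) xs
      ≈⟨ +-cong (trans (wedge-cong (rows n) (λ _ → refl) xs)
           (trans (wedge-+ˡ (λ x → d n * x n) (λ x → a n * x (suc n)) (W n) xs)
             (+-cong (wedge-*ˡ (d n) (λ x → x n) (W n) xs) (wedge-*ˡ (a n) (λ x → x (suc n)) (W n) xs))))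
           (lower n) ⟩
    (d n * W (suc n) xs + a n * wedge (λ x → x (suc n)) (W n) xs) + ∑ n d * W (suc n) xs
      ≈⟨ solve 4 (λ d w a s → (d :* w :+ a) :+ s :* w := (s :+ d) :* w :+ a) refl _ _ _ _ ⟩
    (∑ n d + d n) * W (suc n) xs + a n * wedge (λ x → x (suc n)) (W n) xs
      ≈⟨ +-congʳ (*-congʳ (∑-last n d)) ⟨
    ∑ (suc n) d * W (suc n) xs + a n * wedge (λ x → x (suc n)) (W n) xs ∎
    where
    lower : ∀ n → wedge (λ x → x n) (derive A (W n)) xs ≈ ∑ n d * W (suc n) xs
    lower zero = trans (wedge-congʳ (derive-W₀ A) xs) (trans (wedge-zeroʳ _ xs) (sym (zeroˡ _)))
    lower (suc n) = begin
      wedge (λ x → x (suc n)) (derive A (W (suc n))) xs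
        ≈⟨ wedge-congʳ (derive-superdiagonal A d a rows n) xs ⟩
      wedge (λ x → x (suc n)) (λ ys → ∑ (suc n) d * W (suc n) ys + a n * wedge (λ x → x (suc n)) (W n) ys) xs
        ≈⟨ wedge-+ʳ _ (λ ys → ∑ (suc n) d * W (suc n) ys) (λ ys → a n * wedge (λ x → x (suc n)) (W n) ys) xs ⟩
      wedge (λ x → x (suc n)) (λ ys → ∑ (suc n) d * W (suc n) ys) xs
        + wedge (λ x → x (suc n)) (λ ys → a n * wedge (λ x → x (suc n)) (W n) ys) xs
        ≈⟨ +-cong (wedge-*ʳ _ (∑ (suc n) d) (W (suc n)) xs)
             (trans (wedge-*ʳ _ (a n) (wedge (λ x → x (suc n)) (W n)) xs)
               (trans (*-congˡ (wedge-square _ (W n) xs)) (zeroʳ _))) ⟩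
      ∑ (suc n) d * W (suc (suc n)) xs + 0#
        ≈⟨ +-identityʳ _ ⟩
      ∑ (suc n) d * W (suc (suc n)) xs ∎

  before after : (ℕ → Col) → ℕ → ℕ → List Col
  before f n j = applyUpTo f j
  after f n j = applyUpTo (λ i → f (suc j N.+ i)) (n ∸ suc j)

  replaced : Form → (ℕ → Col) → ℕ → ℕ → Col → Carrier
  replaced w f n j x = w (before f n j ++ x ∷ after f n j)

  around : ∀ f {n j} → j N.< n → before f n j ++ f j ∷ after f n j ≡ applyUpTo f n
  around f {suc n} {zero} _ = ≡.refl
  around f {suc n} {suc j} (s≤s j<n) = ≡.cong (f 0 ∷_) (around (f ∘ suc) j<n)

  derive-∑ : ∀ A w f n → derive A w (applyUpTo f n) ≈ ∑ n (λ j → replaced w f n j (A (f j)))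
  derive-∑ A w f zero = refl
  derive-∑ A w f (suc n) = +-congˡ (derive-∑ A (λ ys → w (f 0 ∷ ys)) (f ∘ suc) n)

-- A basis of the odd polynomials and the operators acting on it.

module Points {c ℓ} (R : CommutativeRing c ℓ) (inv : ℕ → CommutativeRing.Carrier R)
  (inv-suc : Reciprocals R inv) where
  open Kit R inv
  open Units R inv inv-suc
  open Wedge R inv
  open Relation.Binary.Reasoning.Setoid setoid

  -- `γ i` is (2i + 3)!/(2i + 1)!, the ratio of the factorials that normalise consecutive entries of
  -- `pt v`.
  γ γ⁻¹ : ℕ → Carrier
  γ i = ι (2 N.+ 2 N.* i) * ι (3 N.+ 2 N.* i)
  γ⁻¹ i = inv (2 N.+ 2 N.* i) * inv (3 N.+ 2 N.* i)

  γ-unit : ∀ i → γ i * γ⁻¹ i ≈ 1#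
  γ-unit i = trans (solve 4 (λ a b c d → a :* b :* (c :* d) := (a :* c) :* (b :* d)) refl _ _ _ _)
    (trans (*-cong (inv-suc _) (inv-suc _)) (*-identityˡ 1#))

  ι-double : ∀ i → ι (2 N.* i) ≈ ι i + ι i
  ι-double i = trans (ι-* 2 i) (solve 1 (λ i → (K 1 :+ (K 1 :+ K 0)) :* i := i :+ i) refl _)

  γ-value : ∀ i → γ i ≈ (1# + (1# + (ι i + ι i))) * (1# + (1# + (1# + (ι i + ι i))))
  γ-value i = *-cong (+-congˡ (+-congˡ (ι-double i))) (+-congˡ (+-congˡ (+-congˡ (ι-double i))))

  -- pt v i = v (v² − 1²) ⋯ (v² − i²) / (2i + 1)!, an odd polynomial in v.  On these polynomials the
  -- second central difference is a shift, and so is (up to triangular terms) multiplication by v².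
  pt : Carrier → Col
  pt v zero = v
  pt v (suc i) = (v * v - ι (suc i) * ι (suc i)) * pt v i * γ⁻¹ i

  pt-suc : ∀ v i → γ i * pt v (suc i) ≈ (v * v - ι (suc i) * ι (suc i)) * pt v i
  pt-suc v i = trans (solve 3 (λ a b c → a :* (b :* c) := (a :* c) :* b) refl (γ i) _ (γ⁻¹ i))
    (trans (*-congʳ (γ-unit i)) (*-identityˡ _))

  pt-cong : ∀ {v v′} → v ≈ v′ → pt v ≐ pt v′
  pt-cong e zero = e
  pt-cong e (suc i) = *-congʳ (*-cong (+-congʳ (*-cong e e)) (pt-cong e i))

  pt-zero : ∀ i → pt 0# i ≈ 0#
  pt-zero zero = refl
  pt-zero (suc i) = trans (*-congʳ (trans (*-congˡ (pt-zero i)) (zeroʳ _))) (zeroˡ _)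

  pt-neg : ∀ v i → pt (- v) i ≈ - pt v i
  pt-neg v zero = refl
  pt-neg v (suc i) = trans (*-congʳ (*-congˡ (pt-neg v i)))
    (solve 4 (λ v a b c → (:- v :* :- v :- c) :* :- a :* b := :- ((v :* v :- c) :* a :* b)) refl v _ _ _)

  δ : Col → Col
  δ x zero = 0#
  δ x (suc i) = x i

  private
    module Step (n v : Carrier) where
      m²  : Carrier
      m² = (1# + n) * (1# + n)
      γ₁ = (1# + (1# + (n + n))) * (1# + (1# + (1# + (n + n))))

      -- The letters stand for `a` = `pt (v + 1#) i`, `b` = `pt (v - 1#) i`, `g` = `pt v i`, `p` =
      -- `δ (pt v) i` and `n` = `ι i`. As (v ± 1)² - m² = (v² + 1 - m²) ± 2v, the next sum mixes
      -- `a + b` with `v * (a - b)`, so the sum and the difference have to be carried through one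
      -- induction. The third premise trades the remaining multiple of `p` for a multiple of `g`.
      sum-step : ∀ {a b g p} → a + b ≈ g + g + p →
        v * (a - b) ≈ (n + n + n + n + 1# + 1#) * g + n * p →
        (n + n) * (n + n + 1#) * g ≈ (v * v - n * n) * p →
        ((v + 1#) * (v + 1#) - m²) * a + ((v - 1#) * (v - 1#) - m²) * b
          ≈ (v * v - m²) * g + (v * v - m²) * g + γ₁ * g
      sum-step {a} {b} {g} {p} h₁ h₂ h₃ = begin
        ((v + 1#) * (v + 1#) - m²) * a + ((v - 1#) * (v - 1#) - m²) * b
          ≈⟨ solve 4 (λ n v a b → let m = (K 1 :+ n) :* (K 1 :+ n) in
               ((v :+ K 1) :* (v :+ K 1) :- m) :* a :+ ((v :- K 1) :* (v :- K 1) :- m) :* b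
               := (v :* v :+ K 1 :- m) :* (a :+ b) :+ (v :* (a :- b) :+ v :* (a :- b))) refl n v a b ⟩
        (v * v + 1# - m²) * (a + b) + (v * (a - b) + v * (a - b))
          ≈⟨ +-cong (*-congˡ h₁) (+-cong h₂ h₂) ⟩
        (v * v + 1# - m²) * (g + g + p) + (q + q)
          ≈⟨ solve 4 (λ n v g p → let m = (K 1 :+ n) :* (K 1 :+ n) ; q = (n :+ n :+ n :+ n :+ K 1 :+ K 1) :* g :+ n :* p in
               (v :* v :+ K 1 :- m) :* (g :+ g :+ p) :+ (q :+ q)
               := (v :* v :- m) :* g :+ (v :* v :- m) :* g :+ (K 6 :+ K 8 :* n) :* g :+ (v :* v :- n :* n) :* p) refl n v g p ⟩
        (v * v - m²) * g + (v * v - m²) * g + (⟦K⟧ 6 + ⟦K⟧ 8 * n) * g + (v * v - n * n) * p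
          ≈⟨ +-congˡ h₃ ⟨
        (v * v - m²) * g + (v * v - m²) * g + (⟦K⟧ 6 + ⟦K⟧ 8 * n) * g + (n + n) * (n + n + 1#) * g
          ≈⟨ solve 3 (λ n v g → let m = (K 1 :+ n) :* (K 1 :+ n) in
               (v :* v :- m) :* g :+ (v :* v :- m) :* g :+ (K 6 :+ K 8 :* n) :* g :+ (n :+ n) :* (n :+ n :+ K 1) :* g
               := (v :* v :- m) :* g :+ (v :* v :- m) :* g
                  :+ (K 1 :+ (K 1 :+ (n :+ n))) :* (K 1 :+ (K 1 :+ (K 1 :+ (n :+ n)))) :* g) refl n v g ⟩
        (v * v - m²) * g + (v * v - m²) * g + γ₁ * g ∎
        where
        q = (n + n + n + n + 1# + 1#) * g + n * p

      difference-step : ∀ {a b g p} → a + b ≈ g + g + p →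
        v * (a - b) ≈ (n + n + n + n + 1# + 1#) * g + n * p →
        (n + n) * (n + n + 1#) * g ≈ (v * v - n * n) * p →
        v * (((v + 1#) * (v + 1#) - m²) * a - ((v - 1#) * (v - 1#) - m²) * b)
          ≈ (⟦K⟧ 4 * (1# + n) + 1# + 1#) * ((v * v - m²) * g) + γ₁ * ((1# + n) * g)
      difference-step {a} {b} {g} {p} h₁ h₂ h₃ = begin
        v * (((v + 1#) * (v + 1#) - m²) * a - ((v - 1#) * (v - 1#) - m²) * b)
          ≈⟨ solve 4 (λ n v a b → let m = (K 1 :+ n) :* (K 1 :+ n) in
               v :* (((v :+ K 1) :* (v :+ K 1) :- m) :* a :- ((v :- K 1) :* (v :- K 1) :- m) :* b)
               := (v :* v :+ K 1 :- m) :* (v :* (a :- b)) :+ K 2 :* (v :* v) :* (a :+ b)) refl n v a b ⟩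
        (v * v + 1# - m²) * (v * (a - b)) + ⟦K⟧ 2 * (v * v) * (a + b)
          ≈⟨ +-cong (*-congˡ h₂) (*-congˡ h₁) ⟩
        (v * v + 1# - m²) * q + ⟦K⟧ 2 * (v * v) * (g + g + p)
          ≈⟨ solve 4 (λ n v g p → let m = (K 1 :+ n) :* (K 1 :+ n) ; q = (n :+ n :+ n :+ n :+ K 1 :+ K 1) :* g in
               (v :* v :+ K 1 :- m) :* (q :+ n :* p) :+ K 2 :* (v :* v) :* (g :+ g :+ p)
               := (v :* v :+ K 1 :- m) :* q :+ K 2 :* (v :* v) :* (g :+ g) :+ (n :+ K 2) :* ((v :* v :- n :* n) :* p)) refl n v g p ⟩
        (v * v + 1# - m²) * q₁ + ⟦K⟧ 2 * (v * v) * (g + g) + (n + ⟦K⟧ 2) * ((v * v - n * n) * p)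
          ≈⟨ +-congˡ (*-congˡ h₃) ⟨
        (v * v + 1# - m²) * q₁ + ⟦K⟧ 2 * (v * v) * (g + g) + (n + ⟦K⟧ 2) * ((n + n) * (n + n + 1#) * g)
          ≈⟨ solve 3 (λ n v g → let m = (K 1 :+ n) :* (K 1 :+ n) ; q = (n :+ n :+ n :+ n :+ K 1 :+ K 1) :* g in
               (v :* v :+ K 1 :- m) :* q :+ K 2 :* (v :* v) :* (g :+ g) :+ (n :+ K 2) :* ((n :+ n) :* (n :+ n :+ K 1) :* g)
               := (K 4 :* (K 1 :+ n) :+ K 1 :+ K 1) :* ((v :* v :- m) :* g)
                  :+ (K 1 :+ (K 1 :+ (n :+ n))) :* (K 1 :+ (K 1 :+ (K 1 :+ (n :+ n)))) :* ((K 1 :+ n) :* g)) refl n v g ⟩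
        (⟦K⟧ 4 * (1# + n) + 1# + 1#) * ((v * v - m²) * g) + γ₁ * ((1# + n) * g) ∎
        where
        q₁ = (n + n + n + n + 1# + 1#) * g
        q = q₁ + n * p

    previous : ∀ v i → (ι i + ι i) * (ι i + ι i + 1#) * pt v i ≈ (v * v - ι i * ι i) * δ (pt v) i
    previous v zero = solve 1 (λ v → (K 0 :+ K 0) :* (K 0 :+ K 0 :+ K 1) :* v := (v :* v :- K 0 :* K 0) :* K 0) refl v
    previous v (suc i) = trans (*-congʳ (trans
        (solve 1 (λ n → (K 1 :+ n :+ (K 1 :+ n)) :* (K 1 :+ n :+ (K 1 :+ n) :+ K 1)
          := (K 1 :+ (K 1 :+ (n :+ n))) :* (K 1 :+ (K 1 :+ (K 1 :+ (n :+ n))))) refl (ι i))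
        (sym (γ-value i)))) (pt-suc v i)

    -- The plain difference of an odd polynomial is even; the factor `v` makes it odd again and
    -- hence expressible in the entries of `pt`.
    Sum Difference : Carrier → ℕ → Set ℓ
    Sum v i = pt (v + 1#) i + pt (v - 1#) i ≈ pt v i + pt v i + δ (pt v) i
    Difference v i = v * (pt (v + 1#) i - pt (v - 1#) i)
      ≈ (ι i + ι i + ι i + ι i + 1# + 1#) * pt v i + ι i * δ (pt v) i

    sum-step : ∀ v i → Sum v i → Difference v i → Sum v (suc i)
    sum-step v i h₁ h₂ = unit-cancel (γ-unit i) (begin
      γ i * (pt (v + 1#) (suc i) + pt (v - 1#) (suc i))
        ≈⟨ trans (distribˡ _ _ _) (+-cong (pt-suc (v + 1#) i) (pt-suc (v - 1#) i)) ⟩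
      _ ≈⟨ Step.sum-step (ι i) v h₁ h₂ (previous v i) ⟩
      _ ≈⟨ +-cong (+-cong (pt-suc v i) (pt-suc v i)) (*-congʳ (γ-value i)) ⟨
      γ i * pt v (suc i) + γ i * pt v (suc i) + γ i * pt v i
        ≈⟨ solve 3 (λ γ a b → γ :* a :+ γ :* a :+ γ :* b := γ :* (a :+ a :+ b)) refl _ _ _ ⟩
      γ i * (pt v (suc i) + pt v (suc i) + pt v i) ∎)

    difference-step : ∀ v i → Sum v i → Difference v i → Difference v (suc i)
    difference-step v i h₁ h₂ = unit-cancel (γ-unit i) (begin
      γ i * (v * (pt (v + 1#) (suc i) - pt (v - 1#) (suc i)))
        ≈⟨ solve 4 (λ g v a b → g :* (v :* (a :- b)) := v :* (g :* a :- g :* b)) refl _ _ _ _ ⟩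
      v * (γ i * pt (v + 1#) (suc i) - γ i * pt (v - 1#) (suc i))
        ≈⟨ *-congˡ (+-cong (pt-suc (v + 1#) i) (-‿cong (pt-suc (v - 1#) i))) ⟩
      _ ≈⟨ Step.difference-step (ι i) v h₁ h₂ (previous v i) ⟩
      _ ≈⟨ +-cong (*-congˡ (pt-suc v i)) (*-congʳ (γ-value i)) ⟨
      _ ≈⟨ solve 4 (λ n γ a b → (K 4 :* (K 1 :+ n) :+ K 1 :+ K 1) :* (γ :* a) :+ γ :* ((K 1 :+ n) :* b)
              := γ :* ((K 1 :+ n :+ (K 1 :+ n) :+ (K 1 :+ n) :+ (K 1 :+ n) :+ K 1 :+ K 1) :* a :+ (K 1 :+ n) :* b))
              refl (ι i) (γ i) (pt v (suc i)) (pt v i) ⟩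
      _ ∎)

    both : ∀ v i → Sum v i × Difference v i
    both v zero = solve 1 (λ v → v :+ K 1 :+ (v :- K 1) := v :+ v :+ K 0) refl v
      , solve 1 (λ v → v :* (v :+ K 1 :- (v :- K 1)) := (K 0 :+ K 0 :+ K 0 :+ K 0 :+ K 1 :+ K 1) :* v :+ K 0 :* K 0) refl v
    both v (suc i) = let s , d = both v i in sum-step v i s d , difference-step v i s d

  pt-second-difference : ∀ v i → pt (v + 1#) i + pt (v - 1#) i ≈ pt v i + pt v i + δ (pt v) i
  pt-second-difference v i = proj₁ (both v i)

  -- U k is the operator x ↦ x(· + k) + x(· − k), computed by the Chebyshev recursion.
  U : ℕ → Col → Col
  U zero x = x ⊞ x
  U (suc zero) x = x ⊞ x ⊞ δ x
  U (suc (suc k)) x = U (suc k) x ⊞ U (suc k) x ⊞ δ (U (suc k) x) ⊞ (- 1#) • U k x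

  U-cong : ∀ k {x y} → x ≐ y → U k x ≐ U k y
  δ-cong : ∀ {x y} → x ≐ y → δ x ≐ δ y
  δ-cong p zero = refl
  δ-cong p (suc i) = p i
  U-cong zero p i = +-cong (p i) (p i)
  U-cong (suc zero) p i = +-cong (+-cong (p i) (p i)) (δ-cong p i)
  U-cong (suc (suc k)) p i = +-cong (+-cong (+-cong (U-cong (suc k) p i) (U-cong (suc k) p i))
    (δ-cong (U-cong (suc k) p) i)) (*-congˡ (U-cong k p i))

  private
    δ-⊞ : ∀ x y i → δ (x ⊞ y) i ≈ δ x i + δ y i
    δ-⊞ x y zero = sym (+-identityˡ _)
    δ-⊞ x y (suc i) = refl

  pt-U : ∀ k v → pt (v + ι k) ⊞ pt (v - ι k) ≐ U k (pt v)
  pt-U zero v i = +-cong (pt-cong (+-identityʳ v) i) (pt-cong (solve 1 (λ v → v :- K 0 := v) refl v) i)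
  pt-U (suc zero) v i = trans (+-cong (pt-cong (solve 1 (λ v → v :+ (K 1 :+ K 0) := v :+ K 1) refl v) i)
    (pt-cong (solve 1 (λ v → v :- (K 1 :+ K 0) := v :- K 1) refl v) i)) (pt-second-difference v i)
  pt-U (suc (suc k)) v i = begin
    pt (v + ι (2 N.+ k)) i + pt (v - ι (2 N.+ k)) i
      ≈⟨ +-cong (up i) (down i) ⟩
    (pt p i + pt p i + δ (pt p) i - pt (v + ι k) i) + (pt q i + pt q i + δ (pt q) i - pt (v - ι k) i)
      ≈⟨ solve 6 (λ a b c d e f → (a :+ a :+ b :- c) :+ (d :+ d :+ e :- f)
           := (a :+ d) :+ (a :+ d) :+ (b :+ e) :+ (:- K 1) :* (c :+ f)) refl _ _ _ _ _ _ ⟩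
    (pt p i + pt q i) + (pt p i + pt q i) + (δ (pt p) i + δ (pt q) i) + - 1# * (pt (v + ι k) i + pt (v - ι k) i)
      ≈⟨ +-cong (+-cong (+-cong (pt-U (suc k) v i) (pt-U (suc k) v i))
           (trans (sym (δ-⊞ (pt p) (pt q) i)) (δ-cong (pt-U (suc k) v) i))) (*-congˡ (pt-U k v i)) ⟩
    U (suc (suc k)) (pt v) i ∎
    where
    p q : Carrier
    p = v + ι (suc k)
    q = v - ι (suc k)
    up : ∀ i → pt (v + ι (2 N.+ k)) i ≈ pt p i + pt p i + δ (pt p) i - pt (v + ι k) i
    up i = begin
      pt (v + ι (2 N.+ k)) i
        ≈⟨ solve 2 (λ a b → a := (a :+ b) :- b) refl _ _ ⟩
      (pt (v + ι (2 N.+ k)) i + pt (v + ι k) i) - pt (v + ι k) i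
        ≈⟨ +-congʳ (+-cong (pt-cong (solve 2 (λ v k → v :+ (K 1 :+ (K 1 :+ k)) := v :+ (K 1 :+ k) :+ K 1) refl v (ι k)) i)
             (pt-cong (solve 2 (λ v k → v :+ k := v :+ (K 1 :+ k) :- K 1) refl v (ι k)) i)) ⟩
      (pt (p + 1#) i + pt (p - 1#) i) - pt (v + ι k) i
        ≈⟨ +-congʳ (pt-second-difference p i) ⟩
      pt p i + pt p i + δ (pt p) i - pt (v + ι k) i ∎
    down : ∀ i → pt (v - ι (2 N.+ k)) i ≈ pt q i + pt q i + δ (pt q) i - pt (v - ι k) i
    down i = begin
      pt (v - ι (2 N.+ k)) i
        ≈⟨ solve 2 (λ a b → a := (b :+ a) :- b) refl _ _ ⟩
      (pt (v - ι k) i + pt (v - ι (2 N.+ k)) i) - pt (v - ι k) i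
        ≈⟨ +-congʳ (+-cong (pt-cong (solve 2 (λ v k → v :- k := v :- (K 1 :+ k) :+ K 1) refl v (ι k)) i)
             (pt-cong (solve 2 (λ v k → v :- (K 1 :+ (K 1 :+ k)) := v :- (K 1 :+ k) :- K 1) refl v (ι k)) i)) ⟩
      (pt (q + 1#) i + pt (q - 1#) i) - pt (v - ι k) i
        ≈⟨ +-congʳ (pt-second-difference q i) ⟩
      pt q i + pt q i + δ (pt q) i - pt (v - ι k) i ∎

  -- `U k` is twice the identity plus a strictly lower triangular part `φ k`, so its trace on n rows
  -- is 2n. Strictness passes through the Chebyshev recursion: multiples of φ are harmless, and δ
  -- sends row i to the previous row, so that δ of a lower triangular operator is strictly lower
  -- triangular.
  derive-U : ∀ k n xs → derive (U k) (W n) xs ≈ ∑ n (λ _ → ι 2) * W n xs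
  derive-U k = derive-lower-triangular (U k) (λ _ → ι 2) (φ k) (rows k) (null k)
    where
    φ : ℕ → ℕ → Col → Carrier
    φ k i x = U k x i - (x i + x i)

    rows : ∀ k i x → U k x i ≈ ι 2 * x i + φ k i x
    rows k i x = solve 2 (λ u x → u := (K 1 :+ (K 1 :+ K 0)) :* x :+ (u :- (x :+ x))) refl _ _

    null-+ : ∀ i {f g} → (∀ xs → wedge f (W i) xs ≈ 0#) → (∀ xs → wedge g (W i) xs ≈ 0#) →
             ∀ xs → wedge (λ x → f x + g x) (W i) xs ≈ 0#
    null-+ i p q xs = trans (wedge-+ˡ _ _ (W i) xs) (trans (+-cong (p xs) (q xs)) (+-identityˡ _))

    null-* : ∀ i {f} a → (∀ xs → wedge f (W i) xs ≈ 0#) → ∀ xs → wedge (λ x → a * f x) (W i) xs ≈ 0#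
    null-* i a p xs = trans (wedge-*ˡ a _ (W i) xs) (trans (*-congˡ (p xs)) (zeroʳ a))

    null-≈ : ∀ i {f g} → (∀ x → f x ≈ g x) → (∀ xs → wedge g (W i) xs ≈ 0#) → ∀ xs → wedge f (W i) xs ≈ 0#
    null-≈ i p q xs = trans (wedge-cong p (λ _ → refl) xs) (q xs)

    null-suc : ∀ i {f} → (∀ xs → wedge f (W i) xs ≈ 0#) → ∀ xs → wedge f (W (suc i)) xs ≈ 0#
    null-suc i p xs = trans (wedge-swap _ _ (W i) xs)
      (trans (-‿cong (trans (wedge-congʳ p xs) (wedge-zeroʳ _ xs))) -0#≈0#)

    null-δ : ∀ k i → (∀ i xs → wedge (φ k i) (W i) xs ≈ 0#) → ∀ xs → wedge (λ x → δ (U k x) i) (W i) xs ≈ 0#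
    null-δ k zero h xs = wedge-zeroˡ (W 0) xs
    null-δ k (suc i) h xs = null-≈ (suc i) (rows k i)
      (null-+ (suc i) (null-* (suc i) (ι 2) (wedge-W-zero (suc i) i (ℕₚ.n<1+n i))) (null-suc i (h i))) xs

    null : ∀ k i xs → wedge (φ k i) (W i) xs ≈ 0#
    null zero i xs = trans (wedge-cong (λ x → -‿inverseʳ _) (λ _ → refl) xs) (wedge-zeroˡ (W i) xs)
    null (suc zero) zero xs = trans (wedge-cong (λ x → solve 1 (λ a → a :+ a :+ K 0 :- (a :+ a) := K 0) refl (x 0)) (λ _ → refl) xs)
      (wedge-zeroˡ (W 0) xs)
    null (suc zero) (suc i) xs = null-≈ (suc i) {g = λ x → x i} (λ x → solve 2 (λ a b → a :+ a :+ b :- (a :+ a) := b) refl _ _)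
      (wedge-W-zero (suc i) i (ℕₚ.n<1+n i)) xs
    null (suc (suc k)) i = null-≈ i
      (λ x → solve 4 (λ a b c y → a :+ a :+ b :+ (:- K 1) :* c :- (y :+ y)
          := (a :- (y :+ y)) :+ (a :- (y :+ y)) :+ b :+ (:- K 1) :* (c :- (y :+ y))) refl (U (suc k) x i) (δ (U (suc k) x) i) (U k x i) (x i))
      (null-+ i (null-+ i (null-+ i (null (suc k) i) (null (suc k) i)) (null-δ (suc k) i (null (suc k)))) (null-* i (- 1#) (null k i)))

  -- Multiplication by v², written in the basis `pt`; see `Q-pt`.
  Q : Col → Col
  Q x i = ι (suc i) * ι (suc i) * x i + γ i * x (suc i)

  Q-pt : ∀ v i → Q (pt v) i ≈ v * v * pt v i
  Q-pt v i = trans (+-congˡ (pt-suc v i))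
    (solve 3 (λ m u p → m :* m :* p :+ (u :- m :* m) :* p := u :* p) refl (ι (suc i)) _ _)

  -- Left inverse to the shift `δ`, the second central difference; hence a double antidifference on
  -- the columns `pt v`.
  T : Col → Col
  T x i = x (suc i)

  private
    pt-one : ∀ i → pt (ι 1) (suc i) ≈ 0#
    pt-one zero = solve 1 (λ a → let o = K 1 :+ K 0 in (o :* o :- o :* o) :* o :* a := K 0) refl (γ⁻¹ 0)
    pt-one (suc i) = trans (*-congʳ (trans (*-congˡ (pt-one i)) (zeroʳ _))) (zeroˡ _)

    first-difference : ∀ m i → pt (ι (suc m)) (suc i) - pt (ι m) (suc i) ≈ ∑ (suc m) (λ l → pt (ι l) i)
    first-difference zero i = begin
      pt (ι 1) (suc i) - pt 0# (suc i)  ≈⟨ +-cong (pt-one i) (-‿cong (pt-zero (suc i))) ⟩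
      0# - 0#                               ≈⟨ solve 0 (K 0 :- K 0 := K 0 :+ K 0) refl ⟩
      0# + 0#                               ≈⟨ +-congʳ (pt-zero i) ⟨
      pt 0# i + 0#                          ∎
    first-difference (suc m) i = begin
      pt (ι (2 N.+ m)) (suc i) - F
        ≈⟨ +-congʳ (pt-cong (+-comm 1# (ι (suc m))) (suc i)) ⟩
      pt (ι (suc m) + 1#) (suc i) - F
        ≈⟨ solve 3 (λ a b f → a :- f := (a :+ b) :- b :- f) refl _ _ _ ⟩
      (pt (ι (suc m) + 1#) (suc i) + pt (ι (suc m) - 1#) (suc i)) - pt (ι (suc m) - 1#) (suc i) - F
        ≈⟨ +-congʳ (+-cong (pt-second-difference (ι (suc m)) (suc i))
             (-‿cong (pt-cong (solve 1 (λ m → K 1 :+ m :- K 1 := m) refl (ι m)) (suc i)))) ⟩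
      (F + F + pt (ι (suc m)) i) - pt (ι m) (suc i) - F
        ≈⟨ solve 3 (λ f a b → (f :+ f :+ a) :- b :- f := (f :- b) :+ a) refl _ _ _ ⟩
      (F - pt (ι m) (suc i)) + pt (ι (suc m)) i
        ≈⟨ +-congʳ (first-difference m i) ⟩
      ∑ (suc m) (λ l → pt (ι l) i) + pt (ι (suc m)) i
        ≈⟨ ∑-last (suc m) (λ l → pt (ι l) i) ⟨
      ∑ (suc (suc m)) (λ l → pt (ι l) i) ∎
      where
      F : Carrier
      F = pt (ι (suc m)) (suc i)

    T-sum : ∀ m i → pt (ι m) (suc i) ≈ ∑ m (λ l → (ι m - ι l) * pt (ι l) i)
    T-sum zero i = pt-zero (suc i)
    T-sum (suc m) i = begin
      pt (ι (suc m)) (suc i)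
        ≈⟨ solve 2 (λ a b → a := b :+ (a :- b)) refl _ _ ⟩
      pt (ι m) (suc i) + (pt (ι (suc m)) (suc i) - pt (ι m) (suc i))
        ≈⟨ +-cong (T-sum m i) (first-difference m i) ⟩
      ∑ m (λ l → (ι m - ι l) * pt (ι l) i) + ∑ (suc m) (λ l → pt (ι l) i)
        ≈⟨ +-congʳ (trans (sym (+-identityʳ _)) (trans (+-congˡ (solve 2 (λ m p → K 0 := (m :- m) :* p) refl (ι m) (pt (ι m) i)))
             (sym (∑-last m (λ l → (ι m - ι l) * pt (ι l) i))))) ⟩
      ∑ (suc m) (λ l → (ι m - ι l) * pt (ι l) i) + ∑ (suc m) (λ l → pt (ι l) i)
        ≈⟨ ∑-+ (suc m) (λ l → (ι m - ι l) * pt (ι l) i) (λ l → pt (ι l) i) ⟨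
      ∑ (suc m) (λ l → (ι m - ι l) * pt (ι l) i + pt (ι l) i)
        ≈⟨ ∑-cong (suc m) {g = λ l → (ι (suc m) - ι l) * pt (ι l) i} (λ l →
             solve 3 (λ m l p → (m :- l) :* p :+ p := (K 1 :+ m :- l) :* p) refl (ι m) (ι l) _) ⟩
      ∑ (suc m) (λ l → (ι (suc m) - ι l) * pt (ι l) i) ∎

  -- The second difference is summed twice upwards from 0. No constants of summation appear, because
  -- `pt v (suc i)` vanishes at v = 0 by oddness and at v = 1 by the factor v² - 1². A natural
  -- argument `ι m` keeps the sum finite.
  T-pt : ∀ m i → T (pt (ι m)) i ≈ ∑ m (λ k → ι (suc k) * pt (ι m - ι (suc k)) i)
  T-pt m i = begin
    pt (ι m) (suc i)
      ≈⟨ T-sum m i ⟩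
    ∑ m (λ l → (ι m - ι l) * pt (ι l) i)
      ≈⟨ ∑-rev m (λ l → (ι m - ι l) * pt (ι l) i) ⟨
    ∑ m (λ k → (ι m - ι (m ∸ suc k)) * pt (ι (m ∸ suc k)) i)
      ≈⟨ ∑-cong< m (λ k k<m → *-cong (trans (+-congˡ (-‿cong (ι-∸ k<m)))
           (solve 2 (λ m k → m :- (m :- k) := k) refl (ι m) (ι (suc k)))) (pt-cong (ι-∸ k<m) i)) ⟩
    ∑ m (λ k → ι (suc k) * pt (ι m - ι (suc k)) i) ∎

-- The determinant of the sum over all Δ and its differential equation.

module Determinant {c ℓ} (R : CommutativeRing c ℓ) (inv : ℕ → CommutativeRing.Carrier R)
  (inv-suc : Reciprocals R inv)
  (x : CommutativeRing.Carrier R) (n : ℕ) (x-nilpotent : NilpotentBeyond R inv n x)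
  (t′ : ℕ) (3n≤t : n N.+ (n N.+ n) N.≤ suc t′) where
  open Kit R inv
  open Units R inv inv-suc
  open Wedge R inv
  open Points R inv inv-suc
  open Relation.Binary.Reasoning.Setoid setoid

  t M : ℕ
  t = suc t′
  M = suc t

  xp : ℕ → Carrier
  xp = powR x

  xp-+ : ∀ a b → xp (a N.+ b) ≈ xp a * xp b
  xp-+ zero b = sym (*-identityˡ _)
  xp-+ (suc a) b = trans (*-congˡ (xp-+ a b)) (sym (*-assoc _ _ _))

  M-_ M+_ : ℕ → Carrier
  M- j = ι M - ι j
  M+ j = ι M + ι j

  column : ℕ → Col
  column j = pt (M- j) ⊞ (- xp j) • pt (M+ j)

  columns : ℕ → Col
  columns = column ∘ suc

  E : Carrier
  E = W t (applyUpTo columns t)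

  -- Cramer's functional for column i: linear, equal to `E` on the column it replaces and zero on
  -- the others. All computations below take place among its values on the points `pt v`.
  L : ℕ → Col → Carrier
  L = replaced (W t) columns t

  kron : ℕ → ℕ → Carrier
  kron a b = if does (a N.≟ b) then 1# else 0#

  kron-yes : ∀ {a b} → a ≡ b → kron a b ≈ 1#
  kron-yes {a} {b} e = reflexive (if-yes (a N.≟ b) e)

  kron-no : ∀ {a b} → a ≢ b → kron a b ≈ 0#
  kron-no {a} {b} e = reflexive (if-no (a N.≟ b) e)

  kron-* : ∀ {a b y} → a ≢ b → kron a b * y ≈ 0#
  kron-* ne = trans (*-congʳ (kron-no ne)) (zeroˡ _)

  kron-⇔ : ∀ a b a′ b′ → (a ≡ b → a′ ≡ b′) → (a′ ≡ b′ → a ≡ b) → kron a b ≈ kron a′ b′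
  kron-⇔ a b a′ b′ f g with a N.≟ b
  ... | yes e = trans (kron-yes e) (sym (kron-yes (f e)))
  ... | no e = trans (kron-no e) (sym (kron-no (e ∘ g)))

  L-cong : ∀ i {y z} → y ≐ z → L i y ≈ L i z
  L-cong i p = Alternating.resp (W-alternating t) (Pw.++⁺ (≐-refl (before columns t i)) (p ∷ ≐-refl (after columns t i)))

  L-⊞ : ∀ i y z → L i (y ⊞ z) ≈ L i y + L i z
  L-⊞ i y z = Alternating.add (W-alternating t) (before columns t i) y z (after columns t i)

  L-• : ∀ i a y → L i (a • y) ≈ a * L i y
  L-• i a y = Alternating.scale (W-alternating t) (before columns t i) a y (after columns t i)

  L-zero : ∀ i → L i (λ _ → 0#) ≈ 0#
  L-zero i = trans (L-cong i {z = 0# • (λ _ → 0#)} (λ _ → sym (zeroˡ _))) (trans (L-• i 0# _) (zeroˡ _))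

  L-∑ : ∀ i m (f : ℕ → Col) → L i (λ l → ∑ m (λ k → f k l)) ≈ ∑ m (λ k → L i (f k))
  L-∑ i zero f = L-zero i
  L-∑ i (suc m) f = trans (L-⊞ i (f 0) (λ l → ∑ m (λ k → f (suc k) l))) (+-congˡ (L-∑ i m (f ∘ suc)))

  ∑L-derive : ∀ A → ∑ t (λ i → L i (A (columns i))) ≈ derive A (W t) (applyUpTo columns t)
  ∑L-derive A = sym (derive-∑ A (W t) columns t)

  a : ℕ → Carrier → Carrier
  a i v = L i (pt v)

  a-cong : ∀ i {v v′} → v ≈ v′ → a i v ≈ a i v′
  a-cong i e = L-cong i (pt-cong e)

  a-neg : ∀ i v → a i (- v) ≈ - a i v
  a-neg i v = begin
    L i (pt (- v))        ≈⟨ L-cong i (λ l → trans (pt-neg v l) (solve 1 (λ p → :- p := :- K 1 :* p) refl _)) ⟩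
    L i ((- 1#) • pt v)   ≈⟨ L-• i (- 1#) (pt v) ⟩
    - 1# * a i v          ≈⟨ solve 1 (λ p → :- K 1 :* p := :- p) refl _ ⟩
    - a i v               ∎

  a-zero : ∀ i {v} → v ≈ 0# → a i v ≈ 0#
  a-zero i e = trans (L-cong i (λ l → trans (pt-cong e l) (pt-zero l))) (L-zero i)

  cc : ℕ → ℕ → Carrier
  cc i j = a i (M- j) - xp j * a i (M+ j)

  L-column : ∀ i j → L i (column j) ≈ cc i j
  L-column i j = trans (L-⊞ i (pt (M- j)) ((- xp j) • pt (M+ j)))
    (+-congˡ (trans (L-• i (- xp j) (pt (M+ j))) (solve 2 (λ x a → :- x :* a := :- (x :* a)) refl _ _)))

  xp-zero-* : ∀ {j} y → n N.< j → xp j * y ≈ 0#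
  xp-zero-* y n<j = trans (*-congʳ (x-nilpotent _ n<j)) (zeroˡ y)

  n≤t : n N.≤ t
  n≤t = ℕₚ.≤-trans (ℕₚ.m≤m+n n (n N.+ n)) 3n≤t

  2n≤t : n N.+ n N.≤ t
  2n≤t = ℕₚ.≤-trans (ℕₚ.m≤n+m (n N.+ n) n) 3n≤t

  -- Inside the range 1 to t this is Cramer's rule. The two boundary columns vanish for other
  -- reasons: at j = 0 both halves coincide, and at j = M the first half is `pt` at 0 while the
  -- second carries a power of x beyond n.
  cc-value : ∀ {i} → i N.< t → ∀ j → j N.≤ M → cc i j ≈ kron (suc i) j * E
  cc-value {i} i<t zero _ = trans
    (+-cong (a-cong i (solve 1 (λ m → m :- K 0 := m :+ K 0) refl _)) (-‿cong (*-identityˡ _)))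
    (trans (-‿inverseʳ _) (sym (kron-* {suc i} {0} (λ ()))))
  cc-value {i} i<t (suc j) 1+j≤M with ℕₚ.<-cmp j t | j N.≟ i
  ... | tri< j<t _ _ | yes ≡.refl = begin
    cc i (suc i)        ≈⟨ L-column i (suc i) ⟨
    L i (columns i)     ≡⟨ ≡.cong (W t) (around columns i<t) ⟩
    E                   ≈⟨ *-identityˡ E ⟨
    1# * E              ≈⟨ *-congʳ (kron-yes {suc i} ≡.refl) ⟨
    kron (suc i) (suc i) * E ∎
  ... | tri< j<t _ _ | no j≢i = begin
    cc i (suc j)             ≈⟨ L-column i (suc j) ⟨
    L i (columns j)          ≈⟨ repeats ⟩
    0#                       ≈⟨ kron-* (λ e → j≢i (≡.sym (ℕₚ.suc-injective e))) ⟨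
    kron (suc i) (suc j) * E ∎
    where
    repeats : L i (columns j) ≈ 0#
    repeats with ℕₚ.<-cmp j i
    ... | tri< j<i _ _ = repeated-before (W-alternating t) (after columns t i) (∈-applyUpTo⁺ columns j<i)
    ... | tri≈ _ j≡i _ = contradiction j≡i j≢i
    ... | tri> _ _ i<j = repeated-after (W-alternating t) (before columns t i)
      (≡.subst (λ k → columns k ∈ after columns t i) (ℕₚ.m+[n∸m]≡n i<j)
        (∈-applyUpTo⁺ (λ l → columns (suc i N.+ l)) (ℕₚ.∸-monoˡ-< j<t i<j)))
  ... | tri≈ _ ≡.refl _ | _ = begin
    a i (M- M) - xp M * a i (M+ M)
      ≈⟨ +-cong (a-zero i (-‿inverseʳ _)) (-‿cong (xp-zero-* _ (s≤s n≤t))) ⟩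
    0# - 0#          ≈⟨ -‿inverseʳ 0# ⟩
    0#               ≈⟨ kron-* (λ e → ℕₚ.<⇒≢ i<t (ℕₚ.suc-injective e)) ⟨
    kron (suc i) M * E ∎
  ... | tri> _ _ t<j | _ = contradiction 1+j≤M (ℕₚ.<⇒≱ (s≤s t<j))

  -- The exchange rule for all that follows: apart from the diagonal term, reflecting a point in M
  -- from left to right costs the factor xʲ.
  a-M- : ∀ {i} → i N.< t → ∀ j → j N.≤ M → a i (M- j) ≈ kron (suc i) j * E + xp j * a i (M+ j)
  a-M- {i} i<t j j≤M = trans (solve 2 (λ a b → a := (a :- b) :+ b) refl _ (xp j * a i (M+ j)))
    (+-congʳ (cc-value i<t j j≤M))

  -- Past M the oddness of pt reflects the columns: column (M + r) is column (M − r) up to sign and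
  -- higher powers of x.
  cc-reflected : ∀ {i} → i N.< t → ∀ r → r N.≤ M → n N.< M ∸ r → cc i (M N.+ r) ≈ - (kron (suc i) (M ∸ r) * E)
  cc-reflected {i} i<t r r≤M n<M∸r = begin
    a i (M- (M N.+ r)) - xp (M N.+ r) * a i (M+ (M N.+ r))
      ≈⟨ +-congˡ (-‿cong (xp-zero-* _ (ℕₚ.<-≤-trans n<M∸r (ℕₚ.≤-trans (ℕₚ.m∸n≤m M r) (ℕₚ.m≤m+n M r))))) ⟩
    a i (M- (M N.+ r)) - 0#
      ≈⟨ trans (+-congˡ -0#≈0#) (+-identityʳ _) ⟩
    a i (M- (M N.+ r))
      ≈⟨ a-cong i (trans (+-congˡ (-‿cong (ι-+ M r)))
           (trans (solve 2 (λ m r → m :- (m :+ r) := :- (m :- (m :- r))) refl (ι M) (ι r))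
             (-‿cong (+-congˡ (-‿cong (sym (ι-∸ r≤M))))))) ⟩
    a i (- (M- (M ∸ r)))
      ≈⟨ a-neg i _ ⟩
    - a i (M- (M ∸ r))
      ≈⟨ -‿cong (trans (a-M- i<t (M ∸ r) (ℕₚ.m∸n≤m M r)) (trans (+-congˡ (xp-zero-* _ n<M∸r)) (+-identityʳ _))) ⟩
    - (kron (suc i) (M ∸ r) * E) ∎

  -- Here the column index is j = M − l.
  cc-shifted : ∀ i k → i N.< t → k N.≤ n N.+ n → let l = t ∸ i in
    cc i (suc i N.+ suc k) ≈ - (kron (suc k) (l N.+ l) * E)
  cc-shifted i k i<t k≤2n with ℕₚ.≤-total (suc k) (t ∸ i)
  ... | inj₁ k<l = begin
    cc i (suc i N.+ suc k)
      ≈⟨ cc-value i<t (suc i N.+ suc k) (s≤s (ℕₚ.≤-trans (ℕₚ.+-monoʳ-≤ i k<l) (ℕₚ.≤-reflexive (ℕₚ.m+[n∸m]≡n (ℕₚ.<⇒≤ i<t))))) ⟩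
    kron (suc i) (suc i N.+ suc k) * E
      ≈⟨ kron-* (ℕₚ.<⇒≢ (ℕₚ.m<m+n (suc i) (s≤s z≤n))) ⟩
    0#
      ≈⟨ trans (-‿cong (kron-* (ℕₚ.<⇒≢ (ℕₚ.<-≤-trans (s≤s k<l) (ℕₚ.+-monoˡ-≤ (t ∸ i) (ℕₚ.m<n⇒0<n∸m i<t)))))) -0#≈0# ⟨
    - (kron (suc k) (t ∸ i N.+ (t ∸ i)) * E) ∎
  ... | inj₂ l≤1+k = begin
    cc i (suc i N.+ suc k)
      ≡⟨ ≡.cong (cc i) M+r ⟨
    cc i (M N.+ r)
      ≈⟨ cc-reflected i<t r (ℕₚ.≤-trans r≤2n (ℕₚ.≤-trans 2n≤t (ℕₚ.n≤1+n t))) n<M∸r ⟩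
    - (kron (suc i) (M ∸ r) * E)
      ≈⟨ -‿cong (*-congʳ (kron-⇔ (suc i) (M ∸ r) (suc k) (l N.+ l) to from)) ⟩
    - (kron (suc k) (l N.+ l) * E) ∎
    where
    l r : ℕ
    l = t ∸ i
    r = suc k ∸ l
    i+l : i N.+ l ≡ t
    i+l = ℕₚ.m+[n∸m]≡n (ℕₚ.<⇒≤ i<t)
    l+r : l N.+ r ≡ suc k
    l+r = ℕₚ.m+[n∸m]≡n l≤1+k
    M+r : M N.+ r ≡ suc i N.+ suc k
    M+r = ≡.cong suc (≡.trans (≡.cong (N._+ r) (≡.sym i+l)) (≡.trans (ℕₚ.+-assoc i l r) (≡.cong (i N.+_) l+r)))
    r≤2n : r N.≤ n N.+ n
    r≤2n = ℕₚ.≤-trans (ℕₚ.∸-monoʳ-≤ (suc k) (ℕₚ.m<n⇒0<n∸m i<t)) k≤2n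
    -- With r at most 2n this asks for n + 2n ≤ t, the origin of the bound 3n.
    n<M∸r : n N.< M ∸ r
    n<M∸r = ℕₚ.m+n≤o⇒m≤o∸n (suc n) (s≤s (ℕₚ.≤-trans (ℕₚ.+-monoʳ-≤ n r≤2n) 3n≤t))
    r≤M : r N.≤ M
    r≤M = ℕₚ.≤-trans r≤2n (ℕₚ.≤-trans 2n≤t (ℕₚ.n≤1+n t))
    to : suc i ≡ M ∸ r → suc k ≡ l N.+ l
    to e = ≡.trans (≡.sym l+r) (≡.cong (l N.+_)
      (≡.trans (≡.sym (ℕₚ.m∸[m∸n]≡n r≤M)) (≡.cong (M ∸_) (≡.sym e))))
    from : suc k ≡ l N.+ l → suc i ≡ M ∸ r
    from e = ≡.sym (≡.trans (≡.cong (M ∸_) (ℕₚ.+-cancelˡ-≡ l r l (≡.trans l+r e)))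
      (ℕₚ.m∸[m∸n]≡n {M} {suc i} (s≤s (ℕₚ.<⇒≤ i<t))))

  -- `up` and `down` are the values of `L i` on the two halves of `U k` applied to column j =
  -- `suc i`. `inner` is `down` with the point M - (j + k) exchanged for M + (j + k) at the cost of
  -- x to the power j + k; the discrepancy is column j + k.
  up down inner : ℕ → ℕ → Carrier
  up i k = a i (M- suc i + ι k) - xp (suc i) * a i (M+ suc i + ι k)
  down i k = a i (M- suc i - ι k) - xp (suc i) * a i (M+ suc i - ι k)
  inner i k = xp (suc i N.+ k) * a i (M+ (suc i N.+ k)) - xp (suc i) * a i (M+ suc i - ι k)

  down-inner : ∀ i k → down i k ≈ inner i k + cc i (suc i N.+ k)
  down-inner i k = trans
    (+-congʳ (a-cong i (trans (solve 3 (λ m j k → m :- j :- k := m :- (j :+ k)) refl _ _ _)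
      (+-congˡ (-‿cong (sym (ι-+ (suc i) k)))))))
    (solve 3 (λ a b c → a :- b := (c :- b) :+ (a :- c)) refl _ _ _)

  -- The terms at M + (j + k) cancel. The rest is xᵏ times column j - k if k ≤ j, and -xʲ times
  -- column k - j if j ≤ k. By Cramer's rule only column j itself counts, which happens exactly for
  -- k = 2j.
  inner-up : ∀ i k → i N.< t → suc k N.≤ n N.+ n → let j = suc i in
    inner i (suc k) + xp (suc k) * up i (suc k) ≈ - (xp j * kron (suc k) (j N.+ j) * E)
  inner-up i k′ i<t k≤2n = trans first second
    where
    j k : ℕ
    j = suc i
    k = suc k′
    first : inner i k + xp k * up i k ≈ xp k * a i (M- j + ι k) - xp j * a i (M+ j - ι k)
    first = begin
      inner i k + xp k * up i k
        ≈⟨ +-congʳ (+-congʳ (*-cong (xp-+ j k) (a-cong i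
             (trans (+-congˡ (ι-+ j k)) (sym (+-assoc _ _ _)))))) ⟩
      (xp j * xp k * a i (M+ j + ι k) - xp j * a i (M+ j - ι k)) + xp k * up i k
        ≈⟨ solve 5 (λ u v p q r → (u :* v :* p :- u :* q) :+ v :* (r :- u :* p) := v :* r :- u :* q) refl _ _ _ _ _ ⟩
      xp k * a i (M- j + ι k) - xp j * a i (M+ j - ι k) ∎
    second : xp k * a i (M- j + ι k) - xp j * a i (M+ j - ι k) ≈ - (xp j * kron k (j N.+ j) * E)
    second with ℕₚ.≤-total k j
    ... | inj₁ k≤j = begin
      xp k * a i (M- j + ι k) - xp j * a i (M+ j - ι k)
        ≈⟨ +-cong (*-congˡ (a-cong i (trans (+-congʳ (+-congˡ (-‿cong j≈)))
               (solve 3 (λ m k d → m :- (k :+ d) :+ k := m :- d) refl _ _ _))))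
             (-‿cong (*-cong (trans (reflexive (≡.cong xp (≡.sym k+d))) (xp-+ k d)) (a-cong i (trans (+-congʳ (+-congˡ j≈))
               (solve 3 (λ m k d → m :+ (k :+ d) :- k := m :+ d) refl _ _ _))))) ⟩
      xp k * a i (M- d) - xp k * xp d * a i (M+ d)
        ≈⟨ solve 4 (λ u a v b → u :* a :- u :* v :* b := u :* (a :- v :* b)) refl _ _ _ _ ⟩
      xp k * cc i d
        ≈⟨ *-congˡ (trans (cc-value i<t d (ℕₚ.≤-trans (ℕₚ.m∸n≤m j k) (ℕₚ.m≤n⇒m≤1+n i<t)))
             (kron-* (λ e → ℕₚ.<⇒≢ (ℕₚ.∸-monoʳ-< (s≤s z≤n) k≤j) (≡.sym e)))) ⟩
      xp k * 0#
        ≈⟨ zeroʳ _ ⟩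
      0#
        ≈⟨ trans (-‿cong (trans (*-congʳ (trans (*-congˡ (kron-no (ℕₚ.<⇒≢ (ℕₚ.≤-<-trans k≤j (ℕₚ.m<m+n j (s≤s z≤n)))))) (zeroʳ _))) (zeroˡ _))) -0#≈0# ⟨
      - (xp j * kron k (j N.+ j) * E) ∎
      where
      d : ℕ
      d = j ∸ k
      k+d : k N.+ d ≡ j
      k+d = ℕₚ.m+[n∸m]≡n k≤j
      j≈ : ι j ≈ ι k + ι d
      j≈ = trans (reflexive (≡.cong ι (≡.sym k+d))) (ι-+ k d)
    ... | inj₂ j≤k = begin
      xp k * a i (M- j + ι k) - xp j * a i (M+ j - ι k)
        ≈⟨ +-cong (*-cong (trans (reflexive (≡.cong xp (≡.sym j+d))) (xp-+ j d)) (a-cong i (trans (+-congˡ k≈)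
               (solve 3 (λ m j d → m :- j :+ (j :+ d) := m :+ d) refl _ _ _))))
             (-‿cong (*-congˡ (a-cong i (trans (+-congˡ (-‿cong k≈))
               (solve 3 (λ m j d → m :+ j :- (j :+ d) := m :- d) refl _ _ _))))) ⟩
      xp j * xp d * a i (M+ d) - xp j * a i (M- d)
        ≈⟨ solve 4 (λ u a v b → u :* v :* b :- u :* a := :- (u :* (a :- v :* b))) refl _ _ _ _ ⟩
      - (xp j * cc i d)
        ≈⟨ -‿cong (*-congˡ (trans (cc-value i<t d (ℕₚ.≤-trans (ℕₚ.m∸n≤m k j) (ℕₚ.≤-trans k≤2n (ℕₚ.m≤n⇒m≤1+n 2n≤t))))
             (*-congʳ (kron-⇔ j d k (j N.+ j) (λ e → ≡.trans (≡.sym j+d) (≡.cong (j N.+_) (≡.sym e)))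
               (λ e → ≡.sym (ℕₚ.+-cancelˡ-≡ j d j (≡.trans j+d e))))))) ⟩
      - (xp j * (kron k (j N.+ j) * E))
        ≈⟨ -‿cong (*-assoc _ _ _) ⟨
      - (xp j * kron k (j N.+ j) * E) ∎
      where
      d : ℕ
      d = k ∸ j
      j+d : j N.+ d ≡ k
      j+d = ℕₚ.m+[n∸m]≡n j≤k
      k≈ : ι k ≈ ι j + ι d
      k≈ = trans (reflexive (≡.cong ι (≡.sym j+d))) (ι-+ j d)

  δ-linear : ∀ b y z l → δ (y ⊞ b • z) l ≈ δ y l + b * δ z l
  δ-linear b y z zero = solve 1 (λ b → K 0 := K 0 :+ b :* K 0) refl b
  δ-linear b y z (suc l) = refl

  U-linear : ∀ k b y z → U k (y ⊞ b • z) ≐ U k y ⊞ b • U k z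
  U-linear zero b y z l = solve 3 (λ b y z → y :+ b :* z :+ (y :+ b :* z) := y :+ y :+ b :* (z :+ z)) refl b (y l) (z l)
  U-linear (suc zero) b y z l = trans (+-congˡ (δ-linear b y z l))
    (solve 5 (λ b y z u v → y :+ b :* z :+ (y :+ b :* z) :+ (u :+ b :* v) := y :+ y :+ u :+ b :* (z :+ z :+ v)) refl b (y l) (z l) _ _)
  U-linear (suc (suc k)) b y z l = trans
    (+-cong (+-cong (+-cong (U-linear (suc k) b y z l) (U-linear (suc k) b y z l))
      (trans (δ-cong (U-linear (suc k) b y z) l) (δ-linear b (U (suc k) y) (U (suc k) z) l))) (*-congˡ (U-linear k b y z l)))
    (solve 7 (λ b y z u v p q → y :+ b :* z :+ (y :+ b :* z) :+ (u :+ b :* v) :+ (:- K 1) :* (p :+ b :* q)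
        := y :+ y :+ u :+ (:- K 1) :* p :+ b :* (z :+ z :+ v :+ (:- K 1) :* q)) refl b _ _ _ _ _ _)

  τ : Carrier
  τ = ∑ t (λ _ → ι 2)

  up+down : ∀ k → ∑ t (λ i → up i k + down i k) ≈ τ * E
  up+down k = begin
    ∑ t (λ i → up i k + down i k)            ≈⟨ ∑-cong t each ⟨
    ∑ t (λ i → L i (U k (columns i)))        ≈⟨ ∑L-derive (U k) ⟩
    derive (U k) (W t) (applyUpTo columns t) ≈⟨ derive-U k t (applyUpTo columns t) ⟩
    τ * E                                    ∎
    where
    each : ∀ i → L i (U k (columns i)) ≈ up i k + down i k
    each i = begin
      L i (U k (columns i))
        ≈⟨ L-cong i (λ l → trans (U-linear k (- xp j) (pt (M- j)) (pt (M+ j)) l)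
             (+-cong (sym (pt-U k (M- j) l)) (*-congˡ (sym (pt-U k (M+ j) l))))) ⟩
      L i ((pt (M- j + ι k) ⊞ pt (M- j - ι k)) ⊞ (- xp j) • (pt (M+ j + ι k) ⊞ pt (M+ j - ι k)))
        ≈⟨ trans (L-⊞ i _ _) (+-cong (L-⊞ i _ _) (trans (L-• i (- xp j) _) (*-congˡ (L-⊞ i _ _)))) ⟩
      (a i (M- j + ι k) + a i (M- j - ι k)) + - xp j * (a i (M+ j + ι k) + a i (M+ j - ι k))
        ≈⟨ solve 5 (λ x p q r s → (p :+ q) :+ :- x :* (r :+ s) := (p :- x :* r) :+ (q :- x :* s)) refl _ _ _ _ _ ⟩
      up i k + down i k ∎
      where
      j : ℕ
      j = suc i

  -- The geometric series xᵏ/(1 - xᵏ) for positive k: the terms beyond n vanish by nilpotency.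
  G : ℕ → Carrier
  G k = ∑ n (λ r → xp (k N.* suc r))

  G-zero : ∀ k → n N.< k → G k ≈ 0#
  G-zero k n<k = ∑-zero< n (λ r _ → x-nilpotent _ (ℕₚ.<-≤-trans n<k (ℕₚ.m≤m*n k (suc r))))

  G-unfold : ∀ k → xp (suc k) * (1# + G (suc k)) ≈ G (suc k)
  G-unfold k′ = begin
    xp k * (1# + ∑ n g)       ≈⟨ distribˡ _ _ _ ⟩
    xp k * 1# + xp k * ∑ n g  ≈⟨ +-cong (trans (*-identityʳ _) (reflexive (≡.cong xp (≡.sym (ℕₚ.*-identityʳ k)))))
                                  (trans (sym (∑-*ˡ n (xp k) g)) (∑-cong n (λ r → trans (sym (xp-+ k (k N.* suc r)))
                                    (reflexive (≡.cong xp (≡.sym (ℕₚ.*-suc k (suc r)))))))) ⟩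
    ∑ (suc n) g               ≈⟨ ∑-last n g ⟩
    ∑ n g + g n               ≈⟨ +-congˡ (x-nilpotent (k N.* suc n) (ℕₚ.≤-trans (s≤s ℕₚ.≤-refl) (ℕₚ.m≤n*m (suc n) k))) ⟩
    ∑ n g + 0#                ≈⟨ +-identityʳ _ ⟩
    ∑ n g                     ∎
    where
    k : ℕ
    k = suc k′
    g : ℕ → Carrier
    g r = xp (k N.* suc r)

  G-unit : ∀ k → (1# - xp (suc k)) * (1# + G (suc k)) ≈ 1#
  G-unit k = trans (solve 2 (λ x g → (K 1 :- x) :* g := g :- x :* g) refl _ _)
    (trans (+-congˡ (-‿cong (G-unfold k))) (solve 1 (λ g → K 1 :+ g :- g := K 1) refl _))

  -- The multiples of j are split into the odd ones, with sum xʲ/(1 - x²ʲ), and the even ones.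
  G-double : ∀ i → let j = suc i in (1# + G (j N.+ j)) * xp j + G (j N.+ j) ≈ G j
  G-double i = unit-cancel (G-unit i) (begin
    (1# - xp j) * ((1# + G₂) * xp j + G₂)
      ≈⟨ *-congˡ (+-congˡ (trans (sym (G-unfold (i N.+ j))) (*-congʳ (xp-+ j j)))) ⟩
    (1# - xp j) * ((1# + G₂) * xp j + xp j * xp j * (1# + G₂))
      ≈⟨ solve 2 (λ x g → (K 1 :- x) :* (g :* x :+ x :* x :* g) := x :* ((K 1 :- x :* x) :* g)) refl _ _ ⟩
    xp j * ((1# - xp j * xp j) * (1# + G₂))
      ≈⟨ *-congˡ (trans (*-congʳ (+-congˡ (-‿cong (sym (xp-+ j j))))) (G-unit (i N.+ j))) ⟩
    xp j * 1#
      ≈⟨ *-congˡ (G-unit i) ⟨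
    xp j * ((1# - xp j) * (1# + G j))
      ≈⟨ solve 2 (λ x g → x :* ((K 1 :- x) :* g) := (K 1 :- x) :* (x :* g)) refl _ _ ⟩
    (1# - xp j) * (xp j * (1# + G j))
      ≈⟨ *-congˡ (G-unfold i) ⟩
    (1# - xp j) * G j ∎)
    where
    j : ℕ
    j = suc i
    G₂ : Carrier
    G₂ = G (j N.+ j)

  -- Two linear equations in the unknown sums of `up` and of `inner`: the trace of `U k` gives their
  -- sum, and `inner-up` gives `inner` plus xᵏ times `up`. Eliminating `up` and dividing by 1 - xᵏ
  -- produces `G k`. The exceptional terms come from k = 2j, once by reflection at 0 (`ε`) and once
  -- by reflection at M (`ω`), and `G-double` merges them into `G j`.
  ∑inner : ∀ k → suc k N.≤ n N.+ n →
    ∑ t (λ i → inner i (suc k)) ≈ - ((τ * G (suc k) + ∑ t (λ i → kron (suc k) (suc i N.+ suc i) * G (suc i))) * E)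
  ∑inner k′ k≤2n = unit-cancel (trans (*-comm _ _) (trans (*-comm _ _) (G-unit k′))) (begin
    (1# - xk) * I
      ≈⟨ solve 3 (λ x d u → (K 1 :- x) :* d := (d :+ x :* u) :- x :* (u :+ d)) refl xk I A ⟩
    (I + xk * A) - xk * (A + I)
      ≈⟨ +-cong I+xA (-‿cong (*-congˡ A+I)) ⟩
    - (ε * E) - xk * (τ * E + ω * E)
      ≈⟨ solve 5 (λ e E x t w → :- (e :* E) :- x :* (t :* E :+ w :* E) := (:- (e :+ x :* (t :+ w))) :* E) refl ε E xk τ ω ⟩
    - (ε + xk * (τ + ω)) * E
      ≈⟨ *-congʳ (-‿cong (trans (sym (trans (*-congʳ (G-unit k′)) (*-identityˡ _))) (*-assoc _ _ _))) ⟩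
    - ((1# - xk) * ((1# + G k) * (ε + xk * (τ + ω)))) * E
      ≈⟨ *-congʳ (-‿cong (*-congˡ (solve 5 (λ g e x t w → (K 1 :+ g) :* (e :+ x :* (t :+ w)) := (K 1 :+ g) :* e :+ x :* (K 1 :+ g) :* (t :+ w)) refl _ _ _ _ _))) ⟩
    - ((1# - xk) * ((1# + G k) * ε + xk * (1# + G k) * (τ + ω))) * E
      ≈⟨ *-congʳ (-‿cong (*-congˡ (trans (+-congˡ (*-congʳ (G-unfold k′)))
           (solve 5 (λ g e t w h → g :* e :+ h :* (t :+ w) := t :* h :+ (g :* e :+ h :* w)) refl _ _ _ _ _)))) ⟩
    - ((1# - xk) * (τ * G k + ((1# + G k) * ε + G k * ω))) * E
      ≈⟨ *-congʳ (-‿cong (*-congˡ (+-congˡ combine))) ⟩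
    - ((1# - xk) * (τ * G k + S)) * E
      ≈⟨ solve 3 (λ u v E → :- (u :* v) :* E := u :* :- (v :* E)) refl _ _ _ ⟩
    (1# - xk) * - ((τ * G k + S) * E) ∎)
    where
    k : ℕ
    k = suc k′
    xk I A ε ω S : Carrier
    xk = xp k
    I = ∑ t (λ i → inner i k)
    A = ∑ t (λ i → up i k)
    ε = ∑ t (λ i → xp (suc i) * kron k (suc i N.+ suc i))
    ω = ∑ t (λ i → kron k (suc i N.+ suc i))
    S = ∑ t (λ i → kron k (suc i N.+ suc i) * G (suc i))

    I+xA : I + xk * A ≈ - (ε * E)
    I+xA = begin
      I + xk * A
        ≈⟨ +-congˡ (∑-*ˡ t xk (λ i → up i k)) ⟨
      I + ∑ t (λ i → xk * up i k)
        ≈⟨ ∑-+ t (λ i → inner i k) (λ i → xk * up i k) ⟨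
      ∑ t (λ i → inner i k + xk * up i k)
        ≈⟨ ∑-cong< t (λ i i<t → inner-up i k′ i<t k≤2n) ⟩
      ∑ t (λ i → - (xp (suc i) * kron k (suc i N.+ suc i) * E))
        ≈⟨ trans (∑-neg t (λ i → xp (suc i) * kron k (suc i N.+ suc i) * E))
             (-‿cong (∑-*ʳ t E (λ i → xp (suc i) * kron k (suc i N.+ suc i)))) ⟩
      - (ε * E) ∎

    C : Carrier
    C = ∑ t (λ i → cc i (suc i N.+ k))

    -- `cc-shifted` counts by the distance t - i of the column from M. Reversing the order of
    -- summation turns this distance into `suc i`, the index used in `ω`.
    C-value : C ≈ - (ω * E)
    C-value = begin
      C
        ≈⟨ ∑-cong< t (λ i i<t → cc-shifted i k′ i<t (ℕₚ.≤-trans (ℕₚ.n≤1+n k′) k≤2n)) ⟩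
      ∑ t (λ i → - (kron k (t ∸ i N.+ (t ∸ i)) * E))
        ≈⟨ trans (∑-neg t (λ i → kron k (t ∸ i N.+ (t ∸ i)) * E)) (-‿cong (∑-*ʳ t E (λ i → kron k (t ∸ i N.+ (t ∸ i))))) ⟩
      - (∑ t (λ i → kron k (t ∸ i N.+ (t ∸ i))) * E)
        ≈⟨ -‿cong (*-congʳ (trans (∑-cong< t (λ i i<t → reflexive (≡.cong (λ l → kron k (l N.+ l)) (≡.sym (ℕₚ.suc-pred (t ∸ i) {{N.>-nonZero (ℕₚ.m<n⇒0<n∸m i<t)}})))))
             (trans (∑-cong t (λ i → reflexive (≡.cong (λ l → kron k (suc l N.+ suc l)) (ℕₚ.pred[m∸n]≡m∸[1+n] t i))))
               (∑-rev t (λ i → kron k (suc i N.+ suc i)))))) ⟩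
      - (ω * E) ∎

    A+I : A + I ≈ τ * E + ω * E
    A+I = begin
      A + I
        ≈⟨ solve 3 (λ a d c → a :+ d := (a :+ (d :+ c)) :- c) refl A I C ⟩
      (A + (I + C)) - C
        ≈⟨ +-congʳ (trans (∑-+ t (λ i → up i k) (λ i → down i k)) (+-congˡ (trans (∑-cong t (λ i → down-inner i k))
             (∑-+ t (λ i → inner i k) (λ i → cc i (suc i N.+ k)))))) ⟨
      ∑ t (λ i → up i k + down i k) - C
        ≈⟨ +-cong (up+down k) (-‿cong C-value) ⟩
      τ * E - - (ω * E)
        ≈⟨ solve 2 (λ a b → a :- :- b := a :+ b) refl _ _ ⟩
      τ * E + ω * E ∎

    combine : (1# + G k) * ε + G k * ω ≈ S
    combine = begin
      (1# + G k) * ε + G k * ω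
        ≈⟨ trans (∑-+ t (λ i → (1# + G k) * (xp (suc i) * kron k (suc i N.+ suc i))) (λ i → G k * kron k (suc i N.+ suc i)))
             (+-cong (∑-*ˡ t (1# + G k) (λ i → xp (suc i) * kron k (suc i N.+ suc i))) (∑-*ˡ t (G k) (λ i → kron k (suc i N.+ suc i)))) ⟨
      ∑ t (λ i → (1# + G k) * (xp (suc i) * kron k (suc i N.+ suc i)) + G k * kron k (suc i N.+ suc i))
        ≈⟨ ∑-cong t each ⟩
      S ∎
      where
      each : ∀ i → (1# + G k) * (xp (suc i) * kron k (suc i N.+ suc i)) + G k * kron k (suc i N.+ suc i)
                   ≈ kron k (suc i N.+ suc i) * G (suc i)
      each i = trans (solve 3 (λ g x q → (K 1 :+ g) :* (x :* q) :+ g :* q := q :* ((K 1 :+ g) :* x :+ g)) refl _ _ _) weighted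
        where
        weighted : kron k (suc i N.+ suc i) * ((1# + G k) * xp (suc i) + G k) ≈ kron k (suc i N.+ suc i) * G (suc i)
        weighted with k N.≟ suc i N.+ suc i
        ... | yes e = *-congˡ (trans (reflexive (≡.cong (λ k → (1# + G k) * xp (suc i) + G k) e)) (G-double i))
        ... | no ne = trans (kron-* ne) (sym (kron-* ne))

  S₁ : Carrier
  S₁ = ∑ n (λ k → ι (suc k) * G (suc k))

  -- The exceptional terms k = 2j carry the weight 2j and add 2 Σ j `G j`, whence `ι 2` beside the
  -- trace `τ`. They reach up to k = 2n, which fixes the range of summation.
  ∑inner-weighted : ∑ (n N.+ n) (λ k → ι (suc k) * ∑ t (λ i → inner i (suc k))) ≈ - ((τ + ι 2) * S₁ * E)
  ∑inner-weighted = begin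
    ∑ 2n (λ k → ι (suc k) * ∑ t (λ i → inner i (suc k)))
      ≈⟨ ∑-cong< 2n {g = λ k → - ((τ * g k + h k) * E)} (λ k k<2n → trans (*-congˡ (∑inner k k<2n))
           (trans (solve 5 (λ k τ G S E → k :* :- ((τ :* G :+ S) :* E) := :- ((τ :* (k :* G) :+ k :* S) :* E)) refl _ _ _ _ _)
             (-‿cong (*-congʳ (+-congˡ (sym (∑-*ˡ t (ι (suc k)) (λ i → kron (suc k) (suc i N.+ suc i) * G (suc i))))))))) ⟩
    ∑ 2n (λ k → - ((τ * g k + h k) * E))
      ≈⟨ trans (∑-neg 2n (λ k → (τ * g k + h k) * E)) (-‿cong (∑-*ʳ 2n E (λ k → τ * g k + h k))) ⟩
    - (∑ 2n (λ k → τ * g k + h k) * E)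
      ≈⟨ -‿cong (*-congʳ (trans (∑-+ 2n (λ k → τ * g k) h) (+-cong (trans (∑-*ˡ 2n τ g) (*-congˡ first)) second))) ⟩
    - ((τ * S₁ + ι 2 * S₁) * E)
      ≈⟨ -‿cong (*-congʳ (distribʳ _ _ _)) ⟨
    - ((τ + ι 2) * S₁ * E) ∎
    where
    2n : ℕ
    2n = n N.+ n
    g h : ℕ → Carrier
    g k = ι (suc k) * G (suc k)
    summand : ℕ → ℕ → Carrier
    summand k i = ι (suc k) * (kron (suc k) (suc i N.+ suc i) * G (suc i))
    h k = ∑ t (summand k)

    first : ∑ 2n g ≈ S₁
    first = ∑-extend g (ℕₚ.m≤m+n n n) (λ k n≤k _ → trans (*-congˡ (G-zero (suc k) (s≤s n≤k))) (zeroʳ _))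

    second : ∑ 2n h ≈ ι 2 * S₁
    second = begin
      ∑ 2n h
        ≈⟨ ∑-swap 2n t summand ⟩
      ∑ t (λ i → ∑ 2n (λ k → summand k i))
        ≈⟨ ∑-extend (λ i → ∑ 2n (λ k → summand k i)) n≤t (λ i n≤i _ → ∑-zero< 2n (λ k _ →
             trans (*-congˡ (trans (*-congˡ (G-zero (suc i) (s≤s n≤i))) (zeroʳ _))) (zeroʳ _))) ⟩
      ∑ n (λ i → ∑ 2n (λ k → summand k i))
        ≈⟨ ∑-cong< n each ⟩
      ∑ n (λ i → ι 2 * g i)
        ≈⟨ ∑-*ˡ n (ι 2) g ⟩
      ι 2 * S₁ ∎
      where
      each : ∀ i → i N.< n → ∑ 2n (λ k → summand k i) ≈ ι 2 * g i
      each i i<n = begin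
        ∑ 2n (λ k → summand k i)
          ≈⟨ ∑-single 2n (i N.+ suc i) (λ k → summand k i) (ℕₚ.+-mono-≤ i<n i<n) (λ k _ k≢ → trans
               (*-congˡ (kron-* (λ e → k≢ (ℕₚ.suc-injective e)))) (zeroʳ _)) ⟩
        ι (suc i N.+ suc i) * (kron (suc i N.+ suc i) (suc i N.+ suc i) * G (suc i))
          ≈⟨ *-cong (ι-+ (suc i) (suc i)) (trans (*-congʳ (kron-yes {suc i N.+ suc i} ≡.refl)) (*-identityˡ _)) ⟩
        (ι (suc i) + ι (suc i)) * G (suc i)
          ≈⟨ solve 2 (λ i g → (i :+ i) :* g := (K 1 :+ (K 1 :+ K 0)) :* (i :* g)) refl _ _ ⟩
        ι 2 * g i ∎

  -- The antidifferences of the two halves of a column are sums of different lengths, M - j and M +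
  -- j, but both may be cut at 2n. In the first, the exchange rule attaches x to the power j + k. In
  -- the second, either xʲ = 0, or j ≤ n and every later point is M - r with r > n, which the
  -- exchange rule kills.
  L-T : ∀ i → i N.< t → L i (T (columns i)) ≈ ∑ (n N.+ n) (λ k → ι (suc k) * inner i (suc k))
  L-T i i<t = begin
    L i (T (columns i))
      ≈⟨ L-cong i (λ l → +-cong (trans (pt-cong (sym (ι-∸ j≤M)) (suc l)) (T-pt (M ∸ j) l))
           (*-congˡ (trans (pt-cong (sym (ι-+ M j)) (suc l)) (T-pt (M N.+ j) l)))) ⟩
    L i ((λ l → ∑ (M ∸ j) (λ k → ι (suc k) * pt (ι (M ∸ j) - ι (suc k)) l))
         ⊞ (- xp j) • (λ l → ∑ (M N.+ j) (λ k → ι (suc k) * pt (ι (M N.+ j) - ι (suc k)) l)))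
      ≈⟨ trans (L-⊞ i _ _) (+-cong (expand (M ∸ j)) (trans (L-• i (- xp j) _) (*-congˡ (expand (M N.+ j))))) ⟩
    ∑ (M ∸ j) (λ k → ι (suc k) * a i (ι (M ∸ j) - ι (suc k)))
      + - xp j * ∑ (M N.+ j) (λ k → ι (suc k) * a i (ι (M N.+ j) - ι (suc k)))
      ≈⟨ +-cong (∑-cong< (M ∸ j) {g = p} lower) (*-congˡ (∑-cong (M N.+ j) {g = q} (λ k → *-congˡ (a-cong i (+-congʳ (ι-+ M j)))))) ⟩
    ∑ (M ∸ j) p + - xp j * ∑ (M N.+ j) q
      ≈⟨ +-cong (trans (∑-extend p (ℕₚ.∸-monoˡ-≤ j (ℕₚ.m≤n⇒m≤1+n n≤t)) (λ k n≤k+j _ → p-zero k n≤k+j))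
           (sym (∑-extend p (ℕₚ.≤-trans (ℕₚ.m∸n≤m n j) (ℕₚ.m≤m+n n n)) (λ k n≤k+j _ → p-zero k n≤k+j))))
           upper ⟩
    ∑ (n N.+ n) p + - xp j * ∑ (n N.+ n) q
      ≈⟨ +-congˡ (∑-*ˡ (n N.+ n) (- xp j) q) ⟨
    ∑ (n N.+ n) p + ∑ (n N.+ n) (λ k → - xp j * q k)
      ≈⟨ ∑-+ (n N.+ n) p (λ k → - xp j * q k) ⟨
    ∑ (n N.+ n) (λ k → p k + - xp j * q k)
      ≈⟨ ∑-cong (n N.+ n) {λ k → p k + - xp j * q k} {λ k → ι (suc k) * inner i (suc k)}
           (λ k → solve 4 (λ k u x v → k :* u :+ :- x :* (k :* v) := k :* (u :- x :* v)) refl (ι (suc k)) _ (xp j) _) ⟩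
    ∑ (n N.+ n) (λ k → ι (suc k) * inner i (suc k)) ∎
    where
    j : ℕ
    j = suc i
    j≤M : j N.≤ M
    j≤M = ℕₚ.m≤n⇒m≤1+n i<t
    p q : ℕ → Carrier
    p k = ι (suc k) * (xp (j N.+ suc k) * a i (M+ (j N.+ suc k)))
    q k = ι (suc k) * a i (M+ j - ι (suc k))

    expand : ∀ m → L i (λ l → ∑ m (λ k → ι (suc k) * pt (ι m - ι (suc k)) l))
                   ≈ ∑ m (λ k → ι (suc k) * a i (ι m - ι (suc k)))
    expand m = trans (L-∑ i m (λ k → ι (suc k) • pt (ι m - ι (suc k))))
      (∑-cong m (λ k → L-• i (ι (suc k)) (pt (ι m - ι (suc k)))))

    lower : ∀ k → k N.< M ∸ j → ι (suc k) * a i (ι (M ∸ j) - ι (suc k)) ≈ p k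
    lower k k<M∸j = *-congˡ (begin
      a i (ι (M ∸ j) - ι (suc k))
        ≈⟨ a-cong i (trans (+-congʳ (ι-∸ j≤M)) (trans (solve 3 (λ m j k → m :- j :- k := m :- (j :+ k)) refl _ _ _)
             (+-congˡ (-‿cong (sym (ι-+ j (suc k))))))) ⟩
      a i (M- (j N.+ suc k))
        ≈⟨ a-M- i<t (j N.+ suc k) (ℕₚ.≤-trans (ℕₚ.+-monoʳ-≤ j k<M∸j) (ℕₚ.≤-reflexive (ℕₚ.m+[n∸m]≡n j≤M))) ⟩
      kron j (j N.+ suc k) * E + xp (j N.+ suc k) * a i (M+ (j N.+ suc k))
        ≈⟨ trans (+-congʳ (kron-* (ℕₚ.<⇒≢ (ℕₚ.m<m+n j (s≤s z≤n))))) (+-identityˡ _) ⟩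
      xp (j N.+ suc k) * a i (M+ (j N.+ suc k)) ∎)

    p-zero : ∀ k → n ∸ j N.≤ k → p k ≈ 0#
    p-zero k n∸j≤k = trans (*-congˡ (xp-zero-* _ (ℕₚ.≤-trans
      (s≤s (ℕₚ.≤-trans (ℕₚ.m≤n+m∸n n j) (ℕₚ.+-monoʳ-≤ j n∸j≤k))) (ℕₚ.≤-reflexive (≡.sym (ℕₚ.+-suc j k)))))) (zeroʳ _)

    upper : - xp j * ∑ (M N.+ j) q ≈ - xp j * ∑ (n N.+ n) q
    upper with ℕₚ.<-≤-connex n j
    ... | inj₁ n<j = trans (vanish _) (sym (vanish _))
      where
      vanish : ∀ y → - xp j * y ≈ 0#
      vanish y = trans (*-congʳ (trans (-‿cong (x-nilpotent j n<j)) -0#≈0#)) (zeroˡ y)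
    ... | inj₂ j≤n = *-congˡ (∑-extend q (ℕₚ.≤-trans 2n≤t (ℕₚ.≤-trans (ℕₚ.n≤1+n t) (ℕₚ.m≤m+n M j))) q-zero)
      where
      q-zero : ∀ k → n N.+ n N.≤ k → k N.< M N.+ j → q k ≈ 0#
      q-zero k 2n≤k k<M+j = trans (*-congˡ (begin
        a i (M+ j - ι (suc k))
          ≈⟨ a-cong i (trans (+-congˡ (-‿cong (trans (reflexive (≡.cong ι (≡.sym j+r))) (ι-+ j r))))
               (solve 3 (λ m j r → m :+ j :- (j :+ r) := m :- r) refl _ _ _)) ⟩
        a i (M- r)
          ≈⟨ a-M- i<t r (ℕₚ.≤-trans (ℕₚ.∸-monoˡ-≤ j k<M+j) (ℕₚ.≤-reflexive (ℕₚ.m+n∸n≡m M j))) ⟩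
        kron j r * E + xp r * a i (M+ r)
          ≈⟨ trans (+-cong (kron-* (ℕₚ.<⇒≢ (ℕₚ.≤-<-trans j≤n n<r))) (xp-zero-* _ n<r)) (+-identityˡ _) ⟩
        0# ∎)) (zeroʳ _)
        where
        r : ℕ
        r = suc k ∸ j
        j+r : j N.+ r ≡ suc k
        j+r = ℕₚ.m+[n∸m]≡n (ℕₚ.m≤n⇒m≤1+n (ℕₚ.≤-trans j≤n (ℕₚ.≤-trans (ℕₚ.m≤m+n n n) 2n≤k)))
        n<r : n N.< r
        n<r = ℕₚ.m+n≤o⇒m≤o∸n (suc n) (s≤s (ℕₚ.≤-trans (ℕₚ.+-monoʳ-≤ n j≤n) 2n≤k))

  ∑L-T : ∑ t (λ i → L i (T (columns i))) ≈ - ((τ + ι 2) * S₁ * E)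
  ∑L-T = begin
    ∑ t (λ i → L i (T (columns i)))
      ≈⟨ ∑-cong< t L-T ⟩
    ∑ t (λ i → ∑ (n N.+ n) (λ k → ι (suc k) * inner i (suc k)))
      ≈⟨ ∑-swap t (n N.+ n) (λ i k → ι (suc k) * inner i (suc k)) ⟩
    ∑ (n N.+ n) (λ k → ∑ t (λ i → ι (suc k) * inner i (suc k)))
      ≈⟨ ∑-cong (n N.+ n) (λ k → ∑-*ˡ t (ι (suc k)) (λ i → inner i (suc k))) ⟩
    ∑ (n N.+ n) (λ k → ι (suc k) * ∑ t (λ i → inner i (suc k)))
      ≈⟨ ∑inner-weighted ⟩
    - ((τ + ι 2) * S₁ * E) ∎

  -- ∂column j is x d/dx of column j, so ∂E is x d/dx of E.
  ∂column : ℕ → Col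
  ∂column j = (- (ι j * xp j)) • pt (M+ j)

  ∂E : Carrier
  ∂E = ∑ t (λ i → L i (∂column (suc i)))

  private
    4M : Carrier
    4M = ι 4 * ι M

    -- (M + j)² = (M - j)² + 4Mj. The excess 4Mj falls on the half that carries xʲ, where the factor
    -- j is the effect of x d/dx.
    Q-column : ∀ j → Q (column j) ≐ ((M- j) * (M- j)) • column j ⊞ 4M • ∂column j
    Q-column j l = begin
      m * (u + b * v) + γ l * (u′ + b * v′)
        ≈⟨ solve 7 (λ m u b v g u′ v′ → m :* (u :+ b :* v) :+ g :* (u′ :+ b :* v′) := (m :* u :+ g :* u′) :+ b :* (m :* v :+ g :* v′)) refl m u b v (γ l) u′ v′ ⟩
      (m * u + γ l * u′) + b * (m * v + γ l * v′)
        ≈⟨ +-cong (Q-pt (M- j) l) (*-congˡ (Q-pt (M+ j) l)) ⟩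
      (M- j) * (M- j) * u + b * ((M+ j) * (M+ j) * v)
        ≈⟨ solve 5 (λ M j u x v → (M :- j) :* (M :- j) :* u :+ :- x :* ((M :+ j) :* (M :+ j) :* v)
             := (M :- j) :* (M :- j) :* (u :+ :- x :* v) :+ (K 1 :+ (K 1 :+ (K 1 :+ (K 1 :+ K 0)))) :* M :* (:- (j :* x) :* v)) refl
             (ι M) (ι j) u (xp j) v ⟩
      (M- j) * (M- j) * (u + b * v) + 4M * (- (ι j * xp j) * v) ∎
      where
      m u b v u′ v′ : Carrier
      m = ι (suc l) * ι (suc l)
      u = pt (M- j) l
      v = pt (M+ j) l
      b = - xp j
      u′ = pt (M- j) (suc l)
      v′ = pt (M+ j) (suc l)

    τ-value : τ + ι 2 ≈ ι 2 * ι M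
    τ-value = trans (+-congʳ (const-sum t)) (solve 1 (λ t → (K 1 :+ (K 1 :+ K 0)) :* t :+ (K 1 :+ (K 1 :+ K 0)) := (K 1 :+ (K 1 :+ K 0)) :* (K 1 :+ t)) refl (ι t))
      where
      const-sum : ∀ m → ∑ m (λ _ → ι 2) ≈ ι 2 * ι m
      const-sum zero = sym (zeroʳ _)
      const-sum (suc m) = trans (+-congˡ (const-sum m)) (solve 2 (λ a m → a :+ a :* m := a :* (K 1 :+ m)) refl _ _)

    -- The minor whose top row, of index t - 1, is replaced by row t. Both `T` and `Q` leak into it,
    -- and it serves only to be eliminated between their traces.
    Z : Carrier
    Z = wedge (λ y → y t) (W t′) (applyUpTo columns t)

    T-trace : ∑ t (λ i → L i (T (columns i))) ≈ Z
    T-trace = begin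
      ∑ t (λ i → L i (T (columns i)))           ≈⟨ ∑L-derive T ⟩
      derive T (W t) (applyUpTo columns t)
        ≈⟨ derive-superdiagonal T (λ _ → 0#) (λ _ → 1#) (λ i y → solve 2 (λ a b → b := K 0 :* a :+ K 1 :* b) refl (y i) (y (suc i))) t′ (applyUpTo columns t) ⟩
      ∑ t (λ _ → 0#) * E + 1# * Z               ≈⟨ +-cong (trans (*-congʳ (∑-zero t)) (zeroˡ _)) (*-identityˡ _) ⟩
      0# + Z                                    ≈⟨ +-identityˡ _ ⟩
      Z                                         ∎

    squares : Carrier
    squares = ∑ t (λ i → ι (suc i) * ι (suc i))

    -- Evaluated by columns, the diagonal part is the sum of (M - j)²; by rows, it is the sum of the
    -- diagonal entries (i + 1)² of `Q`. Both run over the squares of 1, ..., t, so they will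
    -- cancel.
    Q-trace : squares * E + 4M * ∂E ≈ squares * E + γ t′ * Z
    Q-trace = begin
      squares * E + 4M * ∂E
        ≈⟨ +-cong (*-congʳ (∑-rev t (λ i → ι (suc i) * ι (suc i)))) (∑-*ˡ t 4M (λ i → L i (∂column (suc i)))) ⟨
      ∑ t (λ i → ι (suc (t ∸ suc i)) * ι (suc (t ∸ suc i))) * E + ∑ t (λ i → 4M * L i (∂column (suc i)))
        ≈⟨ +-congʳ (∑-*ʳ t E (λ i → ι (suc (t ∸ suc i)) * ι (suc (t ∸ suc i)))) ⟨
      ∑ t (λ i → ι (suc (t ∸ suc i)) * ι (suc (t ∸ suc i)) * E) + ∑ t (λ i → 4M * L i (∂column (suc i)))
        ≈⟨ ∑-+ t (λ i → ι (suc (t ∸ suc i)) * ι (suc (t ∸ suc i)) * E) (λ i → 4M * L i (∂column (suc i))) ⟨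
      ∑ t (λ i → ι (suc (t ∸ suc i)) * ι (suc (t ∸ suc i)) * E + 4M * L i (∂column (suc i)))
        ≈⟨ ∑-cong< t each ⟨
      ∑ t (λ i → L i (Q (columns i)))
        ≈⟨ ∑L-derive Q ⟩
      derive Q (W t) (applyUpTo columns t)
        ≈⟨ derive-superdiagonal Q (λ i → ι (suc i) * ι (suc i)) γ (λ i y → refl) t′ (applyUpTo columns t) ⟩
      squares * E + γ t′ * Z ∎
      where
      each : ∀ i → i N.< t → L i (Q (columns i)) ≈ ι (suc (t ∸ suc i)) * ι (suc (t ∸ suc i)) * E + 4M * L i (∂column (suc i))
      each i i<t = begin
        L i (Q (columns i))
          ≈⟨ L-cong i (Q-column (suc i)) ⟩
        L i (((M- suc i) * (M- suc i)) • columns i ⊞ 4M • ∂column (suc i))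
          ≈⟨ trans (L-⊞ i _ _) (+-cong (L-• i _ _) (L-• i _ _)) ⟩
        (M- suc i) * (M- suc i) * L i (columns i) + 4M * L i (∂column (suc i))
          ≈⟨ +-congʳ (*-cong (*-cong value value) (reflexive (≡.cong (W t) (around columns i<t)))) ⟩
        ι (suc (t ∸ suc i)) * ι (suc (t ∸ suc i)) * E + 4M * L i (∂column (suc i)) ∎
        where
        value : M- suc i ≈ ι (suc (t ∸ suc i))
        value = trans (solve 2 (λ t i → K 1 :+ t :- i := K 1 :+ (t :- i)) refl (ι t) (ι (suc i)))
          (+-congˡ (sym (ι-∸ i<t)))

  -- After cancelling the squares, 4M ∂E = `γ t′` Z with `γ t′` = 2t(2t + 1), while `T` gives Z =
  -- -2M S₁ E; dividing by 4M leaves t(2t + 1).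
  E-ode : ∂E ≈ - ((ι 2 * ι t * ι t + ι t) * S₁) * E
  E-ode = ι-cancel {4 N.* M} (s≤s z≤n) (begin
    ι (4 N.* M) * ∂E
      ≈⟨ *-congʳ (ι-* 4 M) ⟩
    4M * ∂E
      ≈⟨ solve 2 (λ a b → a := (:- b) :+ (b :+ a)) refl (4M * ∂E) (squares * E) ⟩
    - (squares * E) + (squares * E + 4M * ∂E)
      ≈⟨ +-congˡ Q-trace ⟩
    - (squares * E) + (squares * E + γ t′ * Z)
      ≈⟨ solve 2 (λ a b → (:- b) :+ (b :+ a) := a) refl (γ t′ * Z) (squares * E) ⟩
    γ t′ * Z
      ≈⟨ *-cong (γ-value t′) (trans (sym T-trace) (trans ∑L-T (-‿cong (*-congʳ (*-congʳ τ-value))))) ⟩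
    (1# + (1# + (ι t′ + ι t′))) * (1# + (1# + (1# + (ι t′ + ι t′)))) * - (ι 2 * ι M * S₁ * E)
      ≈⟨ solve 3 (λ t′ S E → let t = K 1 :+ t′ ; M = K 1 :+ t ; two = K 1 :+ (K 1 :+ K 0) in
           (K 1 :+ (K 1 :+ (t′ :+ t′))) :* (K 1 :+ (K 1 :+ (K 1 :+ (t′ :+ t′)))) :* :- (two :* M :* S :* E)
           := (K 1 :+ (K 1 :+ two)) :* M :* (:- ((two :* t :* t :+ t) :* S) :* E)) refl (ι t′) S₁ E ⟩
    4M * (- ((ι 2 * ι t * ι t + ι t) * S₁) * E)
      ≈⟨ *-congʳ (ι-* 4 M) ⟨
    ι (4 N.* M) * (- ((ι 2 * ι t * ι t + ι t) * S₁) * E) ∎)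

-- Vandermonde's determinant for odd polynomials.

module Vandermonde {c ℓ} (R : CommutativeRing c ℓ) (inv : ℕ → CommutativeRing.Carrier R)
  (inv-suc : Reciprocals R inv) where
  open Kit R inv
  open Units R inv inv-suc
  open Wedge R inv
  open Points R inv inv-suc
  open Relation.Binary.Reasoning.Setoid setoid

  Unit : Carrier → Set _
  Unit u = Σ[ u′ ∈ Carrier ] u * u′ ≈ 1#

  unit-* : ∀ {u v} → Unit u → Unit v → Unit (u * v)
  unit-* (u′ , p) (v′ , q) = u′ * v′ ,
    trans (solve 4 (λ a b c d → a :* b :* (c :* d) := (a :* c) :* (b :* d)) refl _ _ _ _) (trans (*-cong p q) (*-identityˡ 1#))

  unit-1 : Unit 1#
  unit-1 = 1# , *-identityˡ 1#

  unit-≈ : ∀ {u v} → u ≈ v → Unit u → Unit v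
  unit-≈ e (u′ , p) = u′ , trans (*-congʳ (sym e)) p

  unit-neg : ∀ {u} → Unit u → Unit (- u)
  unit-neg (u′ , p) = - u′ , trans (solve 2 (λ a b → :- a :* :- b := a :* b) refl _ _) p

  unit-ι : ∀ {m} → 0 N.< m → Unit (ι m)
  unit-ι 0<m = _ , ι-inv 0<m

  unit-∏ : ∀ n {f} → (∀ i → i N.< n → Unit (f i)) → Unit (∏ n f)
  unit-∏ zero us = unit-1
  unit-∏ (suc n) us = unit-* (us 0 (s≤s z≤n)) (unit-∏ n (λ i i<n → us (suc i) (s≤s i<n)))

  cancel : ∀ {u a b} → Unit u → u * a ≈ u * b → a ≈ b
  cancel (u′ , p) = unit-cancel p

  private
    signs : ℕ → Carrier
    signs zero = 1#
    signs (suc n) = - signs n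

    module _ (u : Carrier) where
      -- Subtracting u from Q kills the column pt v with v² = u.
      A : Col → Col
      A x i = Q x i - u * x i

      -- Row reduction: `Z i` has the rows A of index i - 1, ..., 0 followed by the entry 0. Each
      -- row of `A` is `γ` times the next entry plus a multiple of an entry already present, so
      -- `Z i` is a multiple of `W (suc i)`. `Y` lacks the final entry and is what remains once the
      -- killed column is expanded.
      Z Y : ℕ → Form
      Z zero = W 1
      Z (suc i) = wedge (λ x → A x i) (Z i)
      Y zero = W 0
      Y (suc i) = wedge (λ x → A x i) (Y i)

      Z-value : ∀ i xs → Z i xs ≈ ∏ i γ * W (suc i) xs
      Z-value zero xs = sym (*-identityˡ _)
      Z-value (suc i) xs = begin
        wedge (λ x → A x i) (Z i) xs
          ≈⟨ wedge-cong {g = λ x → b * x i + γ i * x (suc i)}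
               (λ x → solve 4 (λ m u p q → (m :* m :* p :+ q) :- u :* p := (m :* m :- u) :* p :+ q) refl (ι (suc i)) u (x i) (γ i * x (suc i)))
               (Z-value i) xs ⟩
        wedge (λ x → b * x i + γ i * x (suc i)) (λ ys → ∏ i γ * W (suc i) ys) xs
          ≈⟨ wedge-*ʳ _ (∏ i γ) (W (suc i)) xs ⟩
        ∏ i γ * wedge (λ x → b * x i + γ i * x (suc i)) (W (suc i)) xs
          ≈⟨ *-congˡ (trans (wedge-+ˡ (λ x → b * x i) (λ x → γ i * x (suc i)) (W (suc i)) xs)
               (+-cong (trans (wedge-*ˡ b (λ x → x i) (W (suc i)) xs) (trans (*-congˡ (wedge-square _ (W i) xs)) (zeroʳ _)))
                 (wedge-*ˡ (γ i) (λ x → x (suc i)) (W (suc i)) xs))) ⟩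
        ∏ i γ * (0# + γ i * W (2 N.+ i) xs)
          ≈⟨ solve 3 (λ p g w → p :* (K 0 :+ g :* w) := p :* g :* w) refl (∏ i γ) (γ i) (W (2 N.+ i) xs) ⟩
        ∏ i γ * γ i * W (2 N.+ i) xs
          ≈⟨ *-congʳ (∏-last i γ) ⟨
        ∏ (suc i) γ * W (2 N.+ i) xs ∎
        where
        b : Carrier
        b = ι (suc i) * ι (suc i) - u

      -- Every row of `A` is zero on `x`, so only the last row, the entry `x 0`, survives. Moving
      -- the first column past the other rows gives `signs i`.
      Z-kernel : ∀ x → (∀ i → A x i ≈ 0#) → ∀ i xs → Z i (x ∷ xs) ≈ signs i * (x 0 * Y i xs)
      Z-kernel x Ax≈0 zero xs = trans (+-congˡ (-‿cong (wedge-zeroʳ _ xs)))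
        (solve 2 (λ a b → a :* b :- K 0 := K 1 :* (a :* b)) refl (x 0) (W 0 xs))
      Z-kernel x Ax≈0 (suc i) xs = begin
        A x i * Z i xs - wedge (λ y → A y i) (λ ys → Z i (x ∷ ys)) xs
          ≈⟨ +-cong (trans (*-congʳ (Ax≈0 i)) (zeroˡ _)) (-‿cong (begin
               wedge (λ y → A y i) (λ ys → Z i (x ∷ ys)) xs
                 ≈⟨ wedge-congʳ (λ ys → trans (Z-kernel x Ax≈0 i ys) (sym (*-assoc _ _ _))) xs ⟩
               wedge (λ y → A y i) (λ ys → signs i * x 0 * Y i ys) xs
                 ≈⟨ wedge-*ʳ _ (signs i * x 0) (Y i) xs ⟩
               signs i * x 0 * Y (suc i) xs ∎)) ⟩
        0# - signs i * x 0 * Y (suc i) xs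
          ≈⟨ solve 3 (λ s a y → K 0 :- s :* a :* y := :- s :* (a :* y)) refl (signs i) (x 0) (Y (suc i) xs) ⟩
        signs (suc i) * (x 0 * Y (suc i) xs) ∎

      wedge-map : ∀ f {v w : Form} → (∀ xs → v xs ≈ w (map A xs)) → ∀ xs → wedge (f ∘ A) v xs ≈ wedge f w (map A xs)
      wedge-map f e [] = refl
      wedge-map f e (x ∷ xs) = +-cong (*-congˡ (e xs)) (-‿cong (wedge-map f (λ ys → e (x ∷ ys)) xs))

      Y-value : ∀ i xs → Y i xs ≈ W i (map A xs)
      Y-value zero [] = refl
      Y-value zero (x ∷ xs) = refl
      Y-value (suc i) = wedge-map (λ x → x i) (Y-value i)

    wedge-scale : ∀ i (s : Carrier → Carrier) {v w : Form} a →
      (∀ vs → v (map (λ z → s z • pt z) vs) ≈ a * prodR (map s vs) * w (map pt vs)) →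
      ∀ vs → wedge (λ x → x i) v (map (λ z → s z • pt z) vs) ≈ a * prodR (map s vs) * wedge (λ x → x i) w (map pt vs)
    wedge-scale i s a e [] = sym (zeroʳ _)
    wedge-scale i s {v} {w} a e (z ∷ vs) = begin
      s z * pt z i * v (map sp vs) - wedge (λ x → x i) (λ ys → v (sp z ∷ ys)) (map sp vs)
        ≈⟨ +-cong (*-congˡ (e vs)) (-‿cong (wedge-scale i s {w = λ ys → w (pt z ∷ ys)} (a * s z)
             (λ us → trans (e (z ∷ us)) (*-congʳ (sym (*-assoc _ _ _)))) vs)) ⟩
      s z * pt z i * (a * prodR (map s vs) * w (map pt vs))
        - a * s z * prodR (map s vs) * wedge (λ x → x i) (λ ys → w (pt z ∷ ys)) (map pt vs)
        ≈⟨ solve 6 (λ s p a P w q → s :* p :* (a :* P :* w) :- a :* s :* P :* q := a :* (s :* P) :* (p :* w :- q)) refl _ _ _ _ _ _ ⟩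
      a * (s z * prodR (map s vs)) * (pt z i * w (map pt vs) - wedge (λ x → x i) (λ ys → w (pt z ∷ ys)) (map pt vs)) ∎
      where
      sp : Carrier → Col
      sp z = s z • pt z

    W-scale : ∀ n (s : Carrier → Carrier) vs → W n (map (λ z → s z • pt z) vs) ≈ prodR (map s vs) * W n (map pt vs)
    W-scale n s vs = trans (go n vs) (*-congʳ (*-identityˡ _))
      where
      go : ∀ n vs → W n (map (λ z → s z • pt z) vs) ≈ 1# * prodR (map s vs) * W n (map pt vs)
      go zero [] = solve 0 (K 1 := K 1 :* K 1 :* K 1) refl
      go zero (_ ∷ _) = sym (zeroʳ _)
      go (suc n) = wedge-scale n s 1# (go n)

  -- The Vandermonde product in odd powers: all points times all differences of squares of a later
  -- and an earlier point.
  Vd : List Carrier → Carrier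
  Vd [] = 1#
  Vd (v ∷ vs) = v * prodR (map (λ z → z * z - v * v) vs) * Vd vs

  private
    -- The reduced operator multiplies each remaining column `pt z` by z² - v², and these scalars
    -- leave the determinant as the factors of the Vandermonde product that involve v.
    W-reduce : ∀ n v vs → ∏ n γ * W (suc n) (pt v ∷ map pt vs)
                          ≈ signs n * (v * prodR (map (λ z → z * z - v * v) vs) * W n (map pt vs))
    W-reduce n v vs = begin
      ∏ n γ * W (suc n) (pt v ∷ map pt vs)
        ≈⟨ Z-value u n (pt v ∷ map pt vs) ⟨
      Z u n (pt v ∷ map pt vs)
        ≈⟨ Z-kernel u (pt v) (λ i → trans (+-congʳ (Q-pt v i)) (-‿inverseʳ _)) n (map pt vs) ⟩
      signs n * (v * Y u n (map pt vs))
        ≈⟨ *-congˡ (*-congˡ (trans (Y-value u n (map pt vs))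
             (trans (Alternating.resp (W-alternating n) (scaled vs)) (W-scale n (λ z → z * z - u) vs)))) ⟩
      signs n * (v * (prodR (map (λ z → z * z - u) vs) * W n (map pt vs)))
        ≈⟨ *-congˡ (*-assoc _ _ _) ⟨
      signs n * (v * prodR (map (λ z → z * z - u) vs) * W n (map pt vs)) ∎
      where
      u : Carrier
      u = v * v
      scaled : ∀ vs → Pointwise _≐_ (map (A u) (map pt vs)) (map (λ z → (z * z - u) • pt z) vs)
      scaled [] = []
      scaled (z ∷ vs) = (λ i → trans (+-congʳ (Q-pt z i)) (solve 3 (λ z u p → z :* p :- u :* p := (z :- u) :* p) refl (z * z) u (pt z i)))
        ∷ scaled vs

    leading : ℕ → Carrier
    leading zero = 1#
    leading (suc n) = ∏ n γ * leading n

    leading-unit : ∀ n → Unit (leading n)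
    leading-unit zero = unit-1
    leading-unit (suc n) = unit-* (unit-∏ n (λ i _ → γ⁻¹ i , γ-unit i)) (leading-unit n)

    total-sign : ℕ → Carrier
    total-sign zero = 1#
    total-sign (suc n) = signs n * total-sign n

    signs-unit : ∀ n → Unit (signs n)
    signs-unit zero = unit-1
    signs-unit (suc n) = unit-neg (signs-unit n)

    total-sign-unit : ∀ n → Unit (total-sign n)
    total-sign-unit zero = unit-1
    total-sign-unit (suc n) = unit-* (signs-unit n) (total-sign-unit n)

    vandermonde : ∀ n vs → length vs ≡ n → leading n * W n (map pt vs) ≈ total-sign n * Vd vs
    vandermonde zero [] _ = refl
    vandermonde (suc n) (v ∷ vs) e = begin
      ∏ n γ * leading n * W (suc n) (pt v ∷ map pt vs)
        ≈⟨ solve 3 (λ a b c → a :* b :* c := b :* (a :* c)) refl _ _ _ ⟩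
      leading n * (∏ n γ * W (suc n) (pt v ∷ map pt vs))
        ≈⟨ *-congˡ (W-reduce n v vs) ⟩
      leading n * (signs n * (v * P * W n (map pt vs)))
        ≈⟨ solve 4 (λ l s p w → l :* (s :* (p :* w)) := s :* p :* (l :* w)) refl _ _ _ _ ⟩
      signs n * (v * P) * (leading n * W n (map pt vs))
        ≈⟨ *-congˡ (vandermonde n vs (ℕₚ.suc-injective e)) ⟩
      signs n * (v * P) * (total-sign n * Vd vs)
        ≈⟨ solve 4 (λ s p t V → s :* p :* (t :* V) := s :* t :* (p :* V)) refl _ _ _ _ ⟩
      signs n * total-sign n * (v * P * Vd vs) ∎
      where
      P : Carrier
      P = prodR (map (λ z → z * z - v * v) vs)

  W-ratio : ∀ n a us vs → length us ≡ n → length vs ≡ n → Vd us ≈ a * Vd vs → W n (map pt us) ≈ a * W n (map pt vs)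
  W-ratio n a us vs eu ev h = cancel (leading-unit n) (begin
    leading n * W n (map pt us)        ≈⟨ vandermonde n us eu ⟩
    total-sign n * Vd us               ≈⟨ *-congˡ h ⟩
    total-sign n * (a * Vd vs)         ≈⟨ solve 3 (λ s a v → s :* (a :* v) := a :* (s :* v)) refl _ _ _ ⟩
    a * (total-sign n * Vd vs)         ≈⟨ *-congˡ (vandermonde n vs ev) ⟨
    a * (leading n * W n (map pt vs))  ≈⟨ solve 3 (λ s a v → a :* (s :* v) := s :* (a :* v)) refl _ _ _ ⟩
    leading n * (a * W n (map pt vs))  ∎)

  W-unit : ∀ n vs → length vs ≡ n → Unit (Vd vs) → Unit (W n (map pt vs))
  W-unit n vs e u = let l′ , p = leading-unit n ; v , q = unit-≈ (sym (vandermonde n vs e)) (unit-* (total-sign-unit n) u) in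
    leading n * v , trans (solve 3 (λ l w v → w :* (l :* v) := l :* w :* v) refl _ _ _) q

  ∏-triangle : ∀ t (F : ℕ → ℕ → Carrier) → ∏ t (λ i → ∏ (t ∸ suc i) (λ k → F i (suc i N.+ k))) ≈ ∏ t (λ h → ∏ h (λ j → F j h))
  ∏-triangle zero F = refl
  ∏-triangle (suc t) F = begin
    ∏ t (λ k → F 0 (suc k)) * ∏ t (λ i → ∏ (t ∸ suc i) (λ k → F (suc i) (suc (suc i N.+ k))))
      ≈⟨ *-congˡ (∏-triangle t (λ j h → F (suc j) (suc h))) ⟩
    ∏ t (λ k → F 0 (suc k)) * ∏ t (λ h → ∏ h (λ j → F (suc j) (suc h)))
      ≈⟨ ∏-* t (λ k → F 0 (suc k)) (λ h → ∏ h (λ j → F (suc j) (suc h))) ⟨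
    ∏ t (λ h → F 0 (suc h) * ∏ h (λ j → F (suc j) (suc h)))
      ≈⟨ *-identityˡ _ ⟨
    1# * ∏ t (λ h → F 0 (suc h) * ∏ h (λ j → F (suc j) (suc h))) ∎

  Vd-∏ : ∀ t f → Vd (applyUpTo f t) ≈ ∏ t (λ h → f h * ∏ h (λ j → f h * f h - f j * f j))
  Vd-∏ t f = trans (direct t f) (trans (∏-* t f (λ i → ∏ (t ∸ suc i) (λ k → F i (suc i N.+ k))))
    (trans (*-congˡ (∏-triangle t F)) (sym (∏-* t f (λ h → ∏ h (λ j → F j h))))))
    where
    F : ℕ → ℕ → Carrier
    F j h = f h * f h - f j * f j
    mapped : ∀ (g : Carrier → Carrier) f t → prodR (map g (applyUpTo f t)) ≡ ∏ t (g ∘ f)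
    mapped g f zero = ≡.refl
    mapped g f (suc t) = ≡.cong (g (f 0) *_) (mapped g (f ∘ suc) t)
    direct : ∀ t f → Vd (applyUpTo f t) ≈ ∏ t (λ i → f i * ∏ (t ∸ suc i) (λ k → f (suc i N.+ k) * f (suc i N.+ k) - f i * f i))
    direct zero f = refl
    direct (suc t) f = *-cong (*-congˡ (reflexive (mapped (λ z → z * z - f 0 * f 0) (f ∘ suc) t))) (direct t (f ∘ suc))

-- The hook product as a quotient of two Vandermonde products.

-- Both sides are 2(h + d) + 3, which is 2t + 1 when t = h + 1 + d.
length-symmetric : ∀ d h → (suc d N.+ suc d) N.+ suc h N.+ h ≡ (suc h N.+ suc h) N.+ suc d N.+ d
length-symmetric = solve 2 (λ d h → let 1+d = con 1 :+ d ; 1+h = con 1 :+ h in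
  ((1+d :+ 1+d) :+ 1+h) :+ h := ((1+h :+ 1+h) :+ 1+d) :+ d) ≡.refl
  where open +-*-Solver

module HookRatio {c ℓ} (R : CommutativeRing c ℓ) (inv : ℕ → CommutativeRing.Carrier R)
  (inv-suc : Reciprocals R inv) (t : ℕ) where
  open Kit R inv
  open Units R inv inv-suc
  open Vandermonde R inv inv-suc
  open Relation.Binary.Reasoning.Setoid setoid

  private
    m N N′ : Carrier
    m = ι (suc t)
    N = m + m
    N′ = ι 2 * ι t + ι 2

    N′≈N : N′ ≈ N
    N′≈N = solve 1 (λ t → let two = K 1 :+ (K 1 :+ K 0) in two :* t :+ two := (K 1 :+ t) :+ (K 1 :+ t)) refl (ι t)

  sel : Bool → Carrier → Carrier
  sel b a = if b then a else 1#

  position : Bool → ℕ → Carrier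
  position true j = m + ι j
  position false j = m - ι j

  pairFactor : (ℕ → Bool) → ℕ → ℕ → Carrier
  pairFactor β h j = 1# - powR (N′ * inv (if β j then h N.+ j else h ∸ j)) 2

  -- `hookFactor` for an arbitrary membership function; for `member Δ` the two agree by definition,
  -- so that the comparison of products needs no lists.
  hookFactorᵇ : (ℕ → Bool) → ℕ → Carrier
  hookFactorᵇ β h = (1# - N′ * inv h) * (1# - (ι t + 1#) * inv h) * prodR (map (pairFactor β h) (oneTo (h ∸ 1)))

  private
    sel-* : ∀ b x y → sel b (x * y) ≈ sel b x * sel b y
    sel-* true x y = refl
    sel-* false x y = sym (*-identityˡ 1#)

    sel-cong : ∀ b {x y} → x ≈ y → sel b x ≈ sel b y
    sel-cong true e = e
    sel-cong false e = refl

    sel-∏ : ∀ b n f → sel b (∏ n f) ≈ ∏ n (λ i → sel b (f i))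
    sel-∏ true n f = refl
    sel-∏ false zero f = refl
    sel-∏ false (suc n) f = sym (trans (*-identityˡ _) (sym (sel-∏ false n (f ∘ suc))))

    sel-unit : ∀ b {x} → Unit x → Unit (sel b x)
    sel-unit true u = u
    sel-unit false u = unit-1

    -- The ratio of a pair factor in the Vandermonde product to the corresponding factor of the hook
    -- product splits as p^[h ∈ Δ] q^[j ∈ Δ], with p and q given by these numerators and denominators.
    pₙ p_d qₙ q_d : Carrier → Carrier → Carrier
    pₙ J H = (H + J) * (H - J)
    p_d J H = (N - H - J) * (N - H + J)
    qₙ J H = (H + J) * (N + J - H)
    q_d J H = (H - J) * (N - H - J)

    sₙ s_d : Carrier → Carrier
    sₙ H = (m + H) * (H * H)
    s_d H = (N - H) * ((m - H) * (m - H))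

    gap : Bool → Bool → ℕ → ℕ → Carrier
    gap b b′ j h = position b′ h * position b′ h - position b j * position b j

    inverse-square : ∀ {y i} → y * i ≈ 1# → y * y * (1# - powR (N′ * i) 2) ≈ y * y - N * N
    inverse-square {y} {i} yi≈1 = begin
      y * y * (1# - N′ * i * (N′ * i * 1#))
        ≈⟨ solve 3 (λ y n i → y :* y :* (K 1 :- n :* i :* (n :* i :* K 1)) := y :* y :- n :* (y :* i) :* (n :* (y :* i))) refl y N′ i ⟩
      y * y - N′ * (y * i) * (N′ * (y * i))
        ≈⟨ +-congˡ (-‿cong (*-cong factor factor)) ⟩
      y * y - N * N ∎
      where
      factor : N′ * (y * i) ≈ N
      factor = trans (*-cong N′≈N yi≈1) (*-identityʳ N)

    inv-sum : ∀ h j → (ι (suc h) + ι (suc j)) * inv (suc h N.+ suc j) ≈ 1#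
    inv-sum h j = trans (*-congʳ (sym (ι-+ (suc h) (suc j)))) (inv-suc (h N.+ suc j))

    inv-difference : ∀ {h j} → j N.< h → (ι (suc h) - ι (suc j)) * inv (suc h ∸ suc j) ≈ 1#
    inv-difference j<h = trans (*-congʳ (sym (ι-∸ (s≤s (ℕₚ.<⇒≤ j<h))))) (ι-inv (ℕₚ.m<n⇒0<n∸m j<h))

    -- This is the role of τ: with h + j for j ∈ Δ and h - j otherwise, the factor 1 - (2M/(h ± j))²
    -- absorbs the whole interaction between the memberships of j and h. What is left of the gap
    -- depends on one membership at a time, through p or q.
    pair : ∀ b b′ j h → j N.< h → let J = ι (suc j) ; H = ι (suc h) in
      gap b b′ (suc j) (suc h) * (sel b′ (p_d J H) * sel b (q_d J H))
      ≈ sel b′ (1# - powR (N′ * inv (if b then suc h N.+ suc j else suc h ∸ suc j)) 2)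
        * gap false false (suc j) (suc h) * (sel b′ (pₙ J H) * sel b (qₙ J H))
    pair false false j h j<h = solve 1 (λ g → g :* (K 1 :* K 1) := K 1 :* g :* (K 1 :* K 1)) refl _
    pair true false j h j<h = solve 3 (λ m H J → let N = m :+ m in
      ((m :- H) :* (m :- H) :- (m :+ J) :* (m :+ J)) :* (K 1 :* ((H :- J) :* (N :- H :- J)))
      := K 1 :* ((m :- H) :* (m :- H) :- (m :- J) :* (m :- J)) :* (K 1 :* ((H :+ J) :* (N :+ J :- H)))) refl m (ι (suc h)) (ι (suc j))
    pair false true j h j<h = begin
      ((m + H) * (m + H) - (m - J) * (m - J)) * ((N - H - J) * (N - H + J) * 1#)
        ≈⟨ solve 3 (λ m H J → let N = m :+ m in
             ((m :+ H) :* (m :+ H) :- (m :- J) :* (m :- J)) :* ((N :- H :- J) :* (N :- H :+ J) :* K 1)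
             := ((H :- J) :* (H :- J) :- N :* N) :* (:- ((N :- H :- J) :* (H :+ J)))) refl m H J ⟩
      ((H - J) * (H - J) - N * N) * (- ((N - H - J) * (H + J)))
        ≈⟨ *-congʳ (inverse-square (inv-difference j<h)) ⟨
      (H - J) * (H - J) * X * (- ((N - H - J) * (H + J)))
        ≈⟨ solve 4 (λ m H J X → let N = m :+ m in
             (H :- J) :* (H :- J) :* X :* (:- ((N :- H :- J) :* (H :+ J)))
             := X :* ((m :- H) :* (m :- H) :- (m :- J) :* (m :- J)) :* ((H :+ J) :* (H :- J) :* K 1)) refl m H J X ⟩
      X * ((m - H) * (m - H) - (m - J) * (m - J)) * ((H + J) * (H - J) * 1#) ∎
      where
      J H X : Carrier
      J = ι (suc j)
      H = ι (suc h)
      X = 1# - powR (N′ * inv (suc h ∸ suc j)) 2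
    pair true true j h j<h = begin
      ((m + H) * (m + H) - (m + J) * (m + J)) * ((N - H - J) * (N - H + J) * ((H - J) * (N - H - J)))
        ≈⟨ solve 3 (λ m H J → let N = m :+ m in
             ((m :+ H) :* (m :+ H) :- (m :+ J) :* (m :+ J)) :* ((N :- H :- J) :* (N :- H :+ J) :* ((H :- J) :* (N :- H :- J)))
             := ((H :+ J) :* (H :+ J) :- N :* N) :* (:- ((H :- J) :* (H :- J) :* (N :- H :- J) :* (N :+ J :- H)))) refl m H J ⟩
      ((H + J) * (H + J) - N * N) * (- ((H - J) * (H - J) * (N - H - J) * (N + J - H)))
        ≈⟨ *-congʳ (inverse-square (inv-sum h j)) ⟨
      (H + J) * (H + J) * X * (- ((H - J) * (H - J) * (N - H - J) * (N + J - H)))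
        ≈⟨ solve 4 (λ m H J X → let N = m :+ m in
             (H :+ J) :* (H :+ J) :* X :* (:- ((H :- J) :* (H :- J) :* (N :- H :- J) :* (N :+ J :- H)))
             := X :* ((m :- H) :* (m :- H) :- (m :- J) :* (m :- J)) :* ((H :+ J) :* (H :- J) :* ((H :+ J) :* (N :+ J :- H)))) refl m H J X ⟩
      X * ((m - H) * (m - H) - (m - J) * (m - J)) * ((H + J) * (H - J) * ((H + J) * (N + J - H))) ∎
      where
      J H X : Carrier
      J = ι (suc j)
      H = ι (suc h)
      X = 1# - powR (N′ * inv (suc h N.+ suc j)) 2

    ends : ℕ → Carrier
    ends h = (1# - N′ * inv h) * (1# - (ι t + 1#) * inv h)

    single : ∀ b h → let H = ι (suc h) in
      position b (suc h) * sel b (s_d H) ≈ sel b (ends (suc h)) * position false (suc h) * sel b (sₙ H)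
    single false h = solve 1 (λ p → p :* K 1 := K 1 :* p :* K 1) refl _
    single true h = begin
      (m + H) * ((N - H) * ((m - H) * (m - H)))
        ≈⟨ solve 2 (λ m H → let N = m :+ m in (m :+ H) :* ((N :- H) :* ((m :- H) :* (m :- H)))
             := (H :- N) :* (H :- m) :* ((m :- H) :* (m :+ H))) refl m H ⟩
      (H - N) * (H - m) * ((m - H) * (m + H))
        ≈⟨ *-congʳ (*-cong (factor N′≈N) (factor (+-comm (ι t) 1#))) ⟨
      H * (1# - N′ * inv (suc h)) * (H * (1# - (ι t + 1#) * inv (suc h))) * ((m - H) * (m + H))
        ≈⟨ solve 4 (λ m H a b → H :* a :* (H :* b) :* ((m :- H) :* (m :+ H)) := a :* b :* (m :- H) :* ((m :+ H) :* (H :* H))) refl m H _ _ ⟩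
      ends (suc h) * (m - H) * ((m + H) * (H * H)) ∎
      where
      H : Carrier
      H = ι (suc h)
      factor : ∀ {a b} → a ≈ b → H * (1# - a * inv (suc h)) ≈ H - b
      factor {a} {b} e = trans (solve 3 (λ H a i → H :* (K 1 :- a :* i) := H :- a :* (H :* i)) refl H a (inv (suc h)))
        (+-congˡ (-‿cong (trans (*-cong e (inv-suc h)) (*-identityʳ b))))

    rising : Carrier → ℕ → Carrier
    rising a n = ∏ n (λ i → a + ι i)

    rising-append : ∀ {a b} k l → b ≈ a + ι k → rising a k * rising b l ≈ rising a (k N.+ l)
    rising-append {a} {b} k l e = sym (trans (∏-split k l (λ i → a + ι i)) (*-congˡ (∏-cong< l (λ i _ →
      trans (+-congˡ (ι-+ k i)) (trans (sym (+-assoc _ _ _)) (+-congʳ (sym e)))))))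

    falling : ∀ {a} c n → a ≈ c - ι n + 1# → ∏ n (λ i → c - ι i) ≈ rising a n
    falling {a} c n e = trans (∏-cong< n {g = λ i → a + ι (n ∸ suc i)} (λ i i<n → begin
      c - ι i
        ≈⟨ solve 3 (λ c n i → c :- i := (c :- n :+ K 1) :+ (n :- (K 1 :+ i))) refl c (ι n) (ι i) ⟩
      (c - ι n + 1#) + (ι n - ι (suc i))
        ≈⟨ +-cong e (ι-∸ i<n) ⟨
      a + ι (n ∸ suc i) ∎)) (∏-rev n (λ i → a + ι i))

    -- The first factor k + 1, doubled, becomes 2k + 2 and moves to the end of the run of
    -- consecutive integers.
    rising-double : ∀ k → ι 2 * rising (ι (suc k)) (suc k) ≈ rising (ι (2 N.+ k)) (suc k)
    rising-double k = begin
      ι 2 * ((ι (suc k) + 0#) * ∏ k (λ i → ι (suc k) + ι (suc i)))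
        ≈⟨ *-congˡ (*-congˡ (∏-cong< k {g = λ i → ι (2 N.+ k) + ι i} (λ i _ →
             solve 2 (λ k i → k :+ (K 1 :+ i) := (K 1 :+ k) :+ i) refl (ι (suc k)) (ι i)))) ⟩
      ι 2 * ((ι (suc k) + 0#) * rising (ι (2 N.+ k)) k)
        ≈⟨ solve 2 (λ k r → (K 1 :+ (K 1 :+ K 0)) :* ((K 1 :+ k :+ K 0) :* r) := r :* ((K 1 :+ (K 1 :+ k)) :+ k)) refl (ι k) _ ⟩
      rising (ι (2 N.+ k)) k * (ι (2 N.+ k) + ι k)
        ≈⟨ ∏-last k (λ i → ι (2 N.+ k) + ι i) ⟨
      rising (ι (2 N.+ k)) (suc k) ∎

    -- Everything conditioned on the single membership of `suc h`: the factor s, a factor p for each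
    -- smaller partner and a factor q for each larger one.
    κ : (Carrier → Carrier) → (Carrier → Carrier → Carrier) → (Carrier → Carrier → Carrier) → ℕ → Carrier
    κ s p q h = s (ι (suc h)) * ∏ h (λ j → p (ι (suc j)) (ι (suc h)))
      * ∏ (t ∸ suc h) (λ k → q (ι (suc h)) (ι (suc (suc h N.+ k))))

    module Hook (h d : ℕ) (t≡ : t ≡ suc h N.+ d) (d≡ : t ∸ suc h ≡ d) where
      a b H : Carrier
      a = ι h
      b = ι d
      H = ι (suc h)

      size : ℕ
      size = (suc h N.+ suc h) N.+ suc d N.+ d

      m≈ : m ≈ 1# + (1# + (a + b))
      m≈ = +-congˡ (trans (reflexive (≡.cong ι t≡)) (+-congˡ (ι-+ h d)))

      K≈ : ∀ k → ι (suc (suc h N.+ k)) ≈ 1# + (H + ι k)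
      K≈ k = +-congˡ (ι-+ (suc h) k)

      big : Carrier
      big = ι (suc h N.+ suc h)

      big≈ : big ≈ H + H
      big≈ = ι-+ (suc h) (suc h)

      -- With H = h + 1 the factors regroup into four consecutive runs of integers, namely 1 to H, H
      -- + 1 to 2H, the next d + 1 and the next d, which make up (2t + 1)!. The factor 2 is spent on
      -- the second run, by `rising-double`.
      numerator : ι 2 * κ sₙ pₙ qₙ h ≈ rising 1# size
      numerator = begin
        ι 2 * κ sₙ pₙ qₙ h
          ≈⟨ *-congˡ (*-cong (*-congˡ (∏-* h (λ j → H + ι (suc j)) (λ j → H - ι (suc j))))
               (trans (reflexive (≡.cong (λ e → ∏ e (λ k → qₙ H (ι (suc (suc h N.+ k))))) d≡))
                 (∏-* d (λ k → ι (suc (suc h N.+ k)) + H) (λ k → N + H - ι (suc (suc h N.+ k)))))) ⟩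
        ι 2 * ((m + H) * (H * H) * (A₁ * A₂) * (A₃ * A₄))
          ≈⟨ solve 7 (λ x y H p q r s → x :* (y :* (H :* H) :* (p :* q) :* (r :* s))
               := (H :* q) :* (x :* (H :* p)) :* (r :* y) :* s) refl (ι 2) (m + H) H A₁ A₂ A₃ A₄ ⟩
        (H * A₂) * (ι 2 * (H * A₁)) * (A₃ * (m + H)) * A₄
          ≈⟨ *-cong (*-cong (*-cong HA₂ (trans (*-congˡ HA₁) (rising-double h))) A₃m) A₄≈ ⟩
        rising 1# (suc h) * rising (ι (2 N.+ h)) (suc h) * rising (1# + big) (suc d) * rising (1# + ι (suc h N.+ suc h N.+ suc d)) d
          ≈⟨ trans (*-congʳ (trans (*-congʳ (rising-append (suc h) (suc h) refl)) (rising-append (suc h N.+ suc h) (suc d) refl)))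
               (rising-append (suc h N.+ suc h N.+ suc d) d refl) ⟩
        rising 1# size ∎
        where
        A₁ A₂ A₃ A₄ : Carrier
        A₁ = ∏ h (λ j → H + ι (suc j))
        A₂ = ∏ h (λ j → H - ι (suc j))
        A₃ = ∏ d (λ k → ι (suc (suc h N.+ k)) + H)
        A₄ = ∏ d (λ k → N + H - ι (suc (suc h N.+ k)))
        HA₂ : H * A₂ ≈ rising 1# (suc h)
        HA₂ = trans (*-congʳ (solve 1 (λ h → h := h :- K 0) refl H))
          (falling {1#} H (suc h) (solve 1 (λ h → K 1 := h :- h :+ K 1) refl H))
        HA₁ : H * A₁ ≈ rising H (suc h)
        HA₁ = *-congʳ (sym (+-identityʳ H))
        A₃m : A₃ * (m + H) ≈ rising (1# + big) (suc d)
        A₃m = trans (*-cong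
            (∏-cong< d {g = λ k → 1# + big + ι k} (λ k _ → trans (+-congʳ (K≈ k))
              (trans (solve 2 (λ H k → K 1 :+ (H :+ k) :+ H := K 1 :+ (H :+ H) :+ k) refl H (ι k)) (+-congʳ (+-congˡ (sym big≈))))))
            (trans (+-congʳ m≈) (trans (solve 2 (λ a b → K 1 :+ (K 1 :+ (a :+ b)) :+ (K 1 :+ a) := K 1 :+ ((K 1 :+ a) :+ (K 1 :+ a)) :+ b) refl a b)
              (+-congʳ (+-congˡ (sym big≈))))))
          (sym (∏-last d (λ k → 1# + big + ι k)))
        A₄≈ : A₄ ≈ rising (1# + ι (suc h N.+ suc h N.+ suc d)) d
        A₄≈ = trans (∏-cong< d {g = λ k → N - 1# - ι k} (λ k _ → trans (+-congˡ (-‿cong (K≈ k)))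
            (solve 3 (λ N H k → N :+ H :- (K 1 :+ (H :+ k)) := N :- K 1 :- k) refl N H (ι k))))
          (falling (N - 1#) d (begin
            1# + ι (suc h N.+ suc h N.+ suc d)
              ≈⟨ +-congˡ (trans (ι-+ (suc h N.+ suc h) (suc d)) (+-congʳ big≈)) ⟩
            1# + ((1# + a) + (1# + a) + (1# + b))
              ≈⟨ solve 2 (λ a b → let m = K 1 :+ (K 1 :+ (a :+ b)) in
                   K 1 :+ ((K 1 :+ a) :+ (K 1 :+ a) :+ (K 1 :+ b)) := m :+ m :- K 1 :- b :+ K 1) refl a b ⟩
            (1# + (1# + (a + b))) + (1# + (1# + (a + b))) - 1# - b + 1#
              ≈⟨ +-congʳ (+-congʳ (+-congʳ (+-cong m≈ m≈))) ⟨
            N - 1# - b + 1# ∎))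

      -- The same factorial (2t + 1)!, with the roles of H and M - H = d + 1 exchanged. So numerator
      -- and denominator cancel separately for each element of Δ.
      denominator : ι 2 * κ s_d p_d q_d h ≈ rising 1# size
      denominator = begin
        ι 2 * κ s_d p_d q_d h
          ≈⟨ *-congˡ (*-cong (*-congˡ (∏-* h (λ j → N - H - ι (suc j)) (λ j → N - H + ι (suc j))))
               (trans (reflexive (≡.cong (λ e → ∏ e (λ k → q_d H (ι (suc (suc h N.+ k))))) d≡))
                 (∏-* d (λ k → ι (suc (suc h N.+ k)) - H) (λ k → N - ι (suc (suc h N.+ k)) - H)))) ⟩
        ι 2 * ((N - H) * ((m - H) * (m - H)) * (A₁ * A₂) * (A₃ * A₄))
          ≈⟨ solve 7 (λ x n y p q r s → x :* (n :* (y :* y) :* (p :* q) :* (r :* s))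
               := (r :* y) :* (x :* (y :* s)) :* (n :* p) :* q) refl (ι 2) (N - H) (m - H) A₁ A₂ A₃ A₄ ⟩
        (A₃ * (m - H)) * (ι 2 * ((m - H) * A₄)) * ((N - H) * A₁) * A₂
          ≈⟨ *-cong (*-cong (*-cong A₃m (trans (*-congˡ mA₄) (rising-double d))) NA₁) A₂≈ ⟩
        rising 1# (suc d) * rising (ι (2 N.+ d)) (suc d) * rising (1# + ι (suc d N.+ suc d)) (suc h)
          * rising (1# + ι (suc d N.+ suc d N.+ suc h)) h
          ≈⟨ trans (*-congʳ (trans (*-congʳ (rising-append (suc d) (suc d) refl)) (rising-append (suc d N.+ suc d) (suc h) refl)))
               (rising-append (suc d N.+ suc d N.+ suc h) h refl) ⟩
        rising 1# ((suc d N.+ suc d) N.+ suc h N.+ h)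
          ≡⟨ ≡.cong (rising 1#) (length-symmetric d h) ⟩
        rising 1# size ∎
        where
        m-H : m - H ≈ 1# + b
        m-H = trans (+-congʳ m≈) (solve 2 (λ a b → K 1 :+ (K 1 :+ (a :+ b)) :- (K 1 :+ a) := K 1 :+ b) refl a b)
        N-2H : N - H - H ≈ (1# + b) + (1# + b)
        N-2H = trans (solve 2 (λ m H → m :+ m :- H :- H := (m :- H) :+ (m :- H)) refl m H) (+-cong m-H m-H)
        A₁ A₂ A₃ A₄ : Carrier
        A₁ = ∏ h (λ j → N - H - ι (suc j))
        A₂ = ∏ h (λ j → N - H + ι (suc j))
        A₃ = ∏ d (λ k → ι (suc (suc h N.+ k)) - H)
        A₄ = ∏ d (λ k → N - ι (suc (suc h N.+ k)) - H)
        A₃m : A₃ * (m - H) ≈ rising 1# (suc d)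
        A₃m = trans (*-cong (∏-cong< d {g = λ k → 1# + ι k} (λ k _ → trans (+-congʳ (K≈ k))
            (solve 2 (λ H k → K 1 :+ (H :+ k) :- H := K 1 :+ k) refl H (ι k)))) m-H)
          (sym (∏-last d (λ k → 1# + ι k)))
        mA₄ : (m - H) * A₄ ≈ rising (ι (suc d)) (suc d)
        mA₄ = *-cong (trans m-H (sym (+-identityʳ _))) (trans
          (∏-cong< d {g = λ k → N - H - H - 1# - ι k} (λ k _ → trans (+-congʳ (+-congˡ (-‿cong (K≈ k))))
            (solve 3 (λ N H k → N :- (K 1 :+ (H :+ k)) :- H := N :- H :- H :- K 1 :- k) refl N H (ι k))))
          (trans (falling {ι (suc d) + 1#} (N - H - H - 1#) d (sym (trans (+-congʳ (+-congʳ (+-congʳ N-2H)))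
              (solve 1 (λ b → (K 1 :+ b) :+ (K 1 :+ b) :- K 1 :- b :+ K 1 := K 1 :+ b :+ K 1) refl b))))
            (∏-cong< d (λ k _ → +-assoc _ _ _))))
        NA₁ : (N - H) * A₁ ≈ rising (1# + ι (suc d N.+ suc d)) (suc h)
        NA₁ = trans (*-congʳ (solve 1 (λ x → x := x :- K 0) refl (N - H)))
          (falling (N - H) (suc h) (sym (trans (+-congʳ N-2H) (trans (+-comm _ _) (+-congˡ (sym (ι-+ (suc d) (suc d))))))))
        A₂≈ : A₂ ≈ rising (1# + ι (suc d N.+ suc d N.+ suc h)) h
        A₂≈ = ∏-cong< h (λ j _ → begin
          N - H + ι (suc j)
            ≈⟨ solve 3 (λ N H j → N :- H :+ (K 1 :+ j) := K 1 :+ ((N :- H :- H) :+ H) :+ j) refl N H (ι j) ⟩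
          1# + ((N - H - H) + H) + ι j
            ≈⟨ +-congʳ (+-congˡ (+-congʳ (trans N-2H (sym (ι-+ (suc d) (suc d)))))) ⟩
          1# + (ι (suc d N.+ suc d) + H) + ι j
            ≈⟨ +-congʳ (+-congˡ (ι-+ (suc d N.+ suc d) (suc h))) ⟨
          1# + ι (suc d N.+ suc d N.+ suc h) + ι j ∎)

    κ-equal : ∀ h → h N.< t → κ s_d p_d q_d h ≈ κ sₙ pₙ qₙ h
    κ-equal h h<t = cancel (unit-ι {2} (s≤s z≤n)) (trans (Hook.denominator h (t ∸ suc h) t≡ ≡.refl) (sym (Hook.numerator h (t ∸ suc h) t≡ ≡.refl)))
      where
      t≡ : t ≡ suc h N.+ (t ∸ suc h)
      t≡ = ≡.sym (ℕₚ.m+[n∸m]≡n h<t)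

    κ-unit : ∀ h → h N.< t → Unit (κ sₙ pₙ qₙ h)
    κ-unit h h<t = unit-≈ undo (unit-* (ι 2 , trans (*-comm _ _) (inv-suc 1))
        (unit-≈ (sym (Hook.numerator h (t ∸ suc h) (≡.sym (ℕₚ.m+[n∸m]≡n h<t)) ≡.refl)) (unit-∏ (Hook.size h (t ∸ suc h) (≡.sym (ℕₚ.m+[n∸m]≡n h<t)) ≡.refl) (λ i _ → unit-ι {suc i} (s≤s z≤n)))))
      where
      undo : inv 2 * (ι 2 * κ sₙ pₙ qₙ h) ≈ κ sₙ pₙ qₙ h
      undo = trans (sym (*-assoc _ _ _)) (trans (*-congʳ (trans (*-comm _ _) (inv-suc 1))) (*-identityˡ _))

  module _ (β : ℕ → Bool) where

    Vβ V₀ w : Carrier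
    Vβ = Vd (applyUpTo (λ i → position (β (suc i)) (suc i)) t)
    V₀ = Vd (applyUpTo (λ i → position false (suc i)) t)
    w = ∏ t (λ h → sel (β (suc h)) (hookFactorᵇ β (suc h)))

    private
      -- The q factors, attached to the smaller element of a pair, are reindexed over the triangle
      -- of pairs, so that all factors depending on the membership of one element come together.
      collect : ∀ s p q → ∏ t (λ h → sel (β (suc h)) (s (ι (suc h))) * ∏ h (λ j →
                  sel (β (suc h)) (p (ι (suc j)) (ι (suc h))) * sel (β (suc j)) (q (ι (suc j)) (ι (suc h)))))
                ≈ ∏ t (λ h → sel (β (suc h)) (κ s p q h))
      collect s p q = begin
        ∏ t (λ h → S h * ∏ h (λ j → P j h * Q j h))
          ≈⟨ ∏-cong< t {g = λ h → S h * ∏ h (λ j → P j h) * ∏ h (λ j → Q j h)} (λ h _ →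
               trans (*-congˡ (∏-* h (λ j → P j h) (λ j → Q j h))) (sym (*-assoc _ _ _))) ⟩
        ∏ t (λ h → S h * ∏ h (λ j → P j h) * ∏ h (λ j → Q j h))
          ≈⟨ ∏-* t (λ h → S h * ∏ h (λ j → P j h)) (λ h → ∏ h (λ j → Q j h)) ⟩
        ∏ t (λ h → S h * ∏ h (λ j → P j h)) * ∏ t (λ h → ∏ h (λ j → Q j h))
          ≈⟨ *-congˡ (∏-triangle t Q) ⟨
        ∏ t (λ h → S h * ∏ h (λ j → P j h)) * ∏ t (λ h → ∏ (t ∸ suc h) (λ k → Q h (suc h N.+ k)))
          ≈⟨ ∏-* t (λ h → S h * ∏ h (λ j → P j h)) (λ h → ∏ (t ∸ suc h) (λ k → Q h (suc h N.+ k))) ⟨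
        ∏ t (λ h → S h * ∏ h (λ j → P j h) * ∏ (t ∸ suc h) (λ k → Q h (suc h N.+ k)))
          ≈⟨ ∏-cong< t (λ h _ → trans (sel-* (β (suc h)) _ _) (*-cong (trans (sel-* (β (suc h)) _ _)
               (*-congˡ (sel-∏ (β (suc h)) h _))) (sel-∏ (β (suc h)) (t ∸ suc h) _))) ⟨
        ∏ t (λ h → sel (β (suc h)) (κ s p q h)) ∎
        where
        S : ℕ → Carrier
        S h = sel (β (suc h)) (s (ι (suc h)))
        P Q : ℕ → ℕ → Carrier
        P j h = sel (β (suc h)) (p (ι (suc j)) (ι (suc h)))
        Q j h = sel (β (suc j)) (q (ι (suc j)) (ι (suc h)))

      pos : ℕ → Carrier
      pos h = position (β (suc h)) (suc h)

      Gap Gap₀ Ψ : ℕ → ℕ → Carrier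
      Gap j h = gap (β (suc j)) (β (suc h)) (suc j) (suc h)
      Gap₀ j h = gap false false (suc j) (suc h)
      Ψ j h = sel (β (suc h)) (pairFactor β (suc h) (suc j))

      factor : (Carrier → Carrier) → (Carrier → Carrier → Carrier) → (Carrier → Carrier → Carrier) → ℕ → Carrier
      factor s p q h = sel (β (suc h)) (s (ι (suc h))) * ∏ h (λ j →
        sel (β (suc h)) (p (ι (suc j)) (ι (suc h))) * sel (β (suc j)) (q (ι (suc j)) (ι (suc h))))

      row : ∀ h → pos h * ∏ h (λ j → Gap j h) * factor s_d p_d q_d h
        ≈ sel (β (suc h)) (hookFactorᵇ β (suc h)) * (position false (suc h) * ∏ h (λ j → Gap₀ j h)) * factor sₙ pₙ qₙ h
      row h = begin
        pos h * ∏ h (λ j → Gap j h) * (σd * ∏ h πd)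
          ≈⟨ solve 4 (λ a b c d → a :* b :* (c :* d) := (a :* c) :* (b :* d)) refl _ _ _ _ ⟩
        (pos h * σd) * (∏ h (λ j → Gap j h) * ∏ h πd)
          ≈⟨ *-cong (single b h) (trans (sym (∏-* h (λ j → Gap j h) πd))
               (trans (∏-cong< h {g = λ j → Ψ j h * Gap₀ j h * πn j} (λ j j<h → pair (β (suc j)) b j h j<h))
                 (trans (∏-* h (λ j → Ψ j h * Gap₀ j h) πn) (*-congʳ (∏-* h (λ j → Ψ j h) (λ j → Gap₀ j h)))))) ⟩
        (sel b (ends (suc h)) * position false (suc h) * σn) * (∏ h (λ j → Ψ j h) * ∏ h (λ j → Gap₀ j h) * ∏ h πn)
          ≈⟨ solve 6 (λ e p s x g y → (e :* p :* s) :* (x :* g :* y) := (e :* x) :* (p :* g) :* (s :* y)) refl _ _ _ _ _ _ ⟩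
        (sel b (ends (suc h)) * ∏ h (λ j → Ψ j h)) * (position false (suc h) * ∏ h (λ j → Gap₀ j h)) * (σn * ∏ h πn)
          ≈⟨ *-congʳ (*-congʳ hooks) ⟩
        sel b (hookFactorᵇ β (suc h)) * (position false (suc h) * ∏ h (λ j → Gap₀ j h)) * (σn * ∏ h πn) ∎
        where
        b : Bool
        b = β (suc h)
        σd σn : Carrier
        σd = sel b (s_d (ι (suc h)))
        σn = sel b (sₙ (ι (suc h)))
        πd πn : ℕ → Carrier
        πd j = sel b (p_d (ι (suc j)) (ι (suc h))) * sel (β (suc j)) (q_d (ι (suc j)) (ι (suc h)))
        πn j = sel b (pₙ (ι (suc j)) (ι (suc h))) * sel (β (suc j)) (qₙ (ι (suc j)) (ι (suc h)))
        hooks : sel b (ends (suc h)) * ∏ h (λ j → Ψ j h) ≈ sel b (hookFactorᵇ β (suc h))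
        hooks = trans (*-congˡ (sym (sel-∏ b h (λ j → pairFactor β (suc h) (suc j)))))
          (trans (sym (sel-* b _ _)) (sel-cong b (*-congˡ (reflexive (≡.sym (prodR-oneTo (pairFactor β (suc h)) h))))))

    V-ratio : Vβ ≈ w * V₀
    V-ratio = cancel (unit-∏ t (λ h h<t → sel-unit (β (suc h)) (κ-unit h h<t))) (begin
      ∏ t (λ h → sel (β (suc h)) (κ sₙ pₙ qₙ h)) * Vβ
        ≈⟨ *-cong (trans (∏-cong< t (λ h h<t → sel-cong (β (suc h)) (sym (κ-equal h h<t)))) (sym (collect s_d p_d q_d)))
             (Vd-∏ t pos) ⟩
      ∏ t (factor s_d p_d q_d) * ∏ t (λ h → pos h * ∏ h (λ j → Gap j h))
        ≈⟨ trans (*-comm _ _) (sym (∏-* t (λ h → pos h * ∏ h (λ j → Gap j h)) (factor s_d p_d q_d))) ⟩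
      ∏ t (λ h → pos h * ∏ h (λ j → Gap j h) * factor s_d p_d q_d h)
        ≈⟨ ∏-cong< t (λ h _ → row h) ⟩
      ∏ t (λ h → W₁ h * V₁ h * factor sₙ pₙ qₙ h)
        ≈⟨ trans (∏-* t (λ h → W₁ h * V₁ h) (factor sₙ pₙ qₙ)) (*-congʳ (∏-* t W₁ V₁)) ⟩
      ∏ t W₁ * ∏ t V₁ * ∏ t (factor sₙ pₙ qₙ)
        ≈⟨ *-cong (*-congˡ (sym (Vd-∏ t (λ i → position false (suc i))))) (collect sₙ pₙ qₙ) ⟩
      w * V₀ * ∏ t (λ h → sel (β (suc h)) (κ sₙ pₙ qₙ h))
        ≈⟨ *-comm _ _ ⟩
      ∏ t (λ h → sel (β (suc h)) (κ sₙ pₙ qₙ h)) * (w * V₀) ∎)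
      where
      W₁ V₁ : ℕ → Carrier
      W₁ h = sel (β (suc h)) (hookFactorᵇ β (suc h))
      V₁ h = position false (suc h) * ∏ h (λ j → Gap₀ j h)

  V₀-unit : Unit (Vd (applyUpTo (λ i → position false (suc i)) t))
  V₀-unit = unit-≈ (sym (Vd-∏ t (λ i → position false (suc i)))) (unit-∏ t (λ h h<t → unit-*
    (unit-≈ (ι-∸ (ℕₚ.m≤n⇒m≤1+n h<t)) (unit-ι (ℕₚ.m<n⇒0<n∸m (s≤s h<t))))
    (unit-∏ h (λ j j<h → unit-≈ (difference h j h<t j<h) (unit-neg (unit-* (unit-ι (ℕₚ.m<n⇒0<n∸m j<h))
      (unit-ι {(t ∸ h) N.+ (t ∸ j)} (ℕₚ.<-≤-trans (ℕₚ.m<n⇒0<n∸m h<t) (ℕₚ.m≤m+n (t ∸ h) (t ∸ j)))))))) ))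
    where
    difference : ∀ h j → h N.< t → j N.< h → - (ι (h ∸ j) * ι ((t ∸ h) N.+ (t ∸ j)))
      ≈ (m - ι (suc h)) * (m - ι (suc h)) - (m - ι (suc j)) * (m - ι (suc j))
    difference h j h<t j<h = begin
      - (ι (h ∸ j) * ι ((t ∸ h) N.+ (t ∸ j)))
        ≈⟨ -‿cong (*-cong (ι-∸ (ℕₚ.<⇒≤ j<h)) (trans (ι-+ (t ∸ h) (t ∸ j))
             (+-cong (ι-∸ (ℕₚ.<⇒≤ h<t)) (ι-∸ (ℕₚ.<⇒≤ (ℕₚ.<-trans j<h h<t)))))) ⟩
      - ((ι h - ι j) * ((ι t - ι h) + (ι t - ι j)))
        ≈⟨ solve 3 (λ t h j → :- ((h :- j) :* ((t :- h) :+ (t :- j)))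
             := ((K 1 :+ t) :- (K 1 :+ h)) :* ((K 1 :+ t) :- (K 1 :+ h)) :- ((K 1 :+ t) :- (K 1 :+ j)) :* ((K 1 :+ t) :- (K 1 :+ j)))
             refl (ι t) (ι h) (ι j) ⟩
      (m - ι (suc h)) * (m - ι (suc h)) - (m - ι (suc j)) * (m - ι (suc j)) ∎

-- Finite sets of positive integers.

module Subsets where
  open N using (_>_)
  open ≡ using (refl)
  open import Data.List.Membership.Propositional using (_∉_)
  open import Data.List.Membership.Propositional.Properties using (∈-++⁺ˡ; ∈-++⁺ʳ)
  open import Data.List.Relation.Binary.Disjoint.Propositional using (Disjoint)
  open All using (All; []; _∷_)
  open import Data.List.Relation.Unary.Linked as Linked using (Linked; []; [-]; _∷_)

  -- Each subset of {1, ..., m} is represented by its strictly decreasing list, so equality of sets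
  -- is equality of lists, and the recursion on the largest element matches the expansion of the
  -- last column of the determinant.
  subsets : ℕ → List (List ℕ)
  subsets zero = [] ∷ []
  subsets (suc m) = subsets m ++ map (suc m ∷_) (subsets m)

  subsets-bounded : ∀ m {Δ} → Δ ∈ subsets m → All (N._≤ m) Δ
  subsets-bounded zero (here refl) = []
  subsets-bounded (suc m) Δ∈ with ∈-++⁻ (subsets m) Δ∈
  ... | inj₁ p = All.map ℕₚ.m≤n⇒m≤1+n (subsets-bounded m p)
  ... | inj₂ q with ∈-map⁻ (suc m ∷_) q
  ...   | Δ′ , p , refl = ℕₚ.≤-refl ∷ All.map ℕₚ.m≤n⇒m≤1+n (subsets-bounded m p)

  subsets-positive : ∀ m {Δ} → Δ ∈ subsets m → All (1 N.≤_) Δ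
  subsets-positive zero (here refl) = []
  subsets-positive (suc m) Δ∈ with ∈-++⁻ (subsets m) Δ∈
  ... | inj₁ p = subsets-positive m p
  ... | inj₂ q with ∈-map⁻ (suc m ∷_) q
  ...   | Δ′ , p , refl = s≤s z≤n ∷ subsets-positive m p

  ∷-decreasing : ∀ {a Δ} → All (N._< a) Δ → Linked _>_ Δ → Linked _>_ (a ∷ Δ)
  ∷-decreasing [] [] = [-]
  ∷-decreasing (b<a ∷ _) [-] = b<a ∷ [-]
  ∷-decreasing (b<a ∷ _) (p ∷ ps) = b<a ∷ p ∷ ps

  subsets-decreasing : ∀ m {Δ} → Δ ∈ subsets m → Linked _>_ Δ
  subsets-decreasing zero (here refl) = []
  subsets-decreasing (suc m) Δ∈ with ∈-++⁻ (subsets m) Δ∈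
  ... | inj₁ p = subsets-decreasing m p
  ... | inj₂ q with ∈-map⁻ (suc m ∷_) q
  ...   | Δ′ , p , refl = ∷-decreasing (All.map s≤s (subsets-bounded m p)) (subsets-decreasing m p)

  decreasing-head : ∀ {a Δ} → Linked _>_ (a ∷ Δ) → All (N._< a) Δ
  decreasing-head [-] = []
  decreasing-head (b<a ∷ ps) = b<a ∷ All.map (λ c<b → ℕₚ.<-trans c<b b<a) (decreasing-head ps)

  ∈-subsets : ∀ m {Δ} → Linked _>_ Δ → All (1 N.≤_) Δ → All (N._≤ m) Δ → Δ ∈ subsets m
  ∈-subsets zero {[]} _ _ _ = here refl
  ∈-subsets zero {a ∷ Δ} _ (1≤a ∷ _) (a≤0 ∷ _) = contradiction (ℕₚ.≤-trans 1≤a a≤0) λ ()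
  ∈-subsets (suc m) {[]} _ _ _ = ∈-++⁺ˡ (∈-subsets m [] [] [])
  ∈-subsets (suc m) {a ∷ Δ} dec (1≤a ∷ pos) (a≤1+m ∷ _) with a N.≟ suc m
  ... | yes refl = ∈-++⁺ʳ (subsets m) (∈-map⁺ (suc m ∷_) (∈-subsets m (Linked.tail dec) pos (All.map ℕₚ.≤-pred (decreasing-head dec))))
  ... | no a≢ = ∈-++⁺ˡ (∈-subsets m dec (1≤a ∷ pos) (a≤m ∷ All.map (λ b<a → ℕₚ.≤-trans (ℕₚ.<⇒≤ b<a) a≤m) (decreasing-head dec)))
    where
    a≤m : a N.≤ m
    a≤m = ℕₚ.≤-pred (ℕₚ.≤∧≢⇒< a≤1+m a≢)

  ∉-bounded : ∀ {m Δ} → All (N._≤ m) Δ → suc m ∉ Δ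
  ∉-bounded bounded 1+m∈ = ℕₚ.1+n≰n (All.lookup bounded 1+m∈)

  subsets-unique : ∀ m → Unique (subsets m)
  subsets-unique zero = [] ∷ []
  subsets-unique (suc m) = Uniqueₚ.++⁺ (subsets-unique m)
    (Uniqueₚ.map⁺ (λ { refl → refl }) (subsets-unique m)) disjoint
    where
    disjoint : Disjoint (subsets m) (map (suc m ∷_) (subsets m))
    disjoint (p , q) with ∈-map⁻ (suc m ∷_) q
    ... | _ , _ , refl = ∉-bounded (subsets-bounded m p) (here refl)

  member : List ℕ → ℕ → Bool
  member Δ j = does (j ∈? Δ)

  member-head : ∀ a Δ → member (a ∷ Δ) a ≡ true
  member-head a Δ = dec-true (a ∈? (a ∷ Δ)) (here refl)

  member-top : ∀ {m Δ} → All (N._≤ m) Δ → member Δ (suc m) ≡ false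
  member-top {m} {Δ} bounded = dec-false (suc m ∈? Δ) (∉-bounded bounded)

  member-tail : ∀ {a j} Δ → j ≢ a → member (a ∷ Δ) j ≡ member Δ j
  member-tail {a} {j} Δ j≢a = does-⇔ (mk⇔ (λ { (here e) → contradiction e j≢a ; (there p) → p }) there) (j ∈? (a ∷ Δ)) (j ∈? Δ)

open Subsets

module SumR {c ℓ} (R : CommutativeRing c ℓ) (inv : ℕ → CommutativeRing.Carrier R) where
  open Kit R inv
  sumR-cong : ∀ {A : Set} (xs : List A) {f g : A → Carrier} → (∀ {a} → a ∈ xs → f a ≈ g a) → sumR (map f xs) ≈ sumR (map g xs)
  sumR-cong [] e = refl
  sumR-cong (a ∷ xs) e = +-cong (e (here ≡.refl)) (sumR-cong xs (e ∘ there))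

  sumR-++ : ∀ {A : Set} (xs ys : List A) (f : A → Carrier) → sumR (map f (xs ++ ys)) ≈ sumR (map f xs) + sumR (map f ys)
  sumR-++ [] ys f = sym (+-identityˡ _)
  sumR-++ (a ∷ xs) ys f = trans (+-congˡ (sumR-++ xs ys f)) (sym (+-assoc _ _ _))

  sumR-map : ∀ {A B : Set} (g : A → B) (xs : List A) (f : B → Carrier) → sumR (map f (map g xs)) ≡ sumR (map (f ∘ g) xs)
  sumR-map g xs f = ≡.cong sumR (≡.sym (Lₚ.map-∘ xs))

  sumR-*ˡ : ∀ {A : Set} (xs : List A) (b : Carrier) (f : A → Carrier) → sumR (map (λ a → b * f a) xs) ≈ b * sumR (map f xs)
  sumR-*ˡ [] b f = sym (zeroʳ b)
  sumR-*ˡ (a ∷ xs) b f = trans (+-congˡ (sumR-*ˡ xs b f)) (sym (distribˡ _ _ _))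

  sumR-+ : ∀ {A : Set} (xs : List A) (f g : A → Carrier) → sumR (map (λ a → f a + g a) xs) ≈ sumR (map f xs) + sumR (map g xs)
  sumR-+ [] f g = sym (+-identityˡ _)
  sumR-+ (a ∷ xs) f g = trans (+-congˡ (sumR-+ xs f g))
    (solve 4 (λ a b c d → (a :+ b) :+ (c :+ d) := (a :+ c) :+ (b :+ d)) refl _ _ _ _)

-- Expansion of the determinant as a sum over subsets.

module Expansion {c ℓ} (R : CommutativeRing c ℓ) (inv : ℕ → CommutativeRing.Carrier R)
  (inv-suc : Reciprocals R inv)
  (x : CommutativeRing.Carrier R) (n : ℕ) (x-nilpotent : NilpotentBeyond R inv n x)
  (t′ : ℕ) (3n≤t : n N.+ (n N.+ n) N.≤ suc t′) where
  open Kit R inv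
  open Units R inv inv-suc
  open Wedge R inv
  open Points R inv inv-suc
  module Det = Determinant R inv inv-suc x n x-nilpotent t′ 3n≤t
  open Det
  open Vandermonde R inv inv-suc
  open HookRatio R inv inv-suc t
  open SumR R inv
  open Relation.Binary.Reasoning.Setoid setoid

  private
    fix-last : ∀ {w} → Alternating w → ∀ y → Alternating (λ ys → w (ys ∷ʳ y))
    fix-last {w} alt y = record
      { resp = λ p → Alternating.resp alt (Pw.++⁺ p (≐-refl [ y ]))
      ; add = λ us a b vs → trans (reflexive (move us (a ⊞ b) vs)) (trans (Alternating.add alt us a b (vs ∷ʳ y))
          (sym (+-cong (reflexive (move us a vs)) (reflexive (move us b vs)))))
      ; scale = λ us b a vs → trans (reflexive (move us (b • a) vs)) (trans (Alternating.scale alt us b a (vs ∷ʳ y))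
          (sym (*-congˡ (reflexive (move us a vs)))))
      ; adjacent = λ us a vs → trans (reflexive (move us a (a ∷ vs))) (Alternating.adjacent alt us a (vs ∷ʳ y)) }
      where
      move : ∀ us a vs → w ((us ++ a ∷ vs) ∷ʳ y) ≡ w (us ++ a ∷ (vs ∷ʳ y))
      move us a vs = ≡.cong w (Lₚ.++-assoc us (a ∷ vs) [ y ])

  coef : List ℕ → Carrier
  coef Δ = sign (length Δ) * xp (sum Δ)

  points : ℕ → List ℕ → List Carrier
  points m Δ = applyUpTo (λ i → position (member Δ (suc i)) (suc i)) m

  private
    coef-∷ : ∀ j Δ → coef (j ∷ Δ) ≈ - xp j * coef Δ
    coef-∷ j Δ = trans (*-congˡ (xp-+ j (sum Δ)))
      (solve 3 (λ s x y → (:- K 1) :* s :* (x :* y) := :- x :* (s :* y)) refl (sign (length Δ)) (xp j) (xp (sum Δ)))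

    applyUpTo-cong : ∀ {a} {A : Set a} m {f g : ℕ → A} → (∀ i → i N.< m → f i ≡ g i) → applyUpTo f m ≡ applyUpTo g m
    applyUpTo-cong zero e = ≡.refl
    applyUpTo-cong (suc m) e = ≡.cong₂ _∷_ (e 0 (s≤s z≤n)) (applyUpTo-cong m (λ i i<m → e (suc i) (s≤s i<m)))

    points-without : ∀ m {Δ} → Δ ∈ subsets m → map pt (points (suc m) Δ) ≡ map pt (points m Δ) ∷ʳ pt (M- suc m)
    points-without m {Δ} Δ∈ = ≡.trans (≡.cong (map pt) (≡.sym (Lₚ.applyUpTo-∷ʳ _ m)))
      (≡.trans (Lₚ.map-++ pt (points m Δ) _)
        (≡.cong (λ b → map pt (points m Δ) ∷ʳ pt (position b (suc m))) (member-top (subsets-bounded m Δ∈))))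

    points-with : ∀ m Δ → map pt (points (suc m) (suc m ∷ Δ)) ≡ map pt (points m Δ) ∷ʳ pt (M+ suc m)
    points-with m Δ = ≡.trans (≡.cong (map pt) (≡.sym (Lₚ.applyUpTo-∷ʳ _ m)))
      (≡.trans (Lₚ.map-++ pt (points m (suc m ∷ Δ)) _)
        (≡.cong₂ (λ ps b → map pt ps ∷ʳ pt (position b (suc m)))
          (applyUpTo-cong m (λ i i<m → ≡.cong (λ b → position b (suc i)) (member-tail Δ (ℕₚ.<⇒≢ (s≤s i<m)))))
          (member-head (suc m) Δ)))

    module _ (w : Form) (m : ℕ) (g : List ℕ → Carrier) where
      -- The weight `g` lets one recursion serve both E, with `g` constantly 1, and x dE/dx, with
      -- `g` the sum of Δ.
      split-top : sumR (map (λ Δ → g Δ * (coef Δ * w (map pt (points (suc m) Δ)))) (subsets (suc m)))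
        ≈ sumR (map (λ Δ → g Δ * (coef Δ * w (map pt (points m Δ) ∷ʳ pt (M- suc m)))) (subsets m))
          + - xp (suc m) * sumR (map (λ Δ → g (suc m ∷ Δ) * (coef Δ * w (map pt (points m Δ) ∷ʳ pt (M+ suc m)))) (subsets m))
      split-top = trans (sumR-++ (subsets m) (map (suc m ∷_) (subsets m)) term′)
        (+-cong (sumR-cong (subsets m) (λ Δ∈ → *-congˡ (*-congˡ (reflexive (≡.cong w (points-without m Δ∈))))))
          (trans (reflexive (sumR-map (suc m ∷_) (subsets m) term′))
            (trans (sumR-cong (subsets m) (λ {Δ} _ → trans
                (*-congˡ (*-cong (coef-∷ (suc m) Δ) (reflexive (≡.cong w (points-with m Δ)))))
                (solve 4 (λ g y c w → g :* (y :* c :* w) := y :* (g :* (c :* w))) refl (g (suc m ∷ Δ)) (- xp (suc m)) (coef Δ) _)))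
              (sumR-*ˡ (subsets m) (- xp (suc m)) (λ Δ → g (suc m ∷ Δ) * (coef Δ * w (map pt (points m Δ) ∷ʳ pt (M+ suc m))))))))
        where
        term′ : List ℕ → Carrier
        term′ Δ = g Δ * (coef Δ * w (map pt (points (suc m) Δ)))

    split-column : ∀ {w} → Alternating w → ∀ j us → w (us ∷ʳ column j) ≈ w (us ∷ʳ pt (M- j)) + - xp j * w (us ∷ʳ pt (M+ j))
    split-column alt j us = trans (Alternating.add alt us _ _ [])
      (+-congˡ (Alternating.scale alt us (- xp j) (pt (M+ j)) []))

    -- Multilinearity in the last column, whose two halves are the choices j ∉ Δ and j ∈ Δ. The form
    -- is arbitrary because the chosen half is absorbed into it before the induction hypothesis is
    -- used.
    expand : ∀ {w} → Alternating w → ∀ m →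
      w (applyUpTo columns m) ≈ sumR (map (λ Δ → 1# * (coef Δ * w (map pt (points m Δ)))) (subsets m))
    expand {w} alt zero = solve 1 (λ w → w := K 1 :* (K 1 :* K 1 :* w) :+ K 0) refl (w [])
    expand {w} alt (suc m) = begin
      w (applyUpTo columns (suc m))
        ≡⟨ ≡.cong w (Lₚ.applyUpTo-∷ʳ columns m) ⟨
      w (applyUpTo columns m ∷ʳ columns m)
        ≈⟨ split-column alt (suc m) (applyUpTo columns m) ⟩
      w (applyUpTo columns m ∷ʳ pt (M- suc m)) + - xp (suc m) * w (applyUpTo columns m ∷ʳ pt (M+ suc m))
        ≈⟨ +-cong (expand (fix-last alt (pt (M- suc m))) m) (*-congˡ (expand (fix-last alt (pt (M+ suc m))) m)) ⟩
      _ ≈⟨ split-top w m (λ _ → 1#) ⟨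
      sumR (map (λ Δ → 1# * (coef Δ * w (map pt (points (suc m) Δ)))) (subsets (suc m))) ∎

    -- The product rule: differentiating the last column contributes its index j exactly when j is
    -- chosen, which accounts for the step from the sum of Δ to the sum of `j ∷ Δ`.
    ∂expand : ∀ {w} → Alternating w → ∀ m →
      ∑ m (λ i → replaced w columns m i (∂column (suc i)))
        ≈ sumR (map (λ Δ → ι (sum Δ) * (coef Δ * w (map pt (points m Δ)))) (subsets m))
    ∂expand {w} alt zero = solve 1 (λ w → K 0 := K 0 :* (K 1 :* K 1 :* w) :+ K 0) refl (w [])
    ∂expand {w} alt (suc m) = begin
      ∑ (suc m) (λ i → replaced w columns (suc m) i (∂column (suc i)))
        ≈⟨ ∑-last m (λ i → replaced w columns (suc m) i (∂column (suc i))) ⟩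
      ∑ m (λ i → replaced w columns (suc m) i (∂column (suc i))) + replaced w columns (suc m) m (∂column (suc m))
        ≈⟨ +-cong (∑-cong< m earlier) last ⟩
      ∑ m (λ i → replaced w⁻ columns m i (∂column (suc i)) + - xp j * replaced w⁺ columns m i (∂column (suc i)))
        + - (ι j * xp j) * w⁺ (applyUpTo columns m)
        ≈⟨ +-cong (trans (∑-+ m (λ i → replaced w⁻ columns m i (∂column (suc i))) (λ i → - xp j * replaced w⁺ columns m i (∂column (suc i))))
             (+-cong (∂expand alt⁻ m) (trans (∑-*ˡ m (- xp j) (λ i → replaced w⁺ columns m i (∂column (suc i)))) (*-congˡ (∂expand alt⁺ m)))))
             (*-congˡ (expand alt⁺ m)) ⟩
      sumR (map (λ Δ → ι (sum Δ) * (coef Δ * w⁻ (map pt (points m Δ)))) (subsets m)) + - xp j * S⁺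
        + - (ι j * xp j) * sumR (map (λ Δ → 1# * (coef Δ * w⁺ (map pt (points m Δ)))) (subsets m))
        ≈⟨ solve 5 (λ a x s j u → a :+ :- x :* s :+ :- (j :* x) :* u := a :+ :- x :* (s :+ j :* u)) refl _ (xp j) S⁺ (ι j) _ ⟩
      sumR (map (λ Δ → ι (sum Δ) * (coef Δ * w⁻ (map pt (points m Δ)))) (subsets m))
        + - xp j * (S⁺ + ι j * sumR (map (λ Δ → 1# * (coef Δ * w⁺ (map pt (points m Δ)))) (subsets m)))
        ≈⟨ +-congˡ (*-congˡ (trans (+-congˡ (sym (sumR-*ˡ (subsets m) (ι j) (λ Δ → 1# * (coef Δ * w⁺ (map pt (points m Δ)))))))
             (trans (sym (sumR-+ (subsets m) (λ Δ → ι (sum Δ) * (coef Δ * w⁺ (map pt (points m Δ)))) _))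
               (sumR-cong (subsets m) (λ {Δ} _ → trans (solve 3 (λ s j c → s :* c :+ j :* (K 1 :* c) := (j :+ s) :* c) refl (ι (sum Δ)) (ι j) _)
                 (*-congʳ (sym (ι-+ j (sum Δ))))))))) ⟩
      _ ≈⟨ split-top w m (ι ∘ sum) ⟨
      sumR (map (λ Δ → ι (sum Δ) * (coef Δ * w (map pt (points (suc m) Δ)))) (subsets (suc m))) ∎
      where
      j : ℕ
      j = suc m
      w⁻ w⁺ : Form
      w⁻ ys = w (ys ∷ʳ pt (M- j))
      w⁺ ys = w (ys ∷ʳ pt (M+ j))
      alt⁻ : Alternating w⁻
      alt⁻ = fix-last alt (pt (M- j))
      alt⁺ : Alternating w⁺
      alt⁺ = fix-last alt (pt (M+ j))
      S⁺ : Carrier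
      S⁺ = sumR (map (λ Δ → ι (sum Δ) * (coef Δ * w⁺ (map pt (points m Δ)))) (subsets m))

      after-snoc : ∀ i → i N.< m → after columns (suc m) i ≡ after columns m i ∷ʳ columns m
      after-snoc i i<m = ≡.trans (≡.cong (applyUpTo (λ k → columns (suc i N.+ k))) (ℕₚ.+-∸-assoc 1 i<m))
        (≡.trans (≡.sym (Lₚ.applyUpTo-∷ʳ (λ k → columns (suc i N.+ k)) (m ∸ suc i)))
          (≡.cong (λ k → after columns m i ∷ʳ columns k) (ℕₚ.m+[n∸m]≡n i<m)))

      earlier : ∀ i → i N.< m → replaced w columns (suc m) i (∂column (suc i))
        ≈ replaced w⁻ columns m i (∂column (suc i)) + - xp j * replaced w⁺ columns m i (∂column (suc i))
      earlier i i<m = trans (reflexive (≡.cong w (≡.trans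
          (≡.cong (λ ys → before columns m i ++ ∂column (suc i) ∷ ys) (after-snoc i i<m))
          (≡.sym (Lₚ.++-assoc (before columns m i) (∂column (suc i) ∷ after columns m i) [ columns m ])))))
        (split-column alt j (before columns m i ++ ∂column (suc i) ∷ after columns m i))

      last : replaced w columns (suc m) m (∂column (suc m)) ≈ - (ι j * xp j) * w⁺ (applyUpTo columns m)
      last = trans (reflexive (≡.cong (λ k → w (applyUpTo columns m ++ ∂column (suc m) ∷ applyUpTo (λ i → columns (suc m N.+ i)) k)) (ℕₚ.n∸n≡0 m)))
        (Alternating.scale alt (applyUpTo columns m) (- (ι j * xp j)) (pt (M+ j)) [])

    prodR-subset : ∀ m {Δ} → Δ ∈ subsets m → ∀ f → prodR (map f Δ) ≈ ∏ m (λ h → sel (member Δ (suc h)) (f (suc h)))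
    prodR-subset zero (here ≡.refl) f = refl
    prodR-subset (suc m) {Δ} Δ∈ f with ∈-++⁻ (subsets m) Δ∈
    ... | inj₁ p = begin
      prodR (map f Δ)
        ≈⟨ prodR-subset m p f ⟩
      ∏ m (λ h → sel (member Δ (suc h)) (f (suc h)))
        ≈⟨ *-identityʳ _ ⟨
      ∏ m (λ h → sel (member Δ (suc h)) (f (suc h))) * 1#
        ≡⟨ ≡.cong (λ b → ∏ m (λ h → sel (member Δ (suc h)) (f (suc h))) * sel b (f (suc m))) (member-top (subsets-bounded m p)) ⟨
      ∏ m (λ h → sel (member Δ (suc h)) (f (suc h))) * sel (member Δ (suc m)) (f (suc m))
        ≈⟨ ∏-last m (λ h → sel (member Δ (suc h)) (f (suc h))) ⟨
      ∏ (suc m) (λ h → sel (member Δ (suc h)) (f (suc h))) ∎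
    ... | inj₂ q with ∈-map⁻ (suc m ∷_) q
    ...   | Δ′ , p , ≡.refl = begin
      f (suc m) * prodR (map f Δ′)
        ≈⟨ trans (*-comm _ _) (*-congʳ (prodR-subset m p f)) ⟩
      ∏ m (λ h → sel (member Δ′ (suc h)) (f (suc h))) * f (suc m)
        ≈⟨ *-cong (∏-cong< m (λ h h<m → reflexive (≡.cong (λ b → sel b (f (suc h))) (≡.sym (member-tail Δ′ (ℕₚ.<⇒≢ (s≤s h<m)))))))
             (reflexive (≡.cong (λ b → sel b (f (suc m))) (≡.sym (member-head (suc m) Δ′)))) ⟩
      ∏ m (λ h → sel (member Δ (suc h)) (f (suc h))) * sel (member Δ (suc m)) (f (suc m))
        ≈⟨ ∏-last m (λ h → sel (member Δ (suc h)) (f (suc h))) ⟨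
      ∏ (suc m) (λ h → sel (member Δ (suc h)) (f (suc h))) ∎

  hookProduct : List ℕ → Carrier
  hookProduct Δ = prodR (map (hookFactor (ι t) Δ) Δ)

  private
    W₀ : Carrier
    W₀ = W t (map pt (applyUpTo (λ i → position false (suc i)) t))

    W₀-unit : Unit W₀
    W₀-unit = W-unit t _ (Lₚ.length-applyUpTo (λ i → position false (suc i)) t) V₀-unit

    W-points : ∀ {Δ} → Δ ∈ subsets t → W t (map pt (points t Δ)) ≈ hookProduct Δ * W₀
    W-points {Δ} Δ∈ = trans
      (W-ratio t (w (member Δ)) (points t Δ) (applyUpTo (λ i → position false (suc i)) t)
        (Lₚ.length-applyUpTo (λ i → position (member Δ (suc i)) (suc i)) t) (Lₚ.length-applyUpTo (λ i → position false (suc i)) t) (V-ratio (member Δ)))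
      (*-congʳ (sym (prodR-subset t Δ∈ (hookFactor (ι t) Δ))))

    factor-W₀ : ∀ (g : List ℕ → Carrier) →
      sumR (map (λ Δ → g Δ * (coef Δ * W t (map pt (points t Δ)))) (subsets t))
        ≈ W₀ * sumR (map (λ Δ → g Δ * (coef Δ * hookProduct Δ)) (subsets t))
    factor-W₀ g = trans (sumR-cong (subsets t) (λ {Δ} Δ∈ → trans (*-congˡ (*-congˡ (W-points Δ∈)))
        (solve 4 (λ g c h w → g :* (c :* (h :* w)) := w :* (g :* (c :* h))) refl (g Δ) (coef Δ) (hookProduct Δ) W₀)))
      (sumR-*ˡ (subsets t) W₀ (λ Δ → g Δ * (coef Δ * hookProduct Δ)))

  hookSum-ode : sumR (map (λ Δ → ι (sum Δ) * (coef Δ * hookProduct Δ)) (subsets t))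
    ≈ - ((ι 2 * ι t * ι t + ι t) * S₁) * sumR (map (λ Δ → 1# * (coef Δ * hookProduct Δ)) (subsets t))
  hookSum-ode = cancel W₀-unit (begin
    W₀ * sumR (map (λ Δ → ι (sum Δ) * (coef Δ * hookProduct Δ)) (subsets t))
      ≈⟨ factor-W₀ (ι ∘ sum) ⟨
    sumR (map (λ Δ → ι (sum Δ) * (coef Δ * W t (map pt (points t Δ)))) (subsets t))
      ≈⟨ ∂expand (W-alternating t) t ⟨
    ∂E
      ≈⟨ E-ode ⟩
    - (C * S₁) * E
      ≈⟨ *-congˡ (trans (expand (W-alternating t) t) (factor-W₀ (λ _ → 1#))) ⟩
    - (C * S₁) * (W₀ * sumR (map (λ Δ → 1# * (coef Δ * hookProduct Δ)) (subsets t)))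
      ≈⟨ solve 3 (λ a w s → a :* (w :* s) := w :* (a :* s)) refl _ _ _ ⟩
    W₀ * (- (C * S₁) * sumR (map (λ Δ → 1# * (coef Δ * hookProduct Δ)) (subsets t))) ∎)
    where
    C : Carrier
    C = ι 2 * ι t * ι t + ι t

-- Comparison of coefficients at natural values of t.

module Coefficients {c ℓ} (R : CommutativeRing c ℓ) (inv : ℕ → CommutativeRing.Carrier R)
  (inv-suc : Reciprocals R inv) where
  open Kit R inv
  open Units R inv inv-suc
  open PowerSeries R inv
  open ExpODE R inv inv-suc
  open SumR R inv
  open Relation.Binary.Reasoning.Setoid setoid

  hookWeight : Carrier → List ℕ → Carrier
  hookWeight T Δ = sign (length Δ) * prodR (map (hookFactor T Δ) Δ)

  module _ (n t′ : ℕ) (3n≤t : n N.+ (n N.+ n) N.≤ suc t′) where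
    private
      module S where
        open Kit (truncated n) (const ∘ inv) public

      t : ℕ
      t = suc t′

      const-cong : ∀ {a b} → a ≈ b → const a ≋ const b
      const-cong e zero = e
      const-cong e (suc _) = refl

      infix 4 _≈ᶜ_
      -- The hook products are formed inside the ring of truncated series although they are scalars;
      -- this relation carries them back to `R`, one ring operation at a time.
      _≈ᶜ_ : Series → Carrier → Set ℓ
      f ≈ᶜ a = f S.≈ const a

      +ᶜ : ∀ {f g a b} → f ≈ᶜ a → g ≈ᶜ b → f S.+ g ≈ᶜ a + b
      +ᶜ p q = S.trans (S.+-cong p q) (λ { zero _ → refl ; (suc _) _ → +-identityˡ 0# })

      -ᶜ : ∀ {f a} → f ≈ᶜ a → S.- f ≈ᶜ - a
      -ᶜ p = S.trans (S.-‿cong p) (λ { zero _ → refl ; (suc _) _ → -0#≈0# })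

      *ᶜ : ∀ {f g a b} → f ≈ᶜ a → g ≈ᶜ b → f S.* g ≈ᶜ a * b
      *ᶜ {a = a} {b} p q = S.trans (S.*-cong p q) (λ i _ → trans (const-⊛ a (const b) i) (scaled i))
        where
        scaled : ∀ i → a * const b i ≈ const (a * b) i
        scaled zero = refl
        scaled (suc _) = zeroʳ a

      1ᶜ : S.1# ≈ᶜ 1#
      1ᶜ = S.refl

      0ᶜ : S.0# ≈ᶜ 0#
      0ᶜ zero _ = refl
      0ᶜ (suc _) _ = refl

      ιᶜ : ∀ k → S.ι k ≈ᶜ ι k
      ιᶜ zero = 0ᶜ
      ιᶜ (suc k) = +ᶜ 1ᶜ (ιᶜ k)

      powᶜ : ∀ {f a} k → f ≈ᶜ a → S.powR f k ≈ᶜ powR a k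
      powᶜ zero p = 1ᶜ
      powᶜ (suc k) p = *ᶜ p (powᶜ k p)

      prodᶜ : ∀ {f : ℕ → Series} {g} xs → (∀ k → f k ≈ᶜ g k) → S.prodR (map f xs) ≈ᶜ prodR (map g xs)
      prodᶜ [] p = 1ᶜ
      prodᶜ (x ∷ xs) p = *ᶜ (p x) (prodᶜ xs p)

      hookFactorᶜ : ∀ Δ h → S.hookFactor (S.ι t) Δ h ≈ᶜ hookFactor (ι t) Δ h
      hookFactorᶜ Δ h = *ᶜ
        (*ᶜ (+ᶜ 1ᶜ (-ᶜ (*ᶜ N S.refl))) (+ᶜ 1ᶜ (-ᶜ (*ᶜ (+ᶜ (ιᶜ t) 1ᶜ) S.refl))))
        (prodᶜ (oneTo (h ∸ 1)) (λ j → +ᶜ 1ᶜ (-ᶜ (powᶜ 2 (*ᶜ N S.refl)))))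
        where
        N : S.ι 2 S.* S.ι t S.+ S.ι 2 ≈ᶜ ι 2 * ι t + ι 2
        N = +ᶜ (*ᶜ (ιᶜ 2) (ιᶜ t)) (ιᶜ 2)

      powR-X : ∀ m → S.powR X m ≡ X^ m
      powR-X zero = ≡.refl
      powR-X (suc m) = ≡.cong (X ⊛_) (powR-X m)

      X-nilpotent : ∀ j → n N.< j → S.powR X j S.≈ S.0#
      X-nilpotent j n<j i i≤n = trans (reflexive (≡.cong (λ f → f i) (powR-X j)))
        (X^-off j i (λ e → ℕₚ.<⇒≢ (ℕₚ.≤-<-trans i≤n n<j) (≡.sym e)))

      inv-sucˢ : ∀ k → S.ι (suc k) S.* const (inv (suc k)) S.≈ S.1#
      inv-sucˢ k = S.trans (*ᶜ (ιᶜ (suc k)) S.refl) (λ i _ → const-cong (inv-suc k) i)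

      open module Ex = Expansion (truncated n) (const ∘ inv) inv-sucˢ X n X-nilpotent t′ 3n≤t
        using (coef; hookProduct; hookSum-ode)

      wt : List ℕ → Carrier
      wt = hookWeight (ι t)

      summand : ∀ Δ i → i N.≤ n → (coef Δ S.* hookProduct Δ) i ≈ (X^ sum Δ) i * wt Δ
      summand Δ i i≤n = begin
        (coef Δ S.* hookProduct Δ) i
          ≈⟨ (S.trans (S.*-congʳ {hookProduct Δ} (S.*-comm (S.sign (length Δ)) (S.powR X (sum Δ)))) (S.*-assoc (S.powR X (sum Δ)) (S.sign (length Δ)) (hookProduct Δ))) i i≤n ⟩
        (S.powR X (sum Δ) S.* (S.sign (length Δ) S.* hookProduct Δ)) i
          ≈⟨ S.*-cong (S.≡⇒≈ (powR-X (sum Δ))) (*ᶜ (powᶜ (length Δ) (-ᶜ 1ᶜ)) (prodᶜ Δ (hookFactorᶜ Δ))) i i≤n ⟩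
        (X^ sum Δ ⊛ const (wt Δ)) i
          ≈⟨ trans (⊛-comm (X^ sum Δ) (const (wt Δ)) i) (const-⊛ (wt Δ) (X^ sum Δ) i) ⟩
        wt Δ * (X^ sum Δ) i
          ≈⟨ *-comm _ _ ⟩
        (X^ sum Δ) i * wt Δ ∎

      F : Series
      F i = sumR (map (λ Δ → (X^ sum Δ) i * wt Δ) (subsets t))

      sumR-at : (xs : List (List ℕ)) (f : List ℕ → Series) → ∀ i → S.sumR (map f xs) i ≡ sumR (map (λ Δ → f Δ i) xs)
      sumR-at [] f i = ≡.refl
      sumR-at (Δ ∷ xs) f i = ≡.cong (f Δ i +_) (sumR-at xs f i)

      ∑-at : ∀ m (f : ℕ → Series) i → S.∑ m f i ≡ ∑ m (λ k → f k i)
      ∑-at zero f i = ≡.refl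
      ∑-at (suc m) f i = ≡.cong (f 0 i +_) (∑-at m (f ∘ suc) i)

      F-value : S.sumR (map (λ Δ → S.1# S.* (coef Δ S.* hookProduct Δ)) (subsets t)) S.≈ F
      F-value i i≤n = trans (reflexive (sumR-at (subsets t) _ i))
        (sumR-cong (subsets t) (λ {Δ} _ → trans (S.*-identityˡ (coef Δ S.* hookProduct Δ) i i≤n) (summand Δ i i≤n)))

      θF-value : ∀ i → i N.≤ n → S.sumR (map (λ Δ → S.ι (sum Δ) S.* (coef Δ S.* hookProduct Δ)) (subsets t)) i ≈ θ F i
      θF-value i i≤n = trans (reflexive (sumR-at (subsets t) _ i))
        (trans (sumR-cong (subsets t) (λ {Δ} _ → trans
            (trans (S.*-congʳ {coef Δ S.* hookProduct Δ} (ιᶜ (sum Δ)) i i≤n) (const-⊛ (ι (sum Δ)) (coef Δ S.* hookProduct Δ) i))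
            (trans (*-congˡ (summand Δ i i≤n)) (weigh Δ))))
          (sumR-*ˡ (subsets t) (ι i) (λ Δ → (X^ sum Δ) i * wt Δ)))
        where
        weigh : ∀ Δ → ι (sum Δ) * ((X^ sum Δ) i * wt Δ) ≈ ι i * ((X^ sum Δ) i * wt Δ)
        weigh Δ with sum Δ N.≟ i
        ... | yes e = *-congʳ (reflexive (≡.cong ι e))
        ... | no ne = trans (*-congˡ vanish) (trans (zeroʳ _) (sym (trans (*-congˡ vanish) (zeroʳ _))))
          where
          vanish : (X^ sum Δ) i * wt Δ ≈ 0#
          vanish = trans (*-congʳ (X^-off (sum Δ) i ne)) (zeroˡ _)

      C : Carrier
      C = ι 2 * ι t * ι t + ι t

      A : Series
      A i = - (C * divisorSum n i)

      scaled-at : ∀ {a} {f} g → f ≈ᶜ a → ∀ i → i N.≤ n → (f S.* g) i ≈ a * g i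
      scaled-at {a} g p i i≤n = trans (S.*-congʳ {g} p i i≤n) (const-⊛ a g i)

      A-value : S.- ((S.ι 2 S.* S.ι t S.* S.ι t S.+ S.ι t) S.* Ex.Det.S₁) S.≈ A
      A-value i i≤n = -‿cong (trans
        (scaled-at Ex.Det.S₁ (+ᶜ (*ᶜ (*ᶜ (ιᶜ 2) (ιᶜ t)) (ιᶜ t)) (ιᶜ t)) i i≤n)
        (*-congˡ (trans (reflexive (∑-at n (λ k → S.ι (suc k) S.* Ex.Det.G (suc k)) i)) (∑-cong n (λ k → trans
          (scaled-at (Ex.Det.G (suc k)) (ιᶜ (suc k)) i i≤n)
          (trans (*-congˡ (trans (reflexive (∑-at n (λ r → S.powR X (suc k N.* suc r)) i))
              (∑-cong n (λ r → reflexive (≡.cong (λ f → f i) (powR-X (suc k N.* suc r)))))))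
            (sym (∑-*ˡ n (ι (suc k)) (λ r → (X^ (suc k N.* suc r)) i)))))))))

      F-ode : ∀ i → i N.≤ n → θ F i ≈ (A ⊛ F) i
      F-ode i i≤n = trans (sym (θF-value i i≤n)) (S.trans hookSum-ode (S.*-cong A-value F-value) i i≤n)

      F₀ : ∀ m → sumR (map (λ Δ → (X^ sum Δ) 0 * wt Δ) (subsets m)) ≈ 1#
      F₀ zero = solve 0 (K 1 :* (K 1 :* K 1) :+ K 0 := K 1) refl
      F₀ (suc m) = begin
        sumR (map f (subsets m ++ map (suc m ∷_) (subsets m)))
          ≈⟨ sumR-++ (subsets m) _ f ⟩
        sumR (map f (subsets m)) + sumR (map f (map (suc m ∷_) (subsets m)))
          ≈⟨ +-cong (F₀ m) (trans (reflexive (sumR-map (suc m ∷_) (subsets m) f)) (vanish (subsets m))) ⟩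
        1# + 0#
          ≈⟨ +-identityʳ 1# ⟩
        1# ∎
        where
        f : List ℕ → Carrier
        f Δ = (X^ sum Δ) 0 * wt Δ
        vanish : ∀ xs → sumR (map (f ∘ (suc m ∷_)) xs) ≈ 0#
        vanish [] = refl
        vanish (Δ ∷ xs) = trans (+-cong (trans (*-congʳ (X^-off (sum (suc m ∷ Δ)) 0 (λ ()))) (zeroˡ _)) (vanish xs)) (+-identityˡ 0#)

      G : Series
      G i = - ((ι 2 * ι t * ι t + ι t) * Lser i)

      G₀ : G 0 ≈ 0#
      G₀ = trans (-‿cong (zeroʳ _)) -0#≈0#

      lhs-ode : ∀ i → i N.≤ n → θ (lhs (ι t)) i ≈ (A ⊛ lhs (ι t)) i
      lhs-ode i i≤n = trans (expS-ode G G₀ i) (⊛-cong≤ {g = expS G} i θG (λ _ _ → refl))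
        where
        θG : ∀ k → k N.≤ i → θ G k ≈ A k
        θG k k≤i = trans (solve 3 (λ k C l → k :* :- (C :* l) := :- (C :* (k :* l))) refl (ι k) C (Lser k))
          (-‿cong (*-congˡ (θ-Lser n k (ℕₚ.≤-trans k≤i i≤n))))

      lhs₀ : lhs (ι t) 0 ≈ 1#
      lhs₀ = trans (solve 1 (λ i → i :* K 1 :+ K 0 := (K 1 :+ K 0) :* i) refl (inv 1)) (inv-suc 0)

      A₀ : A 0 ≈ 0#
      A₀ = trans (-‿cong (trans (*-congˡ (trans (sym (θ-Lser n 0 z≤n)) (zeroˡ _))) (zeroʳ C))) -0#≈0#

    -- Both series have constant term 1 and satisfy the same equation up to degree n. The degree n
    -- of the coefficient sought is also the order of truncation, so the lower bound on t depends on
    -- n.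
    lhs-natural : lhs (ι t) n ≈ sumR (map (λ Δ → (X^ sum Δ) n * wt Δ) (subsets t))
    lhs-natural = ode-unique n A (lhs (ι t)) F A₀ (trans lhs₀ (sym (F₀ t))) lhs-ode F-ode n ℕₚ.≤-refl

-- Polynomial functions over a ring containing the rationals.

module Poly {c ℓ} (R : CommutativeRing c ℓ) (inv : ℕ → CommutativeRing.Carrier R)
  (inv-suc : Reciprocals R inv) where
  open Kit R inv
  open Units R inv inv-suc
  open Relation.Binary.Reasoning.Setoid setoid

  -- Degree< d allows d coefficients, so Degree< 0 is the zero function.
  Degree<_ : ℕ → (Carrier → Carrier) → Set (c ⊔ ℓ)
  (Degree< zero) f = Lift c (∀ t → f t ≈ 0#)
  (Degree< suc d) f = Σ[ a ∈ Carrier ] Σ[ g ∈ (Carrier → Carrier) ] (Degree< d) g × (∀ t → f t ≈ a + t * g t)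

  IsPolynomial : (Carrier → Carrier) → Set (c ⊔ ℓ)
  IsPolynomial f = Σ[ d ∈ ℕ ] (Degree< d) f

  degree-cong : ∀ d {f g} → (∀ t → f t ≈ g t) → (Degree< d) f → (Degree< d) g
  degree-cong zero e (lift z) = lift (λ t → trans (sym (e t)) (z t))
  degree-cong (suc d) e (a , h , dh , f≈) = a , h , dh , λ t → trans (sym (e t)) (f≈ t)

  degree-suc : ∀ d {f} → (Degree< d) f → (Degree< suc d) f
  degree-suc zero {f} (lift z) = 0# , (λ _ → 0#) , lift (λ _ → refl) ,
    λ t → trans (z t) (solve 1 (λ t → K 0 := K 0 :+ t :* K 0) refl t)
  degree-suc (suc d) (a , g , dg , e) = a , g , degree-suc d dg , e

  degree-+ : ∀ d {f g} → (Degree< d) f → (Degree< d) g → (Degree< d) (λ t → f t + g t)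
  degree-+ zero (lift p) (lift q) = lift (λ t → trans (+-cong (p t) (q t)) (+-identityˡ 0#))
  degree-+ (suc d) (a , g , dg , e) (b , h , dh , e′) = a + b , (λ t → g t + h t) , degree-+ d dg dh ,
    λ t → trans (+-cong (e t) (e′ t)) (solve 5 (λ a b t g h → a :+ t :* g :+ (b :+ t :* h) := a :+ b :+ t :* (g :+ h)) refl a b t (g t) (h t))

  degree-scale : ∀ d b {f} → (Degree< d) f → (Degree< d) (λ t → b * f t)
  degree-scale zero b (lift z) = lift (λ t → trans (*-congˡ (z t)) (zeroʳ b))
  degree-scale (suc d) b (a , g , dg , e) = b * a , (λ t → b * g t) , degree-scale d b dg ,
    λ t → trans (*-congˡ (e t)) (solve 4 (λ b a t g → b :* (a :+ t :* g) := b :* a :+ t :* (b :* g)) refl b a t (g t))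

  degree-+k : ∀ k d {f} → (Degree< d) f → (Degree< (k N.+ d)) f
  degree-+k zero d p = p
  degree-+k (suc k) d p = degree-suc (k N.+ d) (degree-+k k d p)

  degree-* : ∀ d e {f g} → (Degree< d) f → (Degree< e) g → (Degree< (d N.+ e)) (λ t → f t * g t)
  degree-* zero e {f} {g} (lift z) q = degree-cong e (λ t → trans (zeroˡ (g t)) (sym (trans (*-congʳ (z t)) (zeroˡ (g t))))) (degree-scale e 0# q)
  degree-* (suc d) e {f} {g} (a , h , dh , f≈) q = degree-cong (suc (d N.+ e))
    (λ t → sym (trans (*-congʳ (f≈ t)) (solve 4 (λ a t h g → (a :+ t :* h) :* g := a :* g :+ (K 0 :+ t :* (h :* g))) refl a t (h t) (g t))))
    (degree-+ (suc (d N.+ e)) (degree-scale (suc (d N.+ e)) a (degree-+k (suc d) e q))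
      (0# , (λ t → h t * g t) , degree-* d e dh q , λ t → refl))

  -- Synthetic division: t g(t) = (t - a) g(t) + a g(t), and the last summand is divided by the
  -- induction hypothesis.
  divide : ∀ d {f} a → (Degree< suc d) f → Σ[ q ∈ (Carrier → Carrier) ] (Degree< d) q × (∀ t → f t ≈ f a + (t - a) * q t)
  divide zero a (b , g , lift z , e) = (λ _ → 0#) , lift (λ _ → refl) , λ t →
    trans (trans (e t) (+-congˡ (*-congˡ (z t)))) (trans (solve 3 (λ b t a → b :+ t :* K 0 := b :+ a :* K 0 :+ (t :- a) :* K 0) refl b t a)
      (+-congʳ (sym (trans (e a) (+-congˡ (*-congˡ (z a)))))))
  divide (suc d) a (b , g , dg , e) with divide d a dg
  ... | q , dq , g≈ = (λ t → g t + a * q t) , degree-+ (suc d) dg (degree-suc d (degree-scale d a dq)) , λ t → begin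
    _ ≈⟨ e t ⟩
    b + t * g t
      ≈⟨ solve 4 (λ b t a g → b :+ t :* g := b :+ (t :- a) :* g :+ a :* g) refl b t a (g t) ⟩
    b + (t - a) * g t + a * g t
      ≈⟨ +-congˡ (*-congˡ (g≈ t)) ⟩
    b + (t - a) * g t + a * (g a + (t - a) * q t)
      ≈⟨ solve 6 (λ b t a g h q → b :+ (t :- a) :* g :+ a :* (h :+ (t :- a) :* q) := (b :+ a :* h) :+ (t :- a) :* (g :+ a :* q)) refl b t a (g t) (g a) (q t) ⟩
    (b + a * g a) + (t - a) * (g t + a * q t)
      ≈⟨ +-congʳ (e a) ⟨
    _ ∎

  -- The ring may have zero divisors, so roots cannot be counted as in a field. Roots at distinct
  -- natural numbers can still be split off one by one, because their differences are units.
  degree-vanishes : ∀ d {f} m → (Degree< d) f → (∀ k → m N.≤ k → f (ι k) ≈ 0#) → ∀ t → f t ≈ 0#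
  degree-vanishes zero m (lift z) _ = z
  degree-vanishes (suc d) {f} m df roots t with divide d (ι m) df
  ... | q , dq , f≈ = begin
    f t                                  ≈⟨ f≈ t ⟩
    f (ι m) + (t - ι m) * q t    ≈⟨ +-cong (roots m ℕₚ.≤-refl) (*-congˡ (degree-vanishes d (suc m) dq roots′ t)) ⟩
    0# + (t - ι m) * 0#              ≈⟨ trans (+-identityˡ _) (zeroʳ _) ⟩
    0#                                   ∎
    where
    roots′ : ∀ k → m N.< k → q (ι k) ≈ 0#
    roots′ k m<k = ι-cancel (ℕₚ.m<n⇒0<n∸m m<k) (begin
      ι (k ∸ m) * q (ι k)                        ≈⟨ *-congʳ (ι-∸ (ℕₚ.<⇒≤ m<k)) ⟩
      (ι k - ι m) * q (ι k)                  ≈⟨ trans (sym (+-identityˡ _)) (+-congʳ (sym (roots m ℕₚ.≤-refl))) ⟩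
      f (ι m) + (ι k - ι m) * q (ι k)    ≈⟨ f≈ (ι k) ⟨
      f (ι k)                                        ≈⟨ roots k (ℕₚ.<⇒≤ m<k) ⟩
      0#                                                 ≈⟨ zeroʳ _ ⟨
      ι (k ∸ m) * 0#                                 ∎)

  polynomial-unique : ∀ {f g} → IsPolynomial f → IsPolynomial g → ∀ m →
    (∀ k → m N.≤ k → f (ι k) ≈ g (ι k)) → ∀ t → f t ≈ g t
  polynomial-unique {f} {g} (d , df) (e , dg) m agree t = begin
    f t                  ≈⟨ solve 2 (λ f g → f := (f :+ (:- K 1) :* g) :+ g) refl (f t) (g t) ⟩
    (f t + - 1# * g t) + g t
      ≈⟨ +-congʳ (degree-vanishes (e N.+ d) m
           (degree-+ (e N.+ d) (degree-+k e d df) (degree-scale (e N.+ d) (- 1#)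
             (≡.subst (λ k → (Degree< k) g) (ℕₚ.+-comm d e) (degree-+k d e dg))))
           (λ k m≤k → trans (+-congʳ (agree k m≤k)) (solve 1 (λ g → g :+ (:- K 1) :* g := K 0) refl (g (ι k)))) t) ⟩
    0# + g t             ≈⟨ +-identityˡ _ ⟩
    g t                  ∎

  poly-const : ∀ a → IsPolynomial (λ _ → a)
  poly-const a = 1 , a , (λ _ → 0#) , lift (λ _ → refl) , λ t → solve 2 (λ a t → a := a :+ t :* K 0) refl a t

  poly-id : IsPolynomial (λ t → t)
  poly-id = 2 , 0# , (λ _ → 1#) , (1# , (λ _ → 0#) , lift (λ _ → refl) , λ t → solve 1 (λ t → K 1 := K 1 :+ t :* K 0) refl t)
    , λ t → solve 1 (λ t → t := K 0 :+ t :* K 1) refl t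

  poly-+ : ∀ {f g} → IsPolynomial f → IsPolynomial g → IsPolynomial (λ t → f t + g t)
  poly-+ {f} {g} (d , df) (e , dg) = e N.+ d , degree-+ (e N.+ d) (degree-+k e d df)
    (≡.subst (λ k → (Degree< k) g) (ℕₚ.+-comm d e) (degree-+k d e dg))

  poly-* : ∀ {f g} → IsPolynomial f → IsPolynomial g → IsPolynomial (λ t → f t * g t)
  poly-* (d , df) (e , dg) = d N.+ e , degree-* d e df dg

  poly-neg : ∀ {f} → IsPolynomial f → IsPolynomial (λ t → - f t)
  poly-neg (d , df) = d , degree-cong d (λ t → solve 1 (λ a → (:- K 1) :* a := :- a) refl _) (degree-scale d (- 1#) df)

  poly-pow : ∀ {f} k → IsPolynomial f → IsPolynomial (λ t → powR (f t) k)
  poly-pow zero p = poly-const 1#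
  poly-pow (suc k) p = poly-* p (poly-pow k p)

  poly-sum : ∀ {A : Set} (xs : List A) {f : Carrier → A → Carrier} → (∀ a → IsPolynomial (λ t → f t a)) → IsPolynomial (λ t → sumR (map (f t) xs))
  poly-sum [] p = poly-const 0#
  poly-sum (a ∷ xs) p = poly-+ (p a) (poly-sum xs p)

  poly-prod : ∀ {A : Set} (xs : List A) {f : Carrier → A → Carrier} → (∀ a → IsPolynomial (λ t → f t a)) → IsPolynomial (λ t → prodR (map (f t) xs))
  poly-prod [] p = poly-const 1#
  poly-prod (a ∷ xs) p = poly-* (p a) (poly-prod xs p)

  poly-powS : ∀ {G : Carrier → Series} → (∀ n → IsPolynomial (λ t → G t n)) → ∀ m n → IsPolynomial (λ t → powS (G t) m n)
  poly-powS p zero n = poly-const (oneS n)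
  poly-powS p (suc m) n = poly-sum (upTo (suc n)) (λ i → poly-* (p i) (poly-powS p m (n ∸ i)))

  poly-lhs : ∀ n → IsPolynomial (λ t → lhs t n)
  poly-lhs n = poly-sum (upTo (suc n)) (λ m → poly-* (poly-const (inv (m !)))
    (poly-powS (λ k → poly-neg (poly-* (poly-+ (poly-* (poly-* (poly-const (ι 2)) poly-id) poly-id) poly-id) (poly-const (Lser k)))) m n))

  poly-hookFactor : ∀ Δ h → IsPolynomial (λ t → hookFactor t Δ h)
  poly-hookFactor Δ h = poly-*
    (poly-* (1-_ (poly-* N (poly-const (inv h)))) (1-_ (poly-* (poly-+ poly-id (poly-const 1#)) (poly-const (inv h)))))
    (poly-prod (oneTo (h ∸ 1)) (λ j → 1-_ (poly-pow 2 (poly-* N (poly-const (inv (shift Δ h j)))))))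
    where
    N : IsPolynomial (λ t → ι 2 * t + ι 2)
    N = poly-+ (poly-* (poly-const (ι 2)) poly-id) (poly-const (ι 2))
    1-_ : ∀ {f} → IsPolynomial f → IsPolynomial (λ t → 1# - f t)
    1- p = poly-+ (poly-const 1#) (poly-neg p)

  poly-term : ∀ p → IsPolynomial (λ t → term t p)
  poly-term (λ′ , μ) = poly-* (poly-const _) (poly-prod (Δset λ′ μ) (poly-hookFactor (Δset λ′ μ)))

-- Partitions assembled from their principal hooks.

module Partitions where
  open N using (_+_; _≤_; _<_; _≥_; _>_; _≤?_)
  open ≡ using (refl; sym; trans; cong; cong₂; subst; module ≡-Reasoning)
  open import Data.Nat.ListAction.Properties using (sum-++)
  open import Data.List using (replicate)
  open import Data.List.Membership.Propositional.Properties using (∈-applyUpTo⁻)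
  open All using (All; []; _∷_)
  open import Data.List.Relation.Unary.Linked as Linked using (Linked; []; [-]; _∷_)
  open import Relation.Unary using (Decidable)

  -- The partition obtained from ν by adding a new first row of length x and a new first column of
  -- length 1 + length ν + k.
  wrap : ℕ → ℕ → List ℕ → List ℕ
  wrap x k ν = x ∷ map suc ν ++ replicate k 1

  rest : ℕ → List ℕ → List ℕ
  rest k ν = map suc ν ++ replicate k 1

  length-rest : ∀ k ν → length (rest k ν) ≡ length ν + k
  length-rest k ν = trans (Lₚ.length-++ (map suc ν)) (cong₂ _+_ (Lₚ.length-map suc ν) (Lₚ.length-replicate k))

  idx-beyond : ∀ xs {j} → length xs ≤ j → idx xs j ≡ 0
  idx-beyond [] _ = refl
  idx-beyond (x ∷ xs) (s≤s p) = idx-beyond xs p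

  idx-rest-low : ∀ k ν {j} → j < length ν → idx (rest k ν) j ≡ suc (idx ν j)
  idx-rest-low k (y ∷ ν) {zero} _ = refl
  idx-rest-low k (y ∷ ν) {suc j} (s≤s p) = idx-rest-low k ν p

  idx-rest-mid : ∀ k ν {j} → length ν ≤ j → j < length ν + k → idx (rest k ν) j ≡ 1
  idx-rest-mid (suc k) [] {zero} _ _ = refl
  idx-rest-mid (suc k) [] {suc j} _ (s≤s p) = idx-rest-mid k [] z≤n p
  idx-rest-mid k (y ∷ ν) (s≤s p) (s≤s q) = idx-rest-mid k ν p q

  idx-rest-high : ∀ k ν {j} → length ν + k ≤ j → idx (rest k ν) j ≡ 0
  idx-rest-high k ν p = idx-beyond (rest k ν) (subst (_≤ _) (sym (length-rest k ν)) p)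

  idx-rest-≤1 : ∀ k ν {j} → length ν ≤ j → idx (rest k ν) j ≤ 1
  idx-rest-≤1 k ν {j} p with ℕₚ.<-≤-connex j (length ν + k)
  ... | inj₁ q = ℕₚ.≤-reflexive (idx-rest-mid k ν p q)
  ... | inj₂ q = ℕₚ.≤-trans (ℕₚ.≤-reflexive (idx-rest-high k ν q)) z≤n

  count : ℕ → List ℕ → ℕ
  count j xs = length (filter (j ≤?_) xs)

  count-∷-yes : ∀ j x xs → j ≤ x → count j (x ∷ xs) ≡ suc (count j xs)
  count-∷-yes j x xs p = cong length (Lₚ.filter-accept (j ≤?_) {x} {xs} p)

  count-∷-no : ∀ j x xs → ¬ (j ≤ x) → count j (x ∷ xs) ≡ count j xs
  count-∷-no j x xs p = cong length (Lₚ.filter-reject (j ≤?_) {x} {xs} p)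

  count-rest : ∀ k ν j → count (suc (suc j)) (rest k ν) ≡ count (suc j) ν
  count-rest zero [] j = refl
  count-rest (suc k) [] j = trans (count-∷-no (suc (suc j)) 1 (replicate k 1) (λ { (s≤s ()) })) (count-rest k [] j)
  count-rest k (y ∷ ν) j with suc j ≤? y
  ... | yes p = trans (count-∷-yes (suc (suc j)) (suc y) (rest k ν) (s≤s p)) (trans (cong suc (count-rest k ν j)) (sym (count-∷-yes (suc j) y ν p)))
  ... | no ¬p = trans (count-∷-no (suc (suc j)) (suc y) (rest k ν) (¬p ∘ ℕₚ.≤-pred)) (trans (count-rest k ν j) (sym (count-∷-no (suc j) y ν ¬p)))

  count-1-rest : ∀ k ν → count 1 (rest k ν) ≡ length ν + k
  count-1-rest zero [] = refl
  count-1-rest (suc k) [] = cong suc (count-1-rest k [])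
  count-1-rest k (y ∷ ν) = cong suc (count-1-rest k ν)

  conj-wrap-1 : ∀ {x} k ν → 1 ≤ x → conjPart (wrap x k ν) 1 ≡ suc (length ν + k)
  conj-wrap-1 {x} k ν p = trans (count-∷-yes 1 x (rest k ν) p) (cong suc (count-1-rest k ν))

  conj-wrap-yes : ∀ {x} k ν {j} → suc (suc j) ≤ x → conjPart (wrap x k ν) (suc (suc j)) ≡ suc (conjPart ν (suc j))
  conj-wrap-yes {x} k ν {j} p = trans (count-∷-yes (suc (suc j)) x (rest k ν) p) (cong suc (count-rest k ν j))

  conj-wrap-no : ∀ {x} k ν {j} → ¬ (suc (suc j) ≤ x) → conjPart (wrap x k ν) (suc (suc j)) ≡ conjPart ν (suc j)
  conj-wrap-no {x} k ν {j} p = trans (count-∷-no (suc (suc j)) x (rest k ν) p) (count-rest k ν j)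

  filter-map : ∀ {P Q : ℕ → Set} (P? : Decidable P) (Q? : Decidable Q) (f : ℕ → ℕ) xs →
               (∀ {a} → a ∈ xs → P (f a) → Q a) → (∀ {a} → a ∈ xs → Q a → P (f a)) →
               filter P? (map f xs) ≡ map f (filter Q? xs)
  filter-map P? Q? f [] to from = refl
  filter-map P? Q? f (x ∷ xs) to from with Q? x
  ... | yes q = trans (Lₚ.filter-accept P? (from (here refl) q))
    (cong (f x ∷_) (filter-map P? Q? f xs (to ∘ there) (from ∘ there)))
  ... | no ¬q = trans (Lₚ.filter-reject P? (¬q ∘ to (here refl)))
    (filter-map P? Q? f xs (to ∘ there) (from ∘ there))

  oneTo-applyUpTo : ∀ n → oneTo n ≡ applyUpTo suc n
  oneTo-applyUpTo n = Lₚ.map-applyUpTo id suc n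

  oneTo-suc : ∀ n → oneTo (suc n) ≡ 1 ∷ map suc (oneTo n)
  oneTo-suc n = cong (1 ∷_) (trans (Lₚ.map-applyUpTo suc suc n)
    (sym (trans (cong (map suc) (oneTo-applyUpTo n)) (Lₚ.map-applyUpTo suc suc n))))

  oneTo-snoc : ∀ n → oneTo (suc n) ≡ oneTo n ∷ʳ suc n
  oneTo-snoc n = trans (oneTo-applyUpTo (suc n)) (trans (sym (Lₚ.applyUpTo-∷ʳ suc n)) (cong (_∷ʳ suc n) (sym (oneTo-applyUpTo n))))

  ∈-oneTo⁻ : ∀ n {a} → a ∈ oneTo n → 1 ≤ a
  ∈-oneTo⁻ n {a} a∈ with ∈-applyUpTo⁻ suc (subst (a ∈_) (oneTo-applyUpTo n) a∈)
  ... | i , _ , refl = s≤s z≤n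

  diagIdx-extend : ∀ ν k → filter (λ i → i ≤? part ν i) (oneTo (length ν + k)) ≡ diagIdx ν
  diagIdx-extend ν zero = cong (λ n → filter (λ i → i ≤? part ν i) (oneTo n)) (ℕₚ.+-identityʳ (length ν))
  diagIdx-extend ν (suc k) = begin
    filter P? (oneTo (length ν + suc k))               ≡⟨ cong (filter P? ∘ oneTo) (ℕₚ.+-suc (length ν) k) ⟩
    filter P? (oneTo (suc (length ν + k)))             ≡⟨ cong (filter P?) (oneTo-snoc (length ν + k)) ⟩
    filter P? (oneTo (length ν + k) ∷ʳ suc (length ν + k))
      ≡⟨ Lₚ.filter-++ P? (oneTo (length ν + k)) _ ⟩
    filter P? (oneTo (length ν + k)) ++ filter P? (suc (length ν + k) ∷ [])
      ≡⟨ cong₂ _++_ (diagIdx-extend ν k) (Lₚ.filter-reject P? beyond) ⟩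
    diagIdx ν ++ []                                    ≡⟨ Lₚ.++-identityʳ _ ⟩
    diagIdx ν                                          ∎
    where
    open ≡-Reasoning
    P? : Decidable (λ i → i ≤ part ν i)
    P? i = i ≤? part ν i
    beyond : ¬ (suc (length ν + k) ≤ part ν (suc (length ν + k)))
    beyond p = contradiction (ℕₚ.≤-trans p (ℕₚ.≤-reflexive (idx-beyond ν (ℕₚ.m≤m+n (length ν) k)))) λ ()

  diag-shift⁻ : ∀ x k ν j → suc (suc j) ≤ part (wrap x k ν) (suc (suc j)) → suc j ≤ part ν (suc j)
  diag-shift⁻ x k ν j p with ℕₚ.<-≤-connex j (length ν)
  ... | inj₁ q = ℕₚ.≤-pred (subst (suc (suc j) ≤_) (idx-rest-low k ν q) p)
  ... | inj₂ q = contradiction (ℕₚ.≤-trans p (idx-rest-≤1 k ν q)) λ { (s≤s ()) }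

  part-length : ∀ ν j → suc j ≤ part ν (suc j) → j < length ν
  part-length ν j p with ℕₚ.<-≤-connex j (length ν)
  ... | inj₁ q = q
  ... | inj₂ q = contradiction (ℕₚ.≤-trans p (ℕₚ.≤-reflexive (idx-beyond ν q))) λ ()

  diag-shift⁺ : ∀ x k ν j → suc j ≤ part ν (suc j) → suc (suc j) ≤ part (wrap x k ν) (suc (suc j))
  diag-shift⁺ x k ν j p = subst (suc (suc j) ≤_) (sym (idx-rest-low k ν (part-length ν j p))) (s≤s p)

  diagIdx-wrap : ∀ {x} k ν → 1 ≤ x → diagIdx (wrap x k ν) ≡ 1 ∷ map suc (diagIdx ν)
  diagIdx-wrap {x} k ν 1≤x = begin
    filter P? (oneTo (suc (length (rest k ν))))       ≡⟨ cong (λ n → filter P? (oneTo (suc n))) (length-rest k ν) ⟩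
    filter P? (oneTo (suc (length ν + k)))            ≡⟨ cong (filter P?) (oneTo-suc (length ν + k)) ⟩
    filter P? (1 ∷ map suc (oneTo (length ν + k)))    ≡⟨ Lₚ.filter-accept P? 1≤x ⟩
    1 ∷ filter P? (map suc (oneTo (length ν + k)))
      ≡⟨ cong (1 ∷_) (filter-map P? Q? suc (oneTo (length ν + k)) (λ a∈ → to (∈-oneTo⁻ _ a∈)) (λ a∈ → from (∈-oneTo⁻ _ a∈))) ⟩
    1 ∷ map suc (filter Q? (oneTo (length ν + k)))    ≡⟨ cong (λ xs → 1 ∷ map suc xs) (diagIdx-extend ν k) ⟩
    1 ∷ map suc (diagIdx ν)                           ∎
    where
    open ≡-Reasoning
    P? : Decidable (λ i → i ≤ part (wrap x k ν) i)
    P? i = i ≤? part (wrap x k ν) i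
    Q? : Decidable (λ i → i ≤ part ν i)
    Q? i = i ≤? part ν i
    to : ∀ {a} → 1 ≤ a → suc a ≤ part (wrap x k ν) (suc a) → a ≤ part ν a
    to {suc j} _ = diag-shift⁻ x k ν j
    from : ∀ {a} → 1 ≤ a → a ≤ part ν a → suc a ≤ part (wrap x k ν) (suc a)
    from {suc j} _ = diag-shift⁺ x k ν j

  D-wrap : ∀ {x} k ν → 1 ≤ x → D (wrap x k ν) ≡ suc (D ν)
  D-wrap k ν 1≤x = trans (cong length (diagIdx-wrap k ν 1≤x)) (cong suc (Lₚ.length-map suc (diagIdx ν)))

  idx-All : ∀ {P : ℕ → Set} {xs j} → All P xs → j < length xs → P (idx xs j)
  idx-All {j = zero} (p ∷ _) _ = p
  idx-All {j = suc j} (_ ∷ ps) (s≤s q) = idx-All ps q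

  -- A diagonal cell of ν moves one step along the diagonal, while its row and its column both grow
  -- by one, so its hook keeps its length. The bound on the parts of ν ensures that the new first
  -- row covers every column concerned.
  principalHooks-wrap : ∀ {x} k ν → 1 ≤ x → All (_< x) ν →
    principalHooks (wrap x k ν) ≡ (x + (length ν + k)) ∷ principalHooks ν
  principalHooks-wrap {x} k ν 1≤x bound = trans (cong (map (λ i → hook (wrap x k ν) i i)) (diagIdx-wrap k ν 1≤x))
    (cong₂ _∷_ corner (trans (sym (Lₚ.map-∘ (diagIdx ν))) (map-cong-∈ (diagIdx ν) inner)))
    where
    open ≡-Reasoning
    map-cong-∈ : ∀ {f g : ℕ → ℕ} xs → (∀ {a} → a ∈ xs → f a ≡ g a) → map f xs ≡ map g xs
    map-cong-∈ [] e = refl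
    map-cong-∈ (x ∷ xs) e = cong₂ _∷_ (e (here refl)) (map-cong-∈ xs (e ∘ there))
    corner : (x + conjPart (wrap x k ν) 1 + 1) ∸ 2 ≡ x + (length ν + k)
    corner = begin
      (x + conjPart (wrap x k ν) 1 + 1) ∸ 2   ≡⟨ cong (λ c → (x + c + 1) ∸ 2) (conj-wrap-1 k ν 1≤x) ⟩
      (x + suc (length ν + k) + 1) ∸ 2        ≡⟨ cong (λ c → (c + 1) ∸ 2) (ℕₚ.+-suc x (length ν + k)) ⟩
      (suc (x + (length ν + k)) + 1) ∸ 2      ≡⟨ cong (_∸ 2) (ℕₚ.+-comm (suc (x + (length ν + k))) 1) ⟩
      x + (length ν + k)                      ∎
    hook-shift : ∀ a b j → (suc a + suc b + 1) ∸ (suc (suc j) + suc (suc j)) ≡ (a + b + 1) ∸ (suc j + suc j)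
    hook-shift a b j = cong₂ _∸_ (cong (_+ 1) (cong suc (ℕₚ.+-suc a b))) (cong suc (ℕₚ.+-suc (suc j) (suc j)))
    inner : ∀ {a} → a ∈ diagIdx ν → hook (wrap x k ν) (suc a) (suc a) ≡ hook ν a a
    inner {a} a∈ with ∈-filter⁻ (λ i → i ≤? part ν i) {xs = oneTo (length ν)} a∈
    inner {zero} a∈ | p , _ = contradiction (∈-oneTo⁻ _ p) λ ()
    inner {suc j} a∈ | _ , q = trans
      (cong₂ (λ a b → (a + b + 1) ∸ (suc (suc j) + suc (suc j))) (idx-rest-low k ν j<)
        (conj-wrap-yes k ν (ℕₚ.≤-trans (s≤s q) (idx-All bound j<))))
      (hook-shift (idx ν j) (conjPart ν (suc j)) j)
      where
      j< : j < length ν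
      j< = part-length ν j q

  weight-wrap : ∀ x k ν → weight (wrap x k ν) ≡ x + (length ν + k) + weight ν
  weight-wrap x k ν = trans (cong (x +_) (trans (sum-++ (map suc ν) (replicate k 1))
      (trans (cong₂ _+_ (sum-suc ν) (sum-ones k)) (rearrange (weight ν) (length ν) k))))
    (sym (ℕₚ.+-assoc x (length ν + k) (weight ν)))
    where
    sum-suc : ∀ xs → sum (map suc xs) ≡ sum xs + length xs
    sum-suc [] = refl
    sum-suc (x ∷ xs) = trans (cong suc (trans (cong (x +_) (sum-suc xs)) (sym (ℕₚ.+-assoc x (sum xs) (length xs)))))
      (sym (ℕₚ.+-suc (x + sum xs) (length xs)))
    sum-ones : ∀ k → sum (replicate k 1) ≡ k
    sum-ones zero = refl
    sum-ones (suc k) = cong suc (sum-ones k)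
    rearrange : ∀ a b c → a + b + c ≡ b + c + a
    rearrange a b c = trans (ℕₚ.+-assoc a b c) (ℕₚ.+-comm a (b + c))

  linked-≥ : ∀ {x xs} → All (_≤ x) xs → Linked _≥_ xs → Linked _≥_ (x ∷ xs)
  linked-≥ [] [] = [-]
  linked-≥ (p ∷ _) l@([-]) = p ∷ l
  linked-≥ (p ∷ _) l@(_ ∷ _) = p ∷ l

  linked-bound : ∀ {x xs} → Linked _≥_ (x ∷ xs) → All (_≤ x) xs
  linked-bound [-] = []
  linked-bound (p ∷ ps) = p ∷ All.map (λ q → ℕₚ.≤-trans q p) (linked-bound ps)

  wrap-partition : ∀ {x} k {ν} → 1 ≤ x → All (_< x) ν → IsPartition ν → IsPartition (wrap x k ν)
  wrap-partition {x} k {ν} 1≤x bound (pos , dec) = 1≤x ∷ Allₚ.++⁺ (Allₚ.map⁺ (All.map (λ _ → s≤s z≤n) pos)) (Allₚ.replicate⁺ k (s≤s z≤n))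
    , linked-≥ (Allₚ.++⁺ (Allₚ.map⁺ bound) (Allₚ.replicate⁺ k 1≤x)) (rest-linked ν dec)
    where
    ones-linked : ∀ k → Linked _≥_ (replicate k 1)
    ones-linked zero = []
    ones-linked (suc k) = linked-≥ (Allₚ.replicate⁺ k ℕₚ.≤-refl) (ones-linked k)
    rest-linked : ∀ ν → Linked _≥_ ν → Linked _≥_ (rest k ν)
    rest-linked [] _ = ones-linked k
    rest-linked (y ∷ ν) l = linked-≥ (Allₚ.++⁺ (Allₚ.map⁺ (All.map s≤s (linked-bound l))) (Allₚ.replicate⁺ k (s≤s z≤n))) (rest-linked ν (Linked.tail l))

  -- The partition with Durfee coordinates: for each l in ls (strictly decreasing), a principal hook with
  -- leg l − 1 and arm l − 1 + e, hence of length e + (2l − 1).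
  build : ℕ → List ℕ → List ℕ
  build e [] = []
  build e (l ∷ ls) = wrap (l + e) (l ∸ suc (length (build e ls))) (build e ls)

  hookLength : ℕ → ℕ → ℕ
  hookLength e l = (l + e) + (l ∸ 1)

  top : List ℕ → ℕ
  top [] = 0
  top (l ∷ _) = l

  top-< : ∀ {l ls} → 1 ≤ l → Linked _>_ (l ∷ ls) → top ls < l
  top-< 1≤l [-] = 1≤l
  top-< 1≤l (p ∷ _) = p

  module _ (e : ℕ) where
    record Built (ls : List ℕ) : Set where
      field
        isPartition : IsPartition (build e ls)
        length-top : length (build e ls) ≡ top ls
        parts-bounded : All (_≤ top ls + e) (build e ls)
        hooks : principalHooks (build e ls) ≡ map (hookLength e) ls
        weight-hooks : weight (build e ls) ≡ sum (map (hookLength e) ls)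

    -- The inequalities behind one step of `build`: `shorter` makes the truncated subtraction in `k`
    -- exact, and `bounded` keeps the new first row longer than every part of ν.
    record BuildStep (l : ℕ) (ls : List ℕ) : Set where
      field
        1≤l : 1 ≤ l
        built : Built ls
        bounded : All (_< l + e) (build e ls)
        shorter : length (build e ls) < l
      k : ℕ
      k = l ∸ suc (length (build e ls))
      total : suc (length (build e ls) + k) ≡ l
      total = ℕₚ.m+[n∸m]≡n shorter
      1≤x : 1 ≤ l + e
      1≤x = ℕₚ.≤-trans 1≤l (ℕₚ.m≤m+n l e)

    build-step : ∀ {l ls} → 1 ≤ l → Linked _>_ (l ∷ ls) → Built ls → BuildStep l ls
    build-step {l} {ls} 1≤l dec b = record
      { 1≤l = 1≤l ; built = b
      ; bounded = All.map (λ p → ℕₚ.≤-<-trans p (ℕₚ.+-monoˡ-< e (top-< 1≤l dec))) (Built.parts-bounded b)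
      ; shorter = ℕₚ.≤-<-trans (ℕₚ.≤-reflexive (Built.length-top b)) (top-< 1≤l dec) }

    built : ∀ {ls} → Linked _>_ ls → All (1 ≤_) ls → Built ls
    built-step : ∀ {l ls} → BuildStep l ls → Built (l ∷ ls)

    built {[]} _ _ = record { isPartition = [] , [] ; length-top = refl ; parts-bounded = [] ; hooks = refl ; weight-hooks = refl }
    built {l ∷ ls} dec (1≤l ∷ pos) = built-step (build-step 1≤l dec (built (Linked.tail dec) pos))

    built-step {l} {ls} st = record
      { isPartition = wrap-partition k 1≤x bounded (Built.isPartition b)
      ; length-top = trans (cong suc (length-rest k ν)) total
      ; parts-bounded = ℕₚ.≤-refl ∷ Allₚ.++⁺ (Allₚ.map⁺ bounded) (Allₚ.replicate⁺ k 1≤x)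
      ; hooks = trans (principalHooks-wrap k ν 1≤x bounded) (cong₂ _∷_ corner (Built.hooks b))
      ; weight-hooks = trans (weight-wrap (l + e) k ν) (cong₂ _+_ corner (Built.weight-hooks b)) }
      where
      open BuildStep st renaming (built to b)
      ν : List ℕ
      ν = build e ls
      corner : l + e + (length ν + k) ≡ hookLength e l
      corner = cong (l + e +_) (cong N.pred total)

    D-build : ∀ {ls} → Linked _>_ ls → All (1 ≤_) ls → D (build e ls) ≡ length ls
    D-build {ls} dec pos = trans (sym (Lₚ.length-map (λ i → hook (build e ls) i i) (diagIdx (build e ls))))
      (trans (cong length (Built.hooks (built dec pos))) (Lₚ.length-map (hookLength e) ls))

  -- Below the first row there are three zones: rows of ν, rows consisting of a single added cell,
  -- and empty rows. In the last two the row of ν is empty, and by induction so is its column.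
  build-selfConjugate : ∀ {ls} → Linked _>_ ls → All (1 ≤_) ls → SelfConjugate (build 0 ls)
  build-selfConjugate {[]} _ _ i = refl
  build-selfConjugate {l ∷ ls} dec (1≤l ∷ pos) = go
    where
    ν : List ℕ
    ν = build 0 ls
    open BuildStep (build-step 0 1≤l dec (built 0 (Linked.tail dec) pos))
    ih : SelfConjugate ν
    ih = build-selfConjugate (Linked.tail dec) pos
    x≡l : l + 0 ≡ l
    x≡l = ℕₚ.+-identityʳ l
    go : SelfConjugate (wrap (l + 0) k ν)
    go zero = trans x≡l (sym (trans (conj-wrap-1 k ν 1≤x) total))
    go (suc i) with ℕₚ.<-≤-connex i (length ν)
    ... | inj₁ i<ν = trans (idx-rest-low k ν i<ν) (trans (cong suc (ih i))
          (sym (conj-wrap-yes k ν (ℕₚ.≤-trans (s≤s i<ν) (ℕₚ.≤-trans shorter (ℕₚ.≤-reflexive (sym x≡l)))))))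
    ... | inj₂ ν≤i with ℕₚ.<-≤-connex i (length ν + k)
    ...   | inj₁ i<l = trans (idx-rest-mid k ν ν≤i i<l) (trans (cong suc (trans (sym (idx-beyond ν ν≤i)) (ih i)))
            (sym (conj-wrap-yes k ν (ℕₚ.≤-trans (s≤s i<l) (ℕₚ.≤-reflexive (trans total (sym x≡l)))))))
    ...   | inj₂ l≤i = trans (idx-rest-high k ν l≤i) (trans (trans (sym (idx-beyond ν ν≤i)) (ih i))
            (sym (conj-wrap-no k ν (λ p → ℕₚ.<⇒≱ (s≤s (s≤s l≤i)) (ℕₚ.≤-trans p (ℕₚ.≤-reflexive (trans x≡l (sym total))))))))

  -- The integers a of the definition are the entries l themselves: for e = 1 the arm is l and the
  -- leg is l - 1.
  build-doubledDistinct : ∀ {ls} → Linked _>_ ls → All (1 ≤_) ls → DoubledDistinct (build 1 ls)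
  build-doubledDistinct {[]} _ _ = inj₁ refl
  build-doubledDistinct {l₀ ∷ ls₀} dec₀ pos₀ = inj₂ (l₀ ∷ ls₀ , dec₀ , pos₀ , D-build 1 dec₀ pos₀ , coordinates dec₀ pos₀)
    where
    coordinates : ∀ {ls} → Linked _>_ ls → All (1 ≤_) ls → ∀ i → suc i ≤ length ls →
      (part (build 1 ls) (suc i) ≡ idx ls i + suc i) × (conjPart (build 1 ls) (suc i) + 1 ≡ idx ls i + suc i)
    coordinates {l ∷ ls} dec (1≤l ∷ pos) = go
      where
      ν : List ℕ
      ν = build 1 ls
      st : BuildStep 1 l ls
      st = build-step 1 1≤l dec (built 1 (Linked.tail dec) pos)
      open BuildStep st
      go : ∀ i → suc i ≤ suc (length ls) → (part (wrap (l + 1) k ν) (suc i) ≡ idx (l ∷ ls) i + suc i)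
           × (conjPart (wrap (l + 1) k ν) (suc i) + 1 ≡ idx (l ∷ ls) i + suc i)
      go zero _ = refl , cong (_+ 1) (trans (conj-wrap-1 k ν 1≤x) total)
      go (suc i) (s≤s i<) with coordinates (Linked.tail dec) pos i i<
      ... | p , c = trans (idx-rest-low k ν i<ν) (trans (cong suc p) (sym (ℕₚ.+-suc (idx ls i) (suc i))))
                  , trans (cong (_+ 1) (conj-wrap-yes k ν (ℕₚ.≤-trans (s≤s diag) (idx-All bounded i<ν))))
                      (trans (cong suc c) (sym (ℕₚ.+-suc (idx ls i) (suc i))))
        where
        diag : suc i ≤ part ν (suc i)
        diag = ℕₚ.≤-trans (ℕₚ.m≤n+m (suc i) (idx ls i)) (ℕₚ.≤-reflexive (sym p))
        i<ν : i < length ν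
        i<ν = part-length ν i diag

  -- At every diagonal cell the arm exceeds the leg by e. Both families satisfy this, with e = 0 and
  -- e = 1. The condition passes to the partition inside the outermost hook and still determines the
  -- first row from the first column.
  SymmetricUpTo : ℕ → List ℕ → Set
  SymmetricUpTo e λ′ = ∀ i → suc i ≤ part λ′ (suc i) → part λ′ (suc i) ≡ conjPart λ′ (suc i) + e

  unwrap-rest : ∀ xs → All (0 <_) xs → Linked _≥_ xs → Σ[ ν ∈ List ℕ ] Σ[ k ∈ ℕ ] (xs ≡ rest k ν × IsPartition ν)
  unwrap-rest [] _ _ = [] , 0 , refl , [] , []
  unwrap-rest (suc zero ∷ xs) (_ ∷ pos) dec = [] , suc (length xs) , cong (1 ∷_) (ones xs pos (linked-bound dec)) , [] , []
    where
    ones : ∀ xs → All (0 <_) xs → All (_≤ 1) xs → xs ≡ replicate (length xs) 1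
    ones [] _ _ = refl
    ones (suc zero ∷ xs) (_ ∷ pos) (_ ∷ bound) = cong (1 ∷_) (ones xs pos bound)
    ones (suc (suc _) ∷ xs) _ (s≤s () ∷ _)
  unwrap-rest (suc (suc y) ∷ xs) (_ ∷ pos) dec with unwrap-rest xs pos (Linked.tail dec)
  ... | ν , k , refl , posν , decν = suc y ∷ ν , k , refl , s≤s z≤n ∷ posν
      , linked-≥ (All.map ℕₚ.≤-pred (Allₚ.map⁻ (Allₚ.++⁻ˡ (map suc ν) (linked-bound dec)))) decν

  record Unwrapped (λ′ : List ℕ) : Set where
    field
      x k : ℕ
      ν : List ℕ
      wraps : λ′ ≡ wrap x k ν
      1≤x : 1 ≤ x
      bounded : All (_< x) ν
      isPartition : IsPartition ν

  unwrap : ∀ {x xs} → IsPartition (x ∷ xs) → Unwrapped (x ∷ xs)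
  unwrap {x} {xs} (1≤x ∷ pos , dec) with unwrap-rest xs pos (Linked.tail dec)
  ... | ν , k , refl , isν = record { x = x ; k = k ; ν = ν ; wraps = refl ; 1≤x = 1≤x
      ; bounded = Allₚ.map⁻ (Allₚ.++⁻ˡ (map suc ν) (linked-bound dec)) ; isPartition = isν }

  shorter-core : ∀ x k ν → suc (length ν) ≤ length (wrap x k ν)
  shorter-core x k ν = s≤s (ℕₚ.≤-trans (ℕₚ.m≤m+n (length ν) k) (ℕₚ.≤-reflexive (sym (length-rest k ν))))

  -- Links two ways of bounding an index: `SymmetricUpTo` speaks of the rows that reach the
  -- diagonal, `DoubledDistinct` of the indices up to the number of such rows. They agree because
  -- these rows come first.
  diagonal-≤-D : ∀ {λ′} → IsPartition λ′ → ∀ i → suc i ≤ part λ′ (suc i) → suc i ≤ D λ′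
  diagonal-≤-D {λ′} = go (length λ′) λ′ ℕₚ.≤-refl
    where
    go : ∀ b λ′ → length λ′ ≤ b → IsPartition λ′ → ∀ i → suc i ≤ part λ′ (suc i) → suc i ≤ D λ′
    go b [] _ _ i p = contradiction p λ ()
    go (suc b) (x₀ ∷ xs) len isλ i p with unwrap isλ
    go (suc b) (x₀ ∷ xs) len isλ zero p | record { x = x ; k = k ; ν = ν ; wraps = refl ; 1≤x = 1≤x } =
      subst (1 ≤_) (sym (D-wrap k ν 1≤x)) (s≤s z≤n)
    go (suc b) (x₀ ∷ xs) len isλ (suc i) p | record { x = x ; k = k ; ν = ν ; wraps = refl ; 1≤x = 1≤x ; isPartition = isν } =
      subst (suc (suc i) ≤_) (sym (D-wrap k ν 1≤x)) (s≤s (go b ν (ℕₚ.≤-pred (ℕₚ.≤-trans (shorter-core x k ν) len)) isν i (diag-shift⁻ x k ν i p)))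

  selfConjugate-symmetric : ∀ {λ′} → SelfConjugate λ′ → SymmetricUpTo 0 λ′
  selfConjugate-symmetric sc i _ = trans (sc i) (sym (ℕₚ.+-identityʳ _))

  doubledDistinct-symmetric : ∀ {λ′} → IsPartition λ′ → DoubledDistinct λ′ → SymmetricUpTo 1 λ′
  doubledDistinct-symmetric _ (inj₁ refl) i p = contradiction p λ ()
  doubledDistinct-symmetric isλ (inj₂ (as , _ , _ , D≡ , coords)) i p
    with coords i (subst (suc i ≤_) D≡ (diagonal-≤-D isλ i p))
  ... | part≡ , conj≡ = trans part≡ (sym conj≡)

  -- The outermost hook is peeled off: its l is the number of rows, and symmetry forces the first
  -- row to have length l + e. The inner partition is no subterm, so the recursion is on a bound for
  -- the number of rows; the bound on `ls` by that number makes the next l strictly larger.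
  symmetric-build : ∀ e {λ′} → IsPartition λ′ → SymmetricUpTo e λ′ →
    Σ[ ls ∈ List ℕ ] (Linked _>_ ls × All (1 ≤_) ls × λ′ ≡ build e ls)
  symmetric-build e {λ′} isλ symλ with go (length λ′) λ′ ℕₚ.≤-refl isλ symλ
    where
    go : ∀ b λ′ → length λ′ ≤ b → IsPartition λ′ → SymmetricUpTo e λ′ →
      Σ[ ls ∈ List ℕ ] (Linked _>_ ls × All (1 ≤_) ls × All (_≤ length λ′) ls × λ′ ≡ build e ls)
    go b [] _ _ _ = [] , [] , [] , [] , refl
    go (suc b) (x₀ ∷ xs) len isλ symλ with unwrap isλ
    ... | record { x = x ; k = k ; ν = ν ; wraps = refl ; 1≤x = 1≤x ; bounded = bounded ; isPartition = isν }
      with go b ν (ℕₚ.≤-pred (ℕₚ.≤-trans (shorter-core x k ν) len)) isν sym-ν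
      where
      sym-ν : SymmetricUpTo e ν
      sym-ν i p = ℕₚ.suc-injective (trans (sym (idx-rest-low k ν i<ν)) (trans (symλ (suc i) (diag-shift⁺ x k ν i p))
        (cong (_+ e) (conj-wrap-yes k ν (ℕₚ.≤-trans (s≤s p) (idx-All bounded i<ν))))))
        where
        i<ν : i < length ν
        i<ν = part-length ν i p
    ...   | ls , dec , pos , bound , ν≡ = l ∷ ls , ∷-decreasing (All.map s≤s (All.map (λ p → ℕₚ.≤-trans p (ℕₚ.m≤m+n (length ν) k)) bound)) dec
          , s≤s z≤n ∷ pos
          , subst (λ m → All (_≤ m) (l ∷ ls)) (sym (cong suc (length-rest k ν)))
              (ℕₚ.≤-refl ∷ All.map (λ p → ℕₚ.≤-trans p (ℕₚ.m≤n⇒m≤1+n (ℕₚ.m≤m+n (length ν) k))) bound)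
          , trans (cong₂ (λ a b → wrap a b ν) (trans (symλ 0 1≤x) (cong (_+ e) (conj-wrap-1 k ν 1≤x))) (sym (ℕₚ.m+n∸m≡n (length ν) k)))
              (cong (λ ν → wrap (l + e) (l ∸ suc (length ν)) ν) ν≡)
      where
      l : ℕ
      l = suc (length ν + k)
  ... | ls , dec , pos , _ , λ≡ = ls , dec , pos , λ≡

-- The bijection between finite sets and pairs of partitions.

module Pairs where
  open Partitions
  open N using (_+_; _≤_; _<_; _>_; _≟_)
  open ≡ using (refl; sym; trans; cong; cong₂; subst)
  open import Data.Nat.ListAction.Properties using (sum-++; sum-↭)
  open import Data.List.Membership.Propositional.Properties using (∈-++⁺ˡ; ∈-++⁺ʳ; deduplicate-∈⇔)
  open import Data.List.Membership.Propositional.Properties.WithK using (unique∧set⇒bag)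
  open import Data.List.Relation.Binary.BagAndSetEquality using (∼bag⇒↭)
  open import Data.List.Relation.Binary.Disjoint.Propositional using (Disjoint)
  open Perm using (↭-trans)
  open import Data.List.Relation.Binary.Permutation.Propositional.Properties using (↭-length)
  open All using (All; []; _∷_)
  import Data.List.Relation.Unary.AllPairs as AllPairs
  open import Data.List.Relation.Unary.Linked as Linked using (Linked; []; [-]; _∷_)
  import Data.List.Relation.Unary.Linked.Properties as Linkedₚ
  open import Data.List.Relation.Unary.Unique.DecPropositional.Properties _≟_ using (deduplicate-!)
  open import Data.Sum using (_⊎_)

  down : ℕ → List ℕ
  down zero = []
  down (suc m) = suc m ∷ down m

  down-bounded : ∀ m → All (_≤ m) (down m)
  down-bounded zero = []
  down-bounded (suc m) = ℕₚ.≤-refl ∷ All.map ℕₚ.m≤n⇒m≤1+n (down-bounded m)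

  down-positive : ∀ m → All (1 ≤_) (down m)
  down-positive zero = []
  down-positive (suc m) = s≤s z≤n ∷ down-positive m

  down-decreasing : ∀ m → Linked _>_ (down m)
  down-decreasing zero = []
  down-decreasing (suc m) = ∷-decreasing (All.map s≤s (down-bounded m)) (down-decreasing m)

  ∈-down : ∀ m {a} → 1 ≤ a → a ≤ m → a ∈ down m
  ∈-down zero 1≤a a≤0 = contradiction (ℕₚ.≤-trans 1≤a a≤0) λ ()
  ∈-down (suc m) {a} 1≤a a≤1+m with a ≟ suc m
  ... | yes refl = here refl
  ... | no a≢ = there (∈-down m 1≤a (ℕₚ.≤-pred (ℕₚ.≤∧≢⇒< a≤1+m a≢)))

  decreasing-unique : ∀ {xs} → Linked _>_ xs → Unique xs
  decreasing-unique dec = AllPairs.map ℕₚ.>⇒≢ (Linkedₚ.Linked⇒AllPairs (λ p q → ℕₚ.<-trans q p) dec)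

  decreasing-≡ : ∀ {xs ys} → Linked _>_ xs → Linked _>_ ys → (∀ {a} → a ∈ xs → a ∈ ys) → (∀ {a} → a ∈ ys → a ∈ xs) → xs ≡ ys
  decreasing-≡ {[]} {[]} _ _ _ _ = refl
  decreasing-≡ {[]} {y ∷ ys} _ _ _ from = contradiction (from (here refl)) λ ()
  decreasing-≡ {x ∷ xs} {[]} _ _ to _ = contradiction (to (here refl)) λ ()
  decreasing-≡ {x ∷ xs} {y ∷ ys} dx dy to from = cong₂ _∷_ x≡y
    (decreasing-≡ (Linked.tail dx) (Linked.tail dy) (strip dx (sym x≡y) to) (strip dy x≡y from))
    where
    ≤-head : ∀ {x xs a} → Linked _>_ (x ∷ xs) → a ∈ x ∷ xs → a ≤ x
    ≤-head _ (here refl) = ℕₚ.≤-refl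
    ≤-head d (there p) = ℕₚ.<⇒≤ (All.lookup (decreasing-head d) p)
    x≡y : x ≡ y
    x≡y = ℕₚ.≤-antisym (≤-head dy (to (here refl))) (≤-head dx (from (here refl)))
    strip : ∀ {x y xs ys} → Linked _>_ (x ∷ xs) → y ≡ x → (∀ {a} → a ∈ x ∷ xs → a ∈ y ∷ ys) → ∀ {a} → a ∈ xs → a ∈ ys
    strip d refl f p with f (there p)
    ... | here refl = contradiction (All.lookup (decreasing-head d) p) (ℕₚ.<-irrefl refl)
    ... | there q = q

  set⇒↭ : ∀ {a} {A : Set a} {xs ys : List A} → Unique xs → Unique ys → (∀ {a} → a ∈ xs → a ∈ ys) → (∀ {a} → a ∈ ys → a ∈ xs) → xs ↭ ys
  set⇒↭ ux uy to from = ∼bag⇒↭ (unique∧set⇒bag ux uy (mk⇔ to from))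

  ≤-sum : ∀ {a xs} → a ∈ xs → a ≤ sum xs
  ≤-sum {xs = x ∷ xs} (here refl) = ℕₚ.m≤m+n x (sum xs)
  ≤-sum {xs = x ∷ xs} (there p) = ℕₚ.≤-trans (≤-sum p) (ℕₚ.m≤n+m (sum xs) x)

  hookLength-mono : ∀ e {a b} → a < b → hookLength e a < hookLength e b
  hookLength-mono e p = ℕₚ.+-mono-<-≤ (ℕₚ.+-monoˡ-< e p) (ℕₚ.∸-monoˡ-≤ 1 (ℕₚ.<⇒≤ p))

  hookLength-injective : ∀ e {a b} → hookLength e a ≡ hookLength e b → a ≡ b
  hookLength-injective e {a} {b} eq with ℕₚ.<-cmp a b
  ... | tri< a<b _ _ = contradiction eq (ℕₚ.<⇒≢ (hookLength-mono e a<b))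
  ... | tri≈ _ a≡b _ = a≡b
  ... | tri> _ _ b<a = contradiction (sym eq) (ℕₚ.<⇒≢ (hookLength-mono e b<a))

  ≤-hookLength : ∀ e l → l ≤ hookLength e l
  ≤-hookLength e l = ℕₚ.≤-trans (ℕₚ.m≤m+n l e) (ℕₚ.m≤m+n (l + e) (l ∸ 1))

  hookLength-odd : ∀ a → hookLength 0 (suc a) ≡ suc (a + a)
  hookLength-odd a = cong (λ b → suc (b + a)) (ℕₚ.+-identityʳ a)

  hookLength-even : ∀ a → hookLength 1 (suc a) ≡ suc (suc (a + a))
  hookLength-even a = cong (λ b → suc (b + a)) (ℕₚ.+-comm a 1)

  double≢odd : ∀ a b → a + a ≢ suc (b + b)
  double≢odd (suc a) b e = double≢odd b a (sym (trans (sym (ℕₚ.+-suc a a)) (ℕₚ.suc-injective e)))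

  parity : ∀ {a b} → 1 ≤ a → 1 ≤ b → hookLength 0 a ≢ hookLength 1 b
  parity {suc a} {suc b} _ _ e = double≢odd a b
    (ℕₚ.suc-injective (trans (sym (hookLength-odd a)) (trans e (hookLength-even b))))

  hookLength-cover : ∀ h → 1 ≤ h → Σ[ l ∈ ℕ ] 1 ≤ l × (h ≡ hookLength 0 l ⊎ h ≡ hookLength 1 l)
  hookLength-cover (suc zero) _ = 1 , s≤s z≤n , inj₁ refl
  hookLength-cover (suc (suc zero)) _ = 1 , s≤s z≤n , inj₂ refl
  hookLength-cover (suc (suc (suc h))) _ with hookLength-cover (suc h) (s≤s z≤n)
  ... | suc l , _ , inj₁ e = suc (suc l) , s≤s z≤n , inj₁ (trans (cong (suc ∘ suc) e) (sym (step 0)))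
    where
    step : ∀ e → hookLength e (suc (suc l)) ≡ suc (suc (hookLength e (suc l)))
    step e = cong suc (ℕₚ.+-suc (suc (l + e)) l)
  ... | suc l , _ , inj₂ e = suc (suc l) , s≤s z≤n , inj₂ (trans (cong (suc ∘ suc) e) (sym (step 1)))
    where
    step : ∀ e → hookLength e (suc (suc l)) ≡ suc (suc (hookLength e (suc l)))
    step e = cong suc (ℕₚ.+-suc (suc (l + e)) l)

  -- The odd elements 2l − 1 (e = 0) or the even elements 2l (e = 1) of Δ, recorded by l.
  coordinates : ℕ → ℕ → List ℕ → List ℕ
  coordinates m e Δ = filter (λ l → hookLength e l ∈? Δ) (down m)

  module _ (m e : ℕ) (Δ : List ℕ) where
    coordinates-decreasing : Linked _>_ (coordinates m e Δ)
    coordinates-decreasing = Linkedₚ.filter⁺ (λ l → hookLength e l ∈? Δ) (λ p q → ℕₚ.<-trans q p) (down-decreasing m)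

    coordinates⁻ : ∀ {l} → l ∈ coordinates m e Δ → 1 ≤ l × hookLength e l ∈ Δ
    coordinates⁻ l∈ with ∈-filter⁻ (λ l → hookLength e l ∈? Δ) {xs = down m} l∈
    ... | p , q = All.lookup (down-positive m) p , q

    coordinates⁺ : ∀ {l} → 1 ≤ l → hookLength e l ≤ m → hookLength e l ∈ Δ → l ∈ coordinates m e Δ
    coordinates⁺ {l} 1≤l h≤m h∈ = ∈-filter⁺ (λ l → hookLength e l ∈? Δ) (∈-down m 1≤l (ℕₚ.≤-trans (≤-hookLength e l) h≤m)) h∈

    coordinates-positive : All (1 ≤_) (coordinates m e Δ)
    coordinates-positive = All.tabulate (proj₁ ∘ coordinates⁻)

  pairOf : ℕ → List ℕ → List ℕ × List ℕ
  pairOf m Δ = build 0 (coordinates m 0 Δ) , build 1 (coordinates m 1 Δ)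

  allHooks : List ℕ × List ℕ → List ℕ
  allHooks (λ′ , μ) = principalHooks λ′ ++ principalHooks μ

  Admissible : ℕ → List ℕ × List ℕ → Set
  Admissible n p = IsPartition (proj₁ p) × SelfConjugate (proj₁ p) ×
                   IsPartition (proj₂ p) × DoubledDistinct (proj₂ p) × weight (proj₁ p) + weight (proj₂ p) ≡ n

  built-coordinates : ∀ m e Δ → Built e (coordinates m e Δ)
  built-coordinates m e Δ = built e (coordinates-decreasing m e Δ) (coordinates-positive m e Δ)

  allHooks-map : ∀ m Δ → allHooks (pairOf m Δ) ≡ map (hookLength 0) (coordinates m 0 Δ) ++ map (hookLength 1) (coordinates m 1 Δ)
  allHooks-map m Δ = cong₂ _++_ (Built.hooks (built-coordinates m 0 Δ)) (Built.hooks (built-coordinates m 1 Δ))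

  module _ (m : ℕ) {Δ : List ℕ} (Δ∈ : Δ ∈ subsets m) where

    -- Odd hook lengths are listed before even ones, so the order of Δ is lost. Parity makes the two
    -- halves disjoint, and every positive integer is 2l - 1 or 2l.
    allHooks-↭ : allHooks (pairOf m Δ) ↭ Δ
    allHooks-↭ = subst (_↭ Δ) (sym (allHooks-map m Δ))
      (set⇒↭ (Uniqueₚ.++⁺ (unique 0) (unique 1) disjoint) (decreasing-unique (subsets-decreasing m Δ∈)) to from)
      where
      unique : ∀ e → Unique (map (hookLength e) (coordinates m e Δ))
      unique e = Uniqueₚ.map⁺ (hookLength-injective e) (decreasing-unique (coordinates-decreasing m e Δ))
      disjoint : Disjoint (map (hookLength 0) (coordinates m 0 Δ)) (map (hookLength 1) (coordinates m 1 Δ))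
      disjoint (p , q) with ∈-map⁻ (hookLength 0) p | ∈-map⁻ (hookLength 1) q
      ... | a , a∈ , refl | b , b∈ , e = parity (proj₁ (coordinates⁻ m 0 Δ a∈)) (proj₁ (coordinates⁻ m 1 Δ b∈)) e
      part-to : ∀ e {h} → h ∈ map (hookLength e) (coordinates m e Δ) → h ∈ Δ
      part-to e p with ∈-map⁻ (hookLength e) p
      ... | l , l∈ , refl = proj₂ (coordinates⁻ m e Δ l∈)
      to : ∀ {h} → h ∈ map (hookLength 0) (coordinates m 0 Δ) ++ map (hookLength 1) (coordinates m 1 Δ) → h ∈ Δ
      to h∈ with ∈-++⁻ (map (hookLength 0) (coordinates m 0 Δ)) h∈
      ... | inj₁ p = part-to 0 p
      ... | inj₂ q = part-to 1 q
      part-from : ∀ e {l} → 1 ≤ l → hookLength e l ∈ Δ → hookLength e l ∈ map (hookLength e) (coordinates m e Δ)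
      part-from e 1≤l h∈ = ∈-map⁺ (hookLength e) (coordinates⁺ m e Δ 1≤l (All.lookup (subsets-bounded m Δ∈) h∈) h∈)
      from : ∀ {h} → h ∈ Δ → h ∈ map (hookLength 0) (coordinates m 0 Δ) ++ map (hookLength 1) (coordinates m 1 Δ)
      from {h} h∈ with hookLength-cover h (All.lookup (subsets-positive m Δ∈) h∈)
      ... | l , 1≤l , inj₁ refl = ∈-++⁺ˡ (part-from 0 1≤l h∈)
      ... | l , 1≤l , inj₂ refl = ∈-++⁺ʳ (map (hookLength 0) (coordinates m 0 Δ)) (part-from 1 1≤l h∈)

    weight-pairOf : weight (proj₁ (pairOf m Δ)) + weight (proj₂ (pairOf m Δ)) ≡ sum Δ
    weight-pairOf = trans (cong₂ _+_ (Built.weight-hooks (built-coordinates m 0 Δ)) (Built.weight-hooks (built-coordinates m 1 Δ)))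
      (trans (sym (sum-++ (map (hookLength 0) (coordinates m 0 Δ)) _)) (trans (cong sum (sym (allHooks-map m Δ))) (sum-↭ allHooks-↭)))

    pairOf-admissible : Admissible (sum Δ) (pairOf m Δ)
    pairOf-admissible = Built.isPartition (built-coordinates m 0 Δ)
      , build-selfConjugate (coordinates-decreasing m 0 Δ) (coordinates-positive m 0 Δ)
      , Built.isPartition (built-coordinates m 1 Δ)
      , build-doubledDistinct (coordinates-decreasing m 1 Δ) (coordinates-positive m 1 Δ)
      , weight-pairOf

    D-pairOf : D (proj₁ (pairOf m Δ)) + D (proj₂ (pairOf m Δ)) ≡ length Δ
    D-pairOf = trans (cong₂ _+_ (as-hooks (proj₁ (pairOf m Δ))) (as-hooks (proj₂ (pairOf m Δ))))
      (trans (sym (Lₚ.length-++ (principalHooks (proj₁ (pairOf m Δ))))) (↭-length allHooks-↭))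
      where
      as-hooks : ∀ λ′ → D λ′ ≡ length (principalHooks λ′)
      as-hooks λ′ = sym (Lₚ.length-map (λ i → hook λ′ i i) (diagIdx λ′))

    Δset-↭ : Δset (proj₁ (pairOf m Δ)) (proj₂ (pairOf m Δ)) ↭ Δ
    Δset-↭ = set⇒↭ (deduplicate-! _) (decreasing-unique (subsets-decreasing m Δ∈))
      (∈-resp-↭ allHooks-↭ ∘ Equivalence.from (deduplicate-∈⇔ _≟_))
      (Equivalence.to (deduplicate-∈⇔ _≟_) ∘ ∈-resp-↭ (↭-sym allHooks-↭))

  -- The principal hooks of the pair recover Δ up to order, and a strictly decreasing list is
  -- determined by its elements.
  pairOf-injective : ∀ m {Δ Δ′} → Δ ∈ subsets m → Δ′ ∈ subsets m → pairOf m Δ ≡ pairOf m Δ′ → Δ ≡ Δ′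
  pairOf-injective m {Δ} {Δ′} p q e = decreasing-≡ (subsets-decreasing m p) (subsets-decreasing m q) (∈-resp-↭ Δ↭Δ′) (∈-resp-↭ (↭-sym Δ↭Δ′))
    where
    Δ↭Δ′ : Δ ↭ Δ′
    Δ↭Δ′ = ↭-trans (↭-sym (allHooks-↭ m p)) (subst (λ r → allHooks r ↭ Δ′) (sym e) (allHooks-↭ m q))

  -- Δ is obtained by sifting m, ..., 1 for hook lengths of the pair, which puts them in decreasing
  -- order. None is missed, since each is at most their sum n ≤ m.
  pairOf-surjective : ∀ {n} m → n ≤ m → ∀ p → Admissible n p → Σ[ Δ ∈ List ℕ ] (Δ ∈ subsets m × p ≡ pairOf m Δ)
  pairOf-surjective {n} m n≤m (λ′ , μ) (isλ , sc , isμ , dd , w≡n)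
    with symmetric-build 0 isλ (selfConjugate-symmetric {λ′} sc) | symmetric-build 1 isμ (doubledDistinct-symmetric {μ} isμ dd)
  ... | lo , dec₀ , pos₀ , refl | le , dec₁ , pos₁ , refl = Δ
      , ∈-subsets m (Linkedₚ.filter⁺ (_∈? H) (λ p q → ℕₚ.<-trans q p) (down-decreasing m))
          (All.tabulate (λ p → All.lookup (down-positive m) (proj₁ (∈Δ⁻ p))))
          (All.tabulate (λ p → All.lookup (down-bounded m) (proj₁ (∈Δ⁻ p))))
      , cong₂ (λ a b → build 0 a , build 1 b)
          (decreasing-≡ dec₀ (coordinates-decreasing m 0 Δ) (to 0 (All.lookup pos₀) (∈-++⁺ˡ ∘ ∈-map⁺ (hookLength 0)))
            (λ l∈ → case₀ (coordinates⁻ m 0 Δ l∈)))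
          (decreasing-≡ dec₁ (coordinates-decreasing m 1 Δ) (to 1 (All.lookup pos₁) (∈-++⁺ʳ (map (hookLength 0) lo) ∘ ∈-map⁺ (hookLength 1)))
            (λ l∈ → case₁ (coordinates⁻ m 1 Δ l∈)))
    where
    H Δ : List ℕ
    H = map (hookLength 0) lo ++ map (hookLength 1) le
    Δ = filter (_∈? H) (down m)
    ∈Δ⁻ : ∀ {a} → a ∈ Δ → a ∈ down m × a ∈ H
    ∈Δ⁻ = ∈-filter⁻ (_∈? H) {xs = down m}
    sum-H : sum H ≡ n
    sum-H = trans (sum-++ (map (hookLength 0) lo) (map (hookLength 1) le))
      (trans (sym (cong₂ _+_ (Built.weight-hooks (built 0 dec₀ pos₀)) (Built.weight-hooks (built 1 dec₁ pos₁)))) w≡n)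
    H≤m : ∀ {a} → a ∈ H → a ≤ m
    H≤m a∈ = ℕₚ.≤-trans (≤-sum a∈) (ℕₚ.≤-trans (ℕₚ.≤-reflexive sum-H) n≤m)
    to : ∀ e {ls} → (∀ {l} → l ∈ ls → 1 ≤ l) → (∀ {l} → l ∈ ls → hookLength e l ∈ H) → ∀ {l} → l ∈ ls → l ∈ coordinates m e Δ
    to e pos h∈ {l} l∈ = coordinates⁺ m e Δ (pos l∈) (H≤m (h∈ l∈))
      (∈-filter⁺ (_∈? H) (∈-down m (ℕₚ.≤-trans (pos l∈) (≤-hookLength e l)) (H≤m (h∈ l∈))) (h∈ l∈))
    case₀ : ∀ {l} → 1 ≤ l × hookLength 0 l ∈ Δ → l ∈ lo
    case₀ (1≤l , h∈) with ∈-++⁻ (map (hookLength 0) lo) (proj₂ (∈Δ⁻ h∈))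
    ... | inj₁ p with ∈-map⁻ (hookLength 0) p
    ...   | a , a∈ , e = subst (_∈ lo) (sym (hookLength-injective 0 e)) a∈
    case₀ (1≤l , h∈) | inj₂ q with ∈-map⁻ (hookLength 1) q
    ...   | a , a∈ , e = contradiction e (parity 1≤l (All.lookup pos₁ a∈))
    case₁ : ∀ {l} → 1 ≤ l × hookLength 1 l ∈ Δ → l ∈ le
    case₁ (1≤l , h∈) with ∈-++⁻ (map (hookLength 0) lo) (proj₂ (∈Δ⁻ h∈))
    ... | inj₂ q with ∈-map⁻ (hookLength 1) q
    ...   | a , a∈ , e = subst (_∈ le) (sym (hookLength-injective 1 e)) a∈
    case₁ (1≤l , h∈) | inj₁ p with ∈-map⁻ (hookLength 0) p
    ...   | a , a∈ , e = contradiction (sym e) (parity (All.lookup pos₀ a∈) 1≤l)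

open Pairs

pairs : ℕ → ℕ → List (List ℕ × List ℕ)
pairs m n = map (pairOf m) (filter (λ Δ → sum Δ N.≟ n) (subsets m))

pairs-unique : ∀ m n → Unique (pairs m n)
pairs-unique m n = map-unique (λ p → proj₁ (∈-filter⁻ (λ Δ → sum Δ N.≟ n) {xs = subsets m} p)) (Uniqueₚ.filter⁺ (λ Δ → sum Δ N.≟ n) (subsets-unique m))
  where
  map-unique : ∀ {Δs} → (∀ {Δ} → Δ ∈ Δs → Δ ∈ subsets m) → Unique Δs → Unique (map (pairOf m) Δs)
  map-unique _ [] = []
  map-unique sub (d ∷ ds) = Allₚ.map⁺ (All.tabulate (λ q e →
      All.lookup d q (pairOf-injective m (sub (here ≡.refl)) (sub (there q)) e))) ∷ map-unique (sub ∘ there) ds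

pairs-↭ : ∀ {m n ps} → n N.≤ m → Unique ps → (∀ p → (p ∈ ps) ⇔ Admissible n p) → ps ↭ pairs m n
pairs-↭ {m} {n} {ps} n≤m unique char = set⇒↭ unique (pairs-unique m n) to from
  where
  to : ∀ {p} → p ∈ ps → p ∈ pairs m n
  to {p} p∈ with Equivalence.to (char p) p∈
  ... | adm with pairOf-surjective m n≤m p adm
  ...   | Δ , Δ∈ , ≡.refl = ∈-map⁺ (pairOf m) (∈-filter⁺ (λ Δ → sum Δ N.≟ n) Δ∈
            (≡.trans (≡.sym (weight-pairOf m Δ∈)) (proj₂ (proj₂ (proj₂ (proj₂ adm))))))
  from : ∀ {p} → p ∈ pairs m n → p ∈ ps
  from {p} p∈ with ∈-map⁻ (pairOf m) p∈
  ... | Δ , q , ≡.refl with ∈-filter⁻ (λ Δ → sum Δ N.≟ n) {xs = subsets m} q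
  ...   | Δ∈ , ≡.refl = Equivalence.from (char p) (pairOf-admissible m Δ∈)

-- From subsets to pairs of partitions, and from natural t to all t.

module PairSum {c ℓ} (R : CommutativeRing c ℓ) (inv : ℕ → CommutativeRing.Carrier R)
  (inv-suc : Reciprocals R inv) where
  open Kit R inv
  open PowerSeries R inv
  open Coefficients R inv inv-suc
  open SumR R inv
  open Poly R inv inv-suc
  open Relation.Binary.Reasoning.Setoid setoid

  sumR-↭ : ∀ {A : Set} {xs ys : List A} (f : A → Carrier) → xs ↭ ys → sumR (map f xs) ≈ sumR (map f ys)
  sumR-↭ f Perm.refl = refl
  sumR-↭ f (Perm.prep x p) = +-congˡ (sumR-↭ f p)
  sumR-↭ f (Perm.swap x y p) = trans (+-congˡ (+-congˡ (sumR-↭ f p))) (solve 3 (λ a b c → a :+ (b :+ c) := b :+ (a :+ c)) refl _ _ _)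
  sumR-↭ f (Perm.trans p q) = trans (sumR-↭ f p) (sumR-↭ f q)

  prodR-↭ : ∀ {xs ys : List ℕ} (f : ℕ → Carrier) → xs ↭ ys → prodR (map f xs) ≈ prodR (map f ys)
  prodR-↭ f Perm.refl = refl
  prodR-↭ f (Perm.prep x p) = *-congˡ (prodR-↭ f p)
  prodR-↭ f (Perm.swap x y p) = trans (*-congˡ (*-congˡ (prodR-↭ f p))) (solve 3 (λ a b c → a :* (b :* c) := b :* (a :* c)) refl _ _ _)
  prodR-↭ f (Perm.trans p q) = trans (prodR-↭ f p) (prodR-↭ f q)

  prodR-cong : ∀ (xs : List ℕ) {f g : ℕ → Carrier} → (∀ a → f a ≈ g a) → prodR (map f xs) ≈ prodR (map g xs)
  prodR-cong [] e = refl
  prodR-cong (x ∷ xs) e = *-cong (e x) (prodR-cong xs e)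

  sign-+ : ∀ a b → sign a * sign b ≈ sign (a N.+ b)
  sign-+ zero b = *-identityˡ _
  sign-+ (suc a) b = trans (*-assoc _ _ _) (*-congˡ (sign-+ a b))

  hookFactor-↭ : ∀ t {Δ Δ′} → Δ ↭ Δ′ → ∀ h → hookFactor t Δ h ≈ hookFactor t Δ′ h
  hookFactor-↭ t {Δ} {Δ′} p h = *-congˡ (prodR-cong (oneTo (h ∸ 1)) (λ j →
    reflexive (≡.cong (λ s → 1# - powR ((ι 2 * t + ι 2) * inv s) 2) (same j))))
    where
    same : ∀ j → shift Δ h j ≡ shift Δ′ h j
    same j rewrite does-⇔ (mk⇔ (∈-resp-↭ p) (∈-resp-↭ (↭-sym p))) (j ∈? Δ) (j ∈? Δ′) = ≡.refl

  term-pairOf : ∀ t m {Δ} → Δ ∈ subsets m → term t (pairOf m Δ) ≈ hookWeight t Δ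
  term-pairOf t m {Δ} Δ∈ = *-cong
    (trans (sign-+ (D (proj₁ (pairOf m Δ))) (D (proj₂ (pairOf m Δ)))) (reflexive (≡.cong sign (D-pairOf m Δ∈))))
    (trans (prodR-cong (Δset (proj₁ (pairOf m Δ)) (proj₂ (pairOf m Δ))) (hookFactor-↭ t (Δset-↭ m Δ∈)))
      (prodR-↭ (hookFactor t Δ) (Δset-↭ m Δ∈)))

  sum-filter : ∀ (w : List ℕ → Carrier) n Δs →
    sumR (map (λ Δ → (X^ sum Δ) n * w Δ) Δs) ≈ sumR (map w (filter (λ Δ → sum Δ N.≟ n) Δs))
  sum-filter w n [] = refl
  sum-filter w n (Δ ∷ Δs) with sum Δ N.≟ n
  ... | yes e = trans (+-cong (trans (*-congʳ (trans (reflexive (≡.cong (X^ sum Δ) (≡.sym e))) (X^-diag (sum Δ)))) (*-identityˡ _)) (sum-filter w n Δs))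
    (reflexive (≡.cong (sumR ∘ map w) (≡.sym (Lₚ.filter-accept (λ Δ → sum Δ N.≟ n) {Δ} {Δs} e))))
  ... | no ne = trans (+-cong (trans (*-congʳ (X^-off (sum Δ) n ne)) (zeroˡ _)) (sum-filter w n Δs))
    (trans (+-identityˡ _) (reflexive (≡.cong (sumR ∘ map w) (≡.sym (Lₚ.filter-reject (λ Δ → sum Δ N.≟ n) {Δ} {Δs} ne)))))

  sum-pairs : ∀ t m n → sumR (map (λ Δ → (X^ sum Δ) n * hookWeight t Δ) (subsets m)) ≈ sumR (map (term t) (pairs m n))
  sum-pairs t m n = begin
    sumR (map (λ Δ → (X^ sum Δ) n * hookWeight t Δ) (subsets m))
      ≈⟨ sum-filter (hookWeight t) n (subsets m) ⟩
    sumR (map (hookWeight t) Δs)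
      ≈⟨ sumR-cong Δs (λ q → term-pairOf t m (proj₁ (∈-filter⁻ (λ Δ → sum Δ N.≟ n) {xs = subsets m} q))) ⟨
    sumR (map (term t ∘ pairOf m) Δs)
      ≡⟨ sumR-map (pairOf m) Δs (term t) ⟨
    sumR (map (term t) (pairs m n)) ∎
    where
    Δs : List (List ℕ)
    Δs = filter (λ Δ → sum Δ N.≟ n) (subsets m)

  identity : ∀ t n ps → Unique ps → (∀ p → (p ∈ ps) ⇔ Admissible n p) → lhs t n ≈ sumR (map (term t) ps)
  -- Starting at 3n + 1 rather than 3n makes every k a successor even for n = 0, the form in which
  -- `lhs-natural` takes t.
  identity t n ps unique char = polynomial-unique (poly-lhs n) (poly-sum ps poly-term) (suc 3n) natural t
    where
    3n : ℕ
    3n = n N.+ (n N.+ n)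
    natural : ∀ k → suc 3n N.≤ k → lhs (ι k) n ≈ sumR (map (term (ι k)) ps)
    natural (suc t′) (s≤s 3n≤t′) = begin
      lhs (ι (suc t′)) n
        ≈⟨ lhs-natural n t′ (ℕₚ.m≤n⇒m≤1+n 3n≤t′) ⟩
      sumR (map (λ Δ → (X^ sum Δ) n * hookWeight (ι (suc t′)) Δ) (subsets (suc t′)))
        ≈⟨ sum-pairs (ι (suc t′)) (suc t′) n ⟩
      sumR (map (term (ι (suc t′))) (pairs (suc t′) n))
        ≈⟨ sumR-↭ (term (ι (suc t′))) (pairs-↭ (ℕₚ.≤-trans (ℕₚ.m≤m+n n (n N.+ n)) (ℕₚ.m≤n⇒m≤1+n 3n≤t′)) unique char) ⟨
      sumR (map (term (ι (suc t′))) ps) ∎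

theorem3p9 : ∀ {c ℓ : Level} (R : CommutativeRing c ℓ)
    (inv : ℕ → CommutativeRing.Carrier R) →
    let open CommutativeRing R
        open RingDefs R inv
    in (∀ n → fromℕ (suc n) * inv (suc n) ≈ 1#) →
       ∀ (t : Carrier) (n : ℕ) (ps : List (List ℕ × List ℕ)) →
       Unique ps →
       (∀ p → (p ∈ ps) ⇔ (IsPartition (proj₁ p) × SelfConjugate (proj₁ p) ×
                          IsPartition (proj₂ p) × DoubledDistinct (proj₂ p) ×
                          weight (proj₁ p) N.+ weight (proj₂ p) ≡ n)) →
       lhs t n ≈ sumR (map (term t) ps)
theorem3p9 R inv inv-suc = PairSum.identity R inv inv-suc
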